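{- Let $\mathbf{A}$ be a finite simple non-abelian loop with identity $e$, let $V$ be the variety generated by $\mathbf{A}$, and let $W$ be the variety generated by all proper subloops of $\mathbf{A}$. (1) The free loop $\mathbf{F}$ of countable (infinite) rank in $V$ has a normal subloop $N$ and a subloop $H$ such that: (a) $N\cong(\mathbf{A}^{\mathbf{B}})^x_e$, where $\mathbf{B}$ is the countable atomless Boolean algebra and $x\in 2^\omega$; (b) $H$ is isomorphic to the free loop of countable (infinite) rank in $W$; (c) $N\cap H=\{e\}$ (the trivial subloop of $\mathbf{F}$) and $F=NH$. (2) Every countable loop $\mathbf{C}$ in $V$ is a split extension of a filtered Boolean power $(\mathbf{A}^{\mathbf{B}})^x_e$, for some Boolean algebra $\mathbf{B}$ (and some point $x$ of its Stone space), by some loop in $W$.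
   Context: Loops are regarded as algebras in the sense of universal algebra (with multiplication, left and right division and identity); every loop is a Mal'cev algebra. A loop is abelian in the sense of commutator theory iff its basic operations can be represented as affine functions over a module, i.e. iff it is an abelian group; otherwise it is non-abelian. A loop $\mathbf{C}$ is a split extension of a normal subloop $N$ by a subloop $H$ if $H$ is a transversal through the cosets of $N$ in $\mathbf{C}$. The Stone space $X$ of a Boolean algebra $\mathbf{B}$ is its set of ultrafilters with basic open sets $\{x\in X : b\in x\}$, $b\in B$. The countable atomless Boolean algebra is unique up to isomorphism and its Stone space is the Cantor space $2^\omega$. The Boolean power $\mathbf{A}^{\mathbf{B}}$ is the subalgebra of the direct power $\mathbf{A}^X$ whose elements are the continuous functions $f\colon X\to A$, where $A$ is discrete. For $x\in X$, the filtered Boolean power $(\mathbf{A}^{\mathbf{B}})^x_e$ is the subalgebra of $\mathbf{A}^{\mathbf{B}}$ with universe $\{f\in A^{\mathbf{B}} : f(x)=e\}$. -}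

module Defs where

open import Algebra.Bundles using (Loop)
open import Algebra.Lattice.Bundles using (BooleanAlgebra)
import Algebra.Lattice.Properties.BooleanAlgebra as BooleanAlgebraProperties
open import Algebra.Morphism.Structures using (module LoopMorphisms)
open import Algebra.Structures using (IsAbelianGroup)
open import Data.Fin.Base using (Fin)
open import Data.Nat.Base using (ℕ)
open import Data.Product.Base using (Σ; Σ-syntax; ∃; ∃-syntax; _×_; _,_; proj₁; proj₂)
open import Data.Sum.Base using (_⊎_)
open import Data.Unit.Base using (⊤)
open import Function.Bundles using (Inverse; Surjection)
open import Level using (Level; 0ℓ; _⊔_; suc)
open import Relation.Binary.Bundles using (Setoid)
import Relation.Binary.Construct.NaturalOrder.Left as NaturalOrder
import Relation.Binary.PropositionalEquality as ≡
open import Relation.Nullary.Negation using (¬_)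
open import Relation.Unary using (Pred; _≐_)

private
  variable
    a b c i p q x ℓ ℓ₁ ℓ₂ : Level

IsFinite : Setoid a ℓ → Set (a ⊔ ℓ)
IsFinite S = ∃[ n ] Inverse S (≡.setoid (Fin n))

-- For inhabited S: finite or countably infinite.
IsCountable : Setoid a ℓ → Set (a ⊔ ℓ)
IsCountable S = Surjection (≡.setoid ℕ) S

infix 4 _≅_

_≅_ : Loop a ℓ₁ → Loop b ℓ₂ → Set (a ⊔ b ⊔ ℓ₁ ⊔ ℓ₂)
L ≅ M = Σ[ f ∈ (Loop.Carrier L → Loop.Carrier M) ] IsLoopIsomorphism f
  where open LoopMorphisms (Loop.rawLoop L) (Loop.rawLoop M)

NonAbelian : Loop c ℓ → Set (c ⊔ ℓ)
NonAbelian L = ¬ (∃[ inv ] IsAbelianGroup _≈_ _∙_ ε inv)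
  where open Loop L

record Subloop (L : Loop c ℓ) (p : Level) : Set (c ⊔ ℓ ⊔ suc p) where
  open Loop L using (Carrier; _≈_; _∙_; _\\_; _//_; ε)
  infix 4 _∈
  field
    _∈       : Pred Carrier p
    resp     : ∀ {x y} → x ≈ y → x ∈ → y ∈
    ∙-closed : ∀ {x y} → x ∈ → y ∈ → (x ∙ y) ∈
    \\-closed : ∀ {x y} → x ∈ → y ∈ → (x \\ y) ∈
    //-closed : ∀ {x y} → x ∈ → y ∈ → (x // y) ∈
    ε-closed : ε ∈

  loop : Loop (c ⊔ p) ℓ
  loop = record
    { Carrier = ∃ _∈
    ; _≈_     = λ x y → proj₁ x ≈ proj₁ y
    ; _∙_     = λ x y → proj₁ x ∙ proj₁ y , ∙-closed (proj₂ x) (proj₂ y)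
    ; _\\_    = λ x y → proj₁ x \\ proj₁ y , \\-closed (proj₂ x) (proj₂ y)
    ; _//_    = λ x y → proj₁ x // proj₁ y , //-closed (proj₂ x) (proj₂ y)
    ; ε       = ε , ε-closed
    ; isLoop  = record
      { isQuasigroup = record
        { isMagma = record
          { isEquivalence = record { refl = L.refl ; sym = L.sym ; trans = L.trans }
          ; ∙-cong = L.∙-cong
          }
        ; \\-cong = L.\\-cong
        ; //-cong = L.//-cong
        ; leftDivides =
            (λ x y → L.leftDividesˡ (proj₁ x) (proj₁ y)) ,
            (λ x y → L.leftDividesʳ (proj₁ x) (proj₁ y))
        ; rightDivides =
            (λ x y → L.rightDividesˡ (proj₁ x) (proj₁ y)) ,
            (λ x y → L.rightDividesʳ (proj₁ x) (proj₁ y))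
        }
      ; identity =
          (λ x → L.identityˡ (proj₁ x)) , (λ x → L.identityʳ (proj₁ x))
      }
    }
    where module L = Loop L

module _ {L : Loop c ℓ} where
  open Loop L using (Carrier; _≈_; _∙_; ε)

  IsProper : Subloop L p → Set (c ⊔ p)
  IsProper S = ∃[ z ] ¬ (z ∈)
    where open Subloop S

  -- xN = Nx,  x(yN) = (xy)N,  (Nx)y = N(xy)  for all x, y
  record IsNormal (N : Subloop L p) : Set (c ⊔ ℓ ⊔ p) where
    open Subloop N using (_∈)
    field
      commutes   : ∀ x →
        (λ z → ∃[ n ] n ∈ × z ≈ x ∙ n) ≐ (λ z → ∃[ n ] n ∈ × z ≈ n ∙ x)
      associatesˡ : ∀ x y →
        (λ z → ∃[ n ] n ∈ × z ≈ x ∙ (y ∙ n)) ≐ (λ z → ∃[ n ] n ∈ × z ≈ (x ∙ y) ∙ n)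
      associatesʳ : ∀ x y →
        (λ z → ∃[ n ] n ∈ × z ≈ (n ∙ x) ∙ y) ≐ (λ z → ∃[ n ] n ∈ × z ≈ n ∙ (x ∙ y))

  -- H meets every coset xN in exactly one element.
  IsTransversal : Subloop L p → Subloop L q → Set (c ⊔ ℓ ⊔ p ⊔ q)
  IsTransversal N H =
    ∀ x → ∃[ h ] (h ∈H × h ∈coset x) × (∀ {h′} → h′ ∈H → h′ ∈coset x → h ≈ h′)
    where
    open Subloop N using () renaming (_∈ to _∈N)
    open Subloop H using () renaming (_∈ to _∈H)
    _∈coset_ : Carrier → Carrier → Set _
    y ∈coset x = ∃[ n ] n ∈N × y ≈ x ∙ n

  IsSplitExtension : Subloop L p → Subloop L q → Set (c ⊔ ℓ ⊔ p ⊔ q)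
  IsSplitExtension N H = IsNormal N × IsTransversal N H

  HasTrivialMeet : Subloop L p → Subloop L q → Set (c ⊔ ℓ ⊔ p ⊔ q)
  HasTrivialMeet N H = ∀ {z} → z ∈N → z ∈H → z ≈ ε
    where
    open Subloop N using () renaming (_∈ to _∈N)
    open Subloop H using () renaming (_∈ to _∈H)

  -- L = NH
  IsFactorization : Subloop L p → Subloop L q → Set (c ⊔ ℓ ⊔ p ⊔ q)
  IsFactorization N H = ∀ z → ∃[ n ] ∃[ h ] n ∈N × h ∈H × z ≈ n ∙ h
    where
    open Subloop N using () renaming (_∈ to _∈N)
    open Subloop H using () renaming (_∈ to _∈H)

record IsSimple (L : Loop c ℓ) : Set (suc (c ⊔ ℓ)) where
  open Loop L using (_≈_; ε)
  field
    nontrivial  : ∃[ z ] ¬ (z ≈ ε)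
    normal-triv : (N : Subloop L (c ⊔ ℓ)) → IsNormal N →
                  let open Subloop N in (∀ {z} → z ∈ → z ≈ ε) ⊎ (∀ z → z ∈)

infixl 7 _∙_ _\\_ _//_

data Term : Set where
  var             : ℕ → Term
  _∙_ _\\_ _//_   : Term → Term → Term
  ε               : Term

module _ (L : Loop c ℓ) where
  private module L = Loop L

  ⟦_⟧ : Term → (ℕ → L.Carrier) → L.Carrier
  ⟦ var n ⟧  ρ = ρ n
  ⟦ s ∙ t ⟧  ρ = ⟦ s ⟧ ρ L.∙ ⟦ t ⟧ ρ
  ⟦ s \\ t ⟧ ρ = ⟦ s ⟧ ρ L.\\ ⟦ t ⟧ ρ
  ⟦ s // t ⟧ ρ = ⟦ s ⟧ ρ L.// ⟦ t ⟧ ρ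
  ⟦ ε ⟧      ρ = L.ε

infix 4 _⊨_≈_ _⊨ᶠ_≈_

_⊨_≈_ : Loop c ℓ → Term → Term → Set (c ⊔ ℓ)
L ⊨ s ≈ t = ∀ ρ → Loop._≈_ L (⟦_⟧ L s ρ) (⟦_⟧ L t ρ)

_⊨ᶠ_≈_ : {I : Set i} → (I → Loop c ℓ) → Term → Term → Set (i ⊔ c ⊔ ℓ)
K ⊨ᶠ s ≈ t = ∀ j → K j ⊨ s ≈ t

-- The variety generated by the family K is the smallest equational class
-- containing K, that is, the class of all models of the identities of K.
InVariety : {I : Set i} → (I → Loop c ℓ) → Loop a ℓ₁ → Set (i ⊔ c ⊔ ℓ ⊔ a ⊔ ℓ₁)
InVariety K L = ∀ s t → K ⊨ᶠ s ≈ t → L ⊨ s ≈ t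

-- The free loop of countably infinite rank in the variety generated by K:
-- terms modulo the identities of K, which are those of the variety.
-- It lies in the variety and is free on `var` by the lemmas below.
FreeLoop : {I : Set i} → (I → Loop c ℓ) → Loop 0ℓ (i ⊔ c ⊔ ℓ)
FreeLoop K = record
  { Carrier = Term
  ; _≈_     = K ⊨ᶠ_≈_
  ; _∙_     = _∙_
  ; _\\_    = _\\_
  ; _//_    = _//_
  ; ε       = ε
  ; isLoop  = record
    { isQuasigroup = record
      { isMagma = record
        { isEquivalence = record
          { refl  = λ j ρ → Loop.refl (K j)
          ; sym   = λ s≈t j ρ → Loop.sym (K j) (s≈t j ρ)
          ; trans = λ s≈t t≈u j ρ → Loop.trans (K j) (s≈t j ρ) (t≈u j ρ)
          }
        ; ∙-cong = λ s≈t u≈v j ρ → Loop.∙-cong (K j) (s≈t j ρ) (u≈v j ρ)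
        }
      ; \\-cong = λ s≈t u≈v j ρ → Loop.\\-cong (K j) (s≈t j ρ) (u≈v j ρ)
      ; //-cong = λ s≈t u≈v j ρ → Loop.//-cong (K j) (s≈t j ρ) (u≈v j ρ)
      ; leftDivides =
          (λ s t j ρ → Loop.leftDividesˡ (K j) (⟦_⟧ (K j) s ρ) (⟦_⟧ (K j) t ρ)) ,
          (λ s t j ρ → Loop.leftDividesʳ (K j) (⟦_⟧ (K j) s ρ) (⟦_⟧ (K j) t ρ))
      ; rightDivides =
          (λ s t j ρ → Loop.rightDividesˡ (K j) (⟦_⟧ (K j) s ρ) (⟦_⟧ (K j) t ρ)) ,
          (λ s t j ρ → Loop.rightDividesʳ (K j) (⟦_⟧ (K j) s ρ) (⟦_⟧ (K j) t ρ))
      }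
    ; identity =
        (λ s j ρ → Loop.identityˡ (K j) (⟦_⟧ (K j) s ρ)) ,
        (λ s j ρ → Loop.identityʳ (K j) (⟦_⟧ (K j) s ρ))
    }
  }

module _ {I : Set i} (K : I → Loop c ℓ) where
  private
    module F = Loop (FreeLoop K)

    substitution : ∀ j (σ : ℕ → Term) (ρ : ℕ → Loop.Carrier (K j)) t →
      let open Loop (K j) using (_≈_) in
      ⟦_⟧ (K j) (⟦_⟧ (FreeLoop K) t σ) ρ ≈ ⟦_⟧ (K j) t (λ n → ⟦_⟧ (K j) (σ n) ρ)
    substitution j σ ρ (var n)  = Loop.refl (K j)
    substitution j σ ρ (s ∙ t)  = Loop.∙-cong (K j) (substitution j σ ρ s) (substitution j σ ρ t)
    substitution j σ ρ (s \\ t) = Loop.\\-cong (K j) (substitution j σ ρ s) (substitution j σ ρ t)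
    substitution j σ ρ (s // t) = Loop.//-cong (K j) (substitution j σ ρ s) (substitution j σ ρ t)
    substitution j σ ρ ε        = Loop.refl (K j)

  FreeLoop-inVariety : InVariety K (FreeLoop K)
  FreeLoop-inVariety s t s≈t σ j ρ =
    Kj.trans (substitution j σ ρ s)
      (Kj.trans (s≈t j (λ n → ⟦_⟧ (K j) (σ n) ρ)) (Kj.sym (substitution j σ ρ t)))
    where module Kj = Loop (K j)

  module _ (L : Loop a ℓ₁) (L∈V : InVariety K L) (ρ : ℕ → Loop.Carrier L) where
    private module L = Loop L
    open LoopMorphisms F.rawLoop L.rawLoop

    FreeLoop-extend : IsLoopHomomorphism (λ t → ⟦_⟧ L t ρ)
    FreeLoop-extend = record
      { isQuasigroupHomomorphism = record
        { isRelHomomorphism = record { cong = λ {s} {t} s≈t → L∈V s t s≈t ρ }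
        ; ∙-homo  = λ s t → L.refl
        ; \\-homo = λ s t → L.refl
        ; //-homo = λ s t → L.refl
        }
      ; ε-homo = L.refl
      }

    FreeLoop-unique : ∀ {f} → IsLoopHomomorphism f → (∀ n → f (var n) L.≈ ρ n) →
                      ∀ t → f t L.≈ ⟦_⟧ L t ρ
    FreeLoop-unique {f} hom f≈ρ = go
      where
      open IsLoopHomomorphism hom
      go : ∀ t → f t L.≈ ⟦_⟧ L t ρ
      go (var n)  = f≈ρ n
      go (s ∙ t)  = L.trans (∙-homo s t) (L.∙-cong (go s) (go t))
      go (s \\ t) = L.trans (\\-homo s t) (L.\\-cong (go s) (go t))
      go (s // t) = L.trans (//-homo s t) (L.//-cong (go s) (go t))
      go ε        = ε-homo

Singleton : Loop c ℓ → ⊤ → Loop c ℓ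
Singleton A _ = A

ProperSubloops : (A : Loop 0ℓ 0ℓ) → (Σ[ S ∈ Subloop A 0ℓ ] IsProper S) → Loop 0ℓ 0ℓ
ProperSubloops A (S , _) = Subloop.loop S

module _ (B : BooleanAlgebra b ℓ) where
  open BooleanAlgebra B using (Carrier; _≈_; ⊥) renaming (_∧_ to _∩_; ⊤ to 𝟙; ¬_ to ∁)
  open NaturalOrder _≈_ _∩_ using (_≤_)

  -- Nontrivial (𝟙 ≠ ⊥) and without minimal nonzero elements.
  IsAtomless : Set (b ⊔ ℓ)
  IsAtomless = ¬ (𝟙 ≈ ⊥) ×
    (∀ u → ¬ (u ≈ ⊥) → ∃[ v ] v ≤ u × ¬ (v ≈ ⊥) × ¬ (v ≈ u))

  -- The points of the Stone space; two points are equal when they have the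
  -- same members.
  record Ultrafilter : Set (b ⊔ suc ℓ) where
    infix 4 _∈
    field
      _∈     : Pred Carrier ℓ
      𝟙-mem  : 𝟙 ∈
      ⊥-mem  : ¬ (⊥ ∈)
      upward : ∀ {u v} → u ≤ v → u ∈ → v ∈
      ∩-mem  : ∀ {u v} → u ∈ → v ∈ → (u ∩ v) ∈
      ultra  : ∀ u → u ∈ ⊎ (∁ u) ∈

  infix 4 _∋_
  _∋_ : Ultrafilter → Carrier → Set ℓ
  x ∋ u = Ultrafilter._∈ x u

  -- U contains a basic open neighbourhood {y : u ∈ y} of each of its points.
  IsOpen : Pred Ultrafilter p → Set (b ⊔ suc ℓ ⊔ p)
  IsOpen U = ∀ {x} → U x → ∃[ u ] x ∋ u × (∀ {y} → y ∋ u → U y)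

Power : Loop c ℓ → Set x → Loop (c ⊔ x) (ℓ ⊔ x)
Power A X = record
  { Carrier = X → A.Carrier
  ; _≈_     = λ f g → ∀ x → f x A.≈ g x
  ; _∙_     = λ f g x → f x A.∙ g x
  ; _\\_    = λ f g x → f x A.\\ g x
  ; _//_    = λ f g x → f x A.// g x
  ; ε       = λ _ → A.ε
  ; isLoop  = record
    { isQuasigroup = record
      { isMagma = record
        { isEquivalence = record
          { refl  = λ x → A.refl
          ; sym   = λ f≈g x → A.sym (f≈g x)
          ; trans = λ f≈g g≈h x → A.trans (f≈g x) (g≈h x)
          }
        ; ∙-cong = λ f≈g h≈k x → A.∙-cong (f≈g x) (h≈k x)
        }
      ; \\-cong = λ f≈g h≈k x → A.\\-cong (f≈g x) (h≈k x)
      ; //-cong = λ f≈g h≈k x → A.//-cong (f≈g x) (h≈k x)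
      ; leftDivides  = (λ f g x → A.leftDividesˡ (f x) (g x)) , (λ f g x → A.leftDividesʳ (f x) (g x))
      ; rightDivides = (λ f g x → A.rightDividesˡ (f x) (g x)) , (λ f g x → A.rightDividesʳ (f x) (g x))
      }
    ; identity = (λ f x → A.identityˡ (f x)) , (λ f x → A.identityʳ (f x))
    }
  }
  where module A = Loop A

module _ (A : Loop c ℓ₁) (B : BooleanAlgebra b ℓ₂) where
  private
    module A = Loop A
    module B = BooleanAlgebra B
    module BP = BooleanAlgebraProperties B

  -- Continuity into the discrete space A, whose topology has the points
  -- as a basis. Such an f automatically identifies ultrafilters with the
  -- same members.
  IsContinuous : Pred (Ultrafilter B → A.Carrier) (c ⊔ ℓ₁ ⊔ b ⊔ suc ℓ₂)
  IsContinuous f = ∀ a → IsOpen B (λ x → f x A.≈ a)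

  private
    pointwise : (_⋆_ : A.Carrier → A.Carrier → A.Carrier) →
      (∀ {p q r s} → p A.≈ q → r A.≈ s → (p ⋆ r) A.≈ (q ⋆ s)) →
      ∀ {f g} → IsContinuous f → IsContinuous g → IsContinuous (λ x → f x ⋆ g x)
    pointwise _⋆_ ⋆-cong {f} {g} f-cts g-cts a {x} fx⋆gx≈a
      with u , u∈x , fu ← f-cts (f x) {x} A.refl
         | v , v∈x , gv ← g-cts (g x) {x} A.refl =
      u B.∧ v , Ultrafilter.∩-mem x u∈x v∈x , λ {y} uv∈y →
        A.trans (⋆-cong (fu (Ultrafilter.upward y uv≤u uv∈y))
                        (gv (Ultrafilter.upward y uv≤v uv∈y)))
                fx⋆gx≈a
      where
      uv≤u : (u B.∧ v) B.≈ ((u B.∧ v) B.∧ u)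
      uv≤u = B.sym (B.trans (B.∧-comm (u B.∧ v) u)
               (B.trans (B.sym (B.∧-assoc u u v)) (B.∧-congʳ (BP.∧-idem u))))
      uv≤v : (u B.∧ v) B.≈ ((u B.∧ v) B.∧ v)
      uv≤v = B.sym (B.trans (B.∧-assoc u v v) (B.∧-congˡ (BP.∧-idem v)))

  BooleanPower : Subloop (Power A (Ultrafilter B)) (c ⊔ ℓ₁ ⊔ b ⊔ suc ℓ₂)
  BooleanPower = record
    { _∈        = IsContinuous
    ; resp      = λ f≈g f-cts a {x} gx≈a →
        let u , u∈x , fu = f-cts a {x} (A.trans (f≈g x) gx≈a)
        in u , u∈x , λ {y} u∈y → A.trans (A.sym (f≈g y)) (fu u∈y)
    ; ∙-closed  = pointwise A._∙_ A.∙-cong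
    ; \\-closed = pointwise A._\\_ A.\\-cong
    ; //-closed = pointwise A._//_ A.//-cong
    ; ε-closed  = λ a {x} ε≈a → B.⊤ , Ultrafilter.𝟙-mem x , λ _ → ε≈a
    }

  FilteredBooleanPower : Ultrafilter B → Subloop (Subloop.loop BooleanPower) ℓ₁
  FilteredBooleanPower x = record
    { _∈        = λ f → proj₁ f x A.≈ A.ε
    ; resp      = λ f≈g fx≈ε → A.trans (A.sym (f≈g x)) fx≈ε
    ; ∙-closed  = λ fx≈ε gx≈ε → A.trans (A.∙-cong fx≈ε gx≈ε) (A.identityˡ A.ε)
    ; \\-closed = λ fx≈ε gx≈ε → A.trans (A.\\-cong fx≈ε gx≈ε)
        (A.trans (A.sym (A.identityˡ _)) (A.leftDividesˡ A.ε A.ε))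
    ; //-closed = λ fx≈ε gx≈ε → A.trans (A.//-cong fx≈ε gx≈ε)
        (A.trans (A.sym (A.identityʳ _)) (A.rightDividesˡ A.ε A.ε))
    ; ε-closed  = A.refl
    }

{-# OPTIONS --safe #-}
-- Evaluate terms at tuples ρ of elements of A.  If ρ generates A and ker ρ does
-- not contain ker σ, then by simplicity the terms vanishing at σ take all values
-- at ρ; commutators, which exist because A is non-abelian, combine this for
-- finitely many σ.  Hence a term vanishing at all non-generating tuples can be
-- prescribed freely at inequivalent generating ones.
--
-- Let C be generated by a sequence.  The surjective homomorphisms C → A modulo
-- automorphisms of A form a locally compact space Y of tuples.  N consists of the
-- values of the terms vanishing at the non-generating tuples; by the
-- above and compactness, N is the loop of all compactly supported locally
-- constant functions Y → A, and C/N lies in W.  The complement H comes from a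
-- retraction: send y in Y to a nearest non-surjective homomorphism r(y), nearest
-- in the sense of the longest common initial segment, and let H consist of the
-- elements of C with the same image under y and r(y) for all y.
--
-- For the free loop the one-point compactification of Y has no isolated point,
-- and a back-and-forth argument identifies it, with its point at infinity, with
-- the Stone space of any countable atomless Boolean algebra, with any base point.

module Submission where

open import Defs hiding (_∙_; _\\_; _//_; ε)
open Term using () renaming (_∙_ to _·_; _\\_ to _⧵_; _//_ to _⧸_; ε to 𝟏)
open import Algebra.Bundles using (Loop)
open import Algebra.Lattice.Bundles using (BooleanAlgebra)
import Algebra.Lattice.Properties.BooleanAlgebra as BooleanAlgebraProperties
import Algebra.Properties.Loop as LoopProperties
import Algebra.Properties.Quasigroup as QuasigroupProperties
open import Axiom.ExcludedMiddle using (ExcludedMiddle)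
open import Data.Bool.Base as Bool using (Bool; true; false; if_then_else_)
import Data.Bool.Properties as Bool
open import Data.Empty using (⊥-elim)
open import Data.Fin.Base as Fin using (Fin; toℕ; fromℕ<; finToFun; funToFin)
import Data.Fin.Properties as Fin
import Data.List.Properties as List
open import Data.List.Base as List using (List; []; _∷_; allFin; _++_)
open import Data.List.Membership.Propositional using () renaming (_∈_ to _∈ˡ_)
open import Data.List.Membership.Propositional.Properties using (∈-map⁺; ∈-allFin; ∈-++⁺ˡ; ∈-++⁺ʳ)
open import Data.List.Relation.Unary.Any using (here; there)
open import Data.Maybe.Base using (Maybe; just; nothing)
open import Data.Nat.Base as ℕ using (ℕ; zero; suc; _≤_; _<_; _⊔_; z≤n; s≤s)
import Data.Nat.Properties as ℕ
open import Data.Product using (Σ-syntax; ∃; ∃-syntax; _×_; _,_; proj₁; proj₂; swap)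
open import Data.Sum using (_⊎_; inj₁; inj₂; [_,_])
open import Data.Unit.Base using (⊤; tt)
open import Function.Bundles using (Inverse; Surjection)
open import Level using (Level; 0ℓ)
open import Relation.Binary.PropositionalEquality as ≡ using (_≡_; _≢_)
open import Relation.Nullary using (¬_; Dec; yes; no; contradiction)
open import Relation.Nullary.Decidable using (decidable-stable)

-- An arbitrary `C` in V need not embed in a power of `A`, so its elements cannot be treated as
-- functions on Y. The arguments are therefore about terms: an element of `C` is the value of a term
-- at a generating sequence, a homomorphism to `A` is a tuple that respects the relations of `C`,
-- and membership in V serves to pass from a term trivial at all tuples of `A` to a term trivial in
-- `C`. Points of Y detect only the nontrivial values of vanishing terms, but every comparison that
-- matters reduces to such a term. To reach the complement, a term t is multiplied by a vanishing n
-- that takes at y the left quotient of t(r(y)) by t(y). Such an n exists only if this quotient is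
-- locally constant with compact support. This dictates what the retraction must satisfy: each
-- coordinate of r(y) depends on finitely many coordinates of y, and r(y) approaches y at infinity.
-- The first holds because r(y) is found by a search through initial segments. The second holds
-- because generating is visible on an initial segment, so limits of points that escape to infinity
-- are non-surjective homomorphisms.

private
  variable
    a c ℓ p : Level

-- Terms and kernels

_[_] : Term → (ℕ → Term) → Term
var i    [ σ ] = σ i
(s · t)  [ σ ] = (s [ σ ]) · (t [ σ ])
(s ⧵ t)  [ σ ] = (s [ σ ]) ⧵ (t [ σ ])
(s ⧸ t)  [ σ ] = (s [ σ ]) ⧸ (t [ σ ])
𝟏        [ σ ] = 𝟏

width : Term → ℕ
width (var i)  = suc i
width (s · t)  = width s ⊔ width t
width (s ⧵ t)  = width s ⊔ width t
width (s ⧸ t)  = width s ⊔ width t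
width 𝟏        = 0

module Evaluation (L : Loop c ℓ) where
  open Loop L using (Carrier; _≈_)
  private
    module L = Loop L

  ⟦⟧-local : ∀ t {ρ σ : ℕ → Carrier} → (∀ i → i < width t → ρ i ≈ σ i) →
             ⟦_⟧ L t ρ ≈ ⟦_⟧ L t σ
  ⟦⟧-local (var i)  eq = eq i ℕ.≤-refl
  ⟦⟧-local (s · t)  eq = L.∙-cong
    (⟦⟧-local s λ i i< → eq i (ℕ.≤-trans i< (ℕ.m≤m⊔n (width s) (width t))))
    (⟦⟧-local t λ i i< → eq i (ℕ.≤-trans i< (ℕ.m≤n⊔m (width s) (width t))))
  ⟦⟧-local (s ⧵ t)  eq = L.\\-cong
    (⟦⟧-local s λ i i< → eq i (ℕ.≤-trans i< (ℕ.m≤m⊔n (width s) (width t))))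
    (⟦⟧-local t λ i i< → eq i (ℕ.≤-trans i< (ℕ.m≤n⊔m (width s) (width t))))
  ⟦⟧-local (s ⧸ t)  eq = L.//-cong
    (⟦⟧-local s λ i i< → eq i (ℕ.≤-trans i< (ℕ.m≤m⊔n (width s) (width t))))
    (⟦⟧-local t λ i i< → eq i (ℕ.≤-trans i< (ℕ.m≤n⊔m (width s) (width t))))
  ⟦⟧-local 𝟏        eq = L.refl

  ⟦⟧-cong : ∀ t {ρ σ : ℕ → Carrier} → (∀ i → ρ i ≈ σ i) → ⟦_⟧ L t ρ ≈ ⟦_⟧ L t σ
  ⟦⟧-cong t eq = ⟦⟧-local t λ i _ → eq i

  ⟦⟧-subst : ∀ t σ ρ → ⟦_⟧ L (t [ σ ]) ρ ≈ ⟦_⟧ L t (λ i → ⟦_⟧ L (σ i) ρ)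
  ⟦⟧-subst (var i)  σ ρ = L.refl
  ⟦⟧-subst (s · t)  σ ρ = L.∙-cong (⟦⟧-subst s σ ρ) (⟦⟧-subst t σ ρ)
  ⟦⟧-subst (s ⧵ t)  σ ρ = L.\\-cong (⟦⟧-subst s σ ρ) (⟦⟧-subst t σ ρ)
  ⟦⟧-subst (s ⧸ t)  σ ρ = L.//-cong (⟦⟧-subst s σ ρ) (⟦⟧-subst t σ ρ)
  ⟦⟧-subst 𝟏        σ ρ = L.refl

  open LoopProperties L public using (x//x≈ε; x//ε≈x; x\\x≈ε)

  x//y≈ε⇒x≈y : ∀ {x y} → x L.// y ≈ L.ε → x ≈ y
  x//y≈ε⇒x≈y {x} {y} eq =
    L.trans (L.sym (L.rightDividesˡ y x)) (L.trans (L.∙-congʳ eq) (L.identityˡ y))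

  x≈y⇒x//y≈ε : ∀ {x y} → x ≈ y → x L.// y ≈ L.ε
  x≈y⇒x//y≈ε {x} {y} eq = L.trans (L.//-congʳ eq) (x//x≈ε y)

subloop-⟦⟧ : (L : Loop c ℓ) (S : Subloop L p) → ∀ t ρ →
             proj₁ (⟦_⟧ (Subloop.loop S) t ρ) ≡ ⟦_⟧ L t (λ i → proj₁ (ρ i))
subloop-⟦⟧ L S (var i)  ρ = ≡.refl
subloop-⟦⟧ L S (s · t)  ρ = ≡.cong₂ (Loop._∙_ L) (subloop-⟦⟧ L S s ρ) (subloop-⟦⟧ L S t ρ)
subloop-⟦⟧ L S (s ⧵ t)  ρ = ≡.cong₂ (Loop._\\_ L) (subloop-⟦⟧ L S s ρ) (subloop-⟦⟧ L S t ρ)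
subloop-⟦⟧ L S (s ⧸ t)  ρ = ≡.cong₂ (Loop._//_ L) (subloop-⟦⟧ L S s ρ) (subloop-⟦⟧ L S t ρ)
subloop-⟦⟧ L S 𝟏        ρ = ≡.refl

Generates : (L : Loop c ℓ) → (ℕ → Loop.Carrier L) → Set (c Level.⊔ ℓ)
Generates L ρ = ∀ x → ∃[ t ] Loop._≈_ L (⟦_⟧ L t ρ) x

-- A set of terms of the form {t : t(gᵢ) = ε for all i}.
record Kernel : Set₁ where
  field
    {Index} : Set
    target  : Index → Loop 0ℓ 0ℓ
    env     : ∀ i → ℕ → Loop.Carrier (target i)

  infix 4 _∋ᵏ_
  _∋ᵏ_ : Term → Set
  _∋ᵏ_ t = ∀ i → Loop._≈_ (target i) (⟦_⟧ (target i) t (env i)) (Loop.ε (target i))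

open Kernel using (_∋ᵏ_) public

infixl 5 _▹_,_
-- The target of the new condition is arbitrary, because relations of `C` are imposed in this way as
-- well as vanishing at tuples of `A`.
_▹_,_ : Kernel → (L : Loop 0ℓ 0ℓ) → (ℕ → Loop.Carrier L) → Kernel
K ▹ L , g = record
  { Index  = Maybe (Kernel.Index K)
  ; target = λ { nothing → L ; (just i) → Kernel.target K i }
  ; env    = λ { nothing → g ; (just i) → Kernel.env K i }
  }

module _ (L : Loop c ℓ) where
  open Loop L
  open Evaluation L using (x//x≈ε; x\\x≈ε)

  ε∙ε≈ε : ∀ {x y} → x ≈ ε → y ≈ ε → x ∙ y ≈ ε
  ε∙ε≈ε x≈ε y≈ε = trans (∙-cong x≈ε y≈ε) (identityˡ ε)

  ε\\ε≈ε : ∀ {x y} → x ≈ ε → y ≈ ε → x \\ y ≈ ε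
  ε\\ε≈ε x≈ε y≈ε = trans (\\-cong x≈ε y≈ε) (x\\x≈ε ε)

  ε//ε≈ε : ∀ {x y} → x ≈ ε → y ≈ ε → x // y ≈ ε
  ε//ε≈ε x≈ε y≈ε = trans (//-cong x≈ε y≈ε) (x//x≈ε ε)

  -- This word and the five below solve the six inclusions of `IsNormal` for the new factor. Each
  -- collapses to `ε` together with `n`, so it stays inside every kernel.
  conjugateʳ : ∀ x {n} → n ≈ ε → (x ∙ n) // x ≈ ε
  conjugateʳ x n≈ε = trans (//-congʳ (trans (∙-congˡ n≈ε) (identityʳ x))) (x//x≈ε x)

  conjugateˡ : ∀ x {n} → n ≈ ε → x \\ (n ∙ x) ≈ ε
  conjugateˡ x n≈ε = trans (\\-congˡ (trans (∙-congʳ n≈ε) (identityˡ x))) (x\\x≈ε x)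

  reassociate₁ : ∀ x y {n} → n ≈ ε → (x ∙ y) \\ (x ∙ (y ∙ n)) ≈ ε
  reassociate₁ x y n≈ε =
    trans (\\-congˡ (∙-congˡ (trans (∙-congˡ n≈ε) (identityʳ y)))) (x\\x≈ε (x ∙ y))

  reassociate₂ : ∀ x y {n} → n ≈ ε → y \\ (x \\ ((x ∙ y) ∙ n)) ≈ ε
  reassociate₂ x y n≈ε =
    trans (\\-congˡ (trans (\\-congˡ (trans (∙-congˡ n≈ε) (identityʳ _))) (leftDividesʳ x y)))
      (x\\x≈ε y)

  reassociate₃ : ∀ x y {n} → n ≈ ε → ((n ∙ x) ∙ y) // (x ∙ y) ≈ ε
  reassociate₃ x y n≈ε =
    trans (//-congʳ (∙-congʳ (trans (∙-congʳ n≈ε) (identityˡ x)))) (x//x≈ε (x ∙ y))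

  reassociate₄ : ∀ x y {n} → n ≈ ε → ((n ∙ (x ∙ y)) // y) // x ≈ ε
  reassociate₄ x y n≈ε =
    trans (//-congʳ (trans (//-congʳ (trans (∙-congʳ n≈ε) (identityˡ _))) (rightDividesʳ y x)))
      (x//x≈ε x)

module _ (K : Kernel) where
  private
    at : ∀ i → Loop 0ℓ 0ℓ
    at = Kernel.target K

    value : ∀ i → Term → Loop.Carrier (at i)
    value i t = ⟦_⟧ (at i) t (Kernel.env K i)

  module _ (L : Loop c ℓ) (ρ : ℕ → Loop.Carrier L) where
    open Loop L

    image : Subloop L ℓ
    image = record
      { _∈        = λ x → ∃[ t ] _∋ᵏ_ K t × ⟦_⟧ L t ρ ≈ x
      ; resp      = λ x≈y (t , t∈ , eq) → t , t∈ , trans eq x≈y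
      ; ∙-closed  = λ (s , s∈ , s≈) (t , t∈ , t≈) →
          s · t , (λ i → ε∙ε≈ε (at i) (s∈ i) (t∈ i)) , ∙-cong s≈ t≈
      ; \\-closed = λ (s , s∈ , s≈) (t , t∈ , t≈) →
          s ⧵ t , (λ i → ε\\ε≈ε (at i) (s∈ i) (t∈ i)) , \\-cong s≈ t≈
      ; //-closed = λ (s , s∈ , s≈) (t , t∈ , t≈) →
          s ⧸ t , (λ i → ε//ε≈ε (at i) (s∈ i) (t∈ i)) , //-cong s≈ t≈
      ; ε-closed  = 𝟏 , (λ i → Loop.refl (at i)) , refl
      }

    -- Since `ρ` generates, arbitrary `x` and `y` are values of terms; substituted into the words
    -- above, these give terms of the kernel.
    image-normal : Generates L ρ → IsNormal image
    image-normal gen = record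
      { commutes    = λ x → let s , s≈ = gen x in
          (λ (n , (t , t∈ , t≈) , eq) →
            (x ∙ n) // x ,
            ((s · t) ⧸ s , (λ i → conjugateʳ (at i) (value i s) (t∈ i)) ,
              //-cong (∙-cong s≈ t≈) s≈) ,
            trans eq (sym (rightDividesˡ x (x ∙ n)))) ,
          (λ (n , (t , t∈ , t≈) , eq) →
            x \\ (n ∙ x) ,
            (s ⧵ (t · s) , (λ i → conjugateˡ (at i) (value i s) (t∈ i)) ,
              \\-cong s≈ (∙-cong t≈ s≈)) ,
            trans eq (sym (leftDividesˡ x (n ∙ x))))
      ; associatesˡ = λ x y → let r , r≈ = gen x ; s , s≈ = gen y in
          (λ (n , (t , t∈ , t≈) , eq) →
            (x ∙ y) \\ (x ∙ (y ∙ n)) ,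
            ((r · s) ⧵ (r · (s · t)) ,
              (λ i → reassociate₁ (at i) (value i r) (value i s) (t∈ i)) ,
              \\-cong (∙-cong r≈ s≈) (∙-cong r≈ (∙-cong s≈ t≈))) ,
            trans eq (sym (leftDividesˡ (x ∙ y) _))) ,
          (λ (n , (t , t∈ , t≈) , eq) →
            y \\ (x \\ ((x ∙ y) ∙ n)) ,
            (s ⧵ (r ⧵ ((r · s) · t)) ,
              (λ i → reassociate₂ (at i) (value i r) (value i s) (t∈ i)) ,
              \\-cong s≈ (\\-cong r≈ (∙-cong (∙-cong r≈ s≈) t≈))) ,
            trans eq (sym (trans (∙-congˡ (leftDividesˡ y _)) (leftDividesˡ x _))))
      ; associatesʳ = λ x y → let r , r≈ = gen x ; s , s≈ = gen y in
          (λ (n , (t , t∈ , t≈) , eq) →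
            ((n ∙ x) ∙ y) // (x ∙ y) ,
            (((t · r) · s) ⧸ (r · s) ,
              (λ i → reassociate₃ (at i) (value i r) (value i s) (t∈ i)) ,
              //-cong (∙-cong (∙-cong t≈ r≈) s≈) (∙-cong r≈ s≈)) ,
            trans eq (sym (rightDividesˡ (x ∙ y) _))) ,
          (λ (n , (t , t∈ , t≈) , eq) →
            ((n ∙ (x ∙ y)) // y) // x ,
            (((t · (r · s)) ⧸ s) ⧸ r ,
              (λ i → reassociate₄ (at i) (value i r) (value i s) (t∈ i)) ,
              //-cong (//-cong (∙-cong t≈ (∙-cong r≈ s≈)) s≈) r≈) ,
            trans eq (sym (trans (∙-congʳ (rightDividesˡ x _)) (rightDividesˡ y _))))
      }

-- Simple non-abelian loops

emptyKernel : Kernel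
emptyKernel = record { target = ⊥-elim ; env = λ () }

Fin-injective⇒surjective : ∀ {n} (f : Fin n → Fin n) → (∀ {i j} → f i ≡ f j → i ≡ j) →
                           ∀ j → ¬ (∀ i → f i ≢ j)
Fin-injective⇒surjective {suc n} f inj j f≢j =
  ℕ.1+n≰n (Fin.injective⇒≤ {f = λ i → Fin.punchOut (λ eq → f≢j i (≡.sym eq))}
    (λ {i} {k} eq → inj (Fin.punchOut-injective (λ eq → f≢j i (≡.sym eq)) (λ eq → f≢j k (≡.sym eq)) eq)))

module SimpleLoop
  (em : ∀ {ℓ} → ExcludedMiddle ℓ) (A : Loop 0ℓ 0ℓ) (finite : IsFinite (Loop.setoid A))
  (simple : IsSimple A) (nonAbelian : NonAbelian A) where

  open Loop A
  open Evaluation A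

  dne : ∀ {ℓ} {P : Set ℓ} → ¬ ¬ P → P
  dne = decidable-stable em

  size : ℕ
  size = proj₁ finite

  index : Carrier → Fin size
  index = Inverse.to (proj₂ finite)

  element : Fin size → Carrier
  element = Inverse.from (proj₂ finite)

  index-cong : ∀ {x y} → x ≈ y → index x ≡ index y
  index-cong = Inverse.to-cong (proj₂ finite)

  element-index : ∀ x → element (index x) ≈ x
  element-index = Inverse.strictlyInverseʳ (proj₂ finite)

  index-element : ∀ i → index (element i) ≡ i
  index-element = Inverse.strictlyInverseˡ (proj₂ finite)

  index-injective : ∀ {x y} → index x ≡ index y → x ≈ y
  index-injective {x} {y} eq =
    trans (sym (element-index x)) (trans (reflexive (≡.cong element eq)) (element-index y))

  element-injective : ∀ {i j} → element i ≈ element j → i ≡ j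
  element-injective {i} {j} eq =
    ≡.trans (≡.sym (index-element i)) (≡.trans (index-cong eq) (index-element j))

  Env : Set
  Env = ℕ → Carrier

  Ev : Term → Env → Carrier
  Ev = ⟦_⟧ A

  Gen : Env → Set
  Gen = Generates A

  infix 4 _⊑_

  -- Equivalently, `ρ i ↦ σ i` extends to a homomorphism from the subloop generated by `ρ` onto the
  -- one generated by `σ`; see `⊑-≈`.
  _⊑_ : Env → Env → Set
  ρ ⊑ σ = ∀ t → Ev t ρ ≈ ε → Ev t σ ≈ ε

  ⊑-≈ : ∀ {ρ σ} → ρ ⊑ σ → ∀ s t → Ev s ρ ≈ Ev t ρ → Ev s σ ≈ Ev t σ
  ⊑-≈ ρ⊑σ s t eq = x//y≈ε⇒x≈y (ρ⊑σ (s ⧸ t) (x≈y⇒x//y≈ε eq))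

  -- Choosing a term for each element of A turns an inclusion of kernels into
  -- an injective self-map of the finite set A.
  gen-⊑ : ∀ {ρ σ} → Gen σ → ρ ⊑ σ → Gen ρ × σ ⊑ ρ
  gen-⊑ {ρ} {σ} gen ρ⊑σ = (λ x → let i , eq = reach x in term i , eq) , σ⊑ρ
    where
    term : Fin size → Term
    term i = proj₁ (gen (element i))

    term-injective : ∀ {i j} → Ev (term i) σ ≈ Ev (term j) σ → i ≡ j
    term-injective {i} {j} eq = element-injective
      (trans (sym (proj₂ (gen (element i)))) (trans eq (proj₂ (gen (element j)))))

    reach : ∀ x → ∃[ i ] Ev (term i) ρ ≈ x
    reach x = dne λ none → Fin-injective⇒surjective (λ i → index (Ev (term i) ρ))
      (λ {i} {j} eq → term-injective (⊑-≈ ρ⊑σ (term i) (term j) (index-injective eq)))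
      (index x) (λ i eq → none (i , index-injective eq))

    σ⊑ρ : σ ⊑ ρ
    σ⊑ρ t tσ≈ε with i , ti≈ ← reach (Ev t ρ) | j , tj≈ ← reach ε =
      trans (sym ti≈) (trans (reflexive (≡.cong (λ k → Ev (term k) ρ) i≡j)) tj≈)
      where
      i≡j : i ≡ j
      i≡j = term-injective
        (trans (⊑-≈ ρ⊑σ (term i) t ti≈) (trans tσ≈ε (sym (ρ⊑σ (term j) tj≈))))

  Full : Kernel → Env → Set
  Full K ρ = ∀ x → ∃[ t ] K ∋ᵏ t × Ev t ρ ≈ x

  nontrivial⇒full : ∀ K {ρ} t → Gen ρ → K ∋ᵏ t → ¬ (Ev t ρ ≈ ε) → Full K ρ
  nontrivial⇒full K {ρ} t gen t∈K tρ≉ε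
    with IsSimple.normal-triv simple (image K A ρ) (image-normal K A ρ gen)
  ... | inj₁ trivial = contradiction (trivial (t , t∈K , refl)) tρ≉ε
  ... | inj₂ full    = full

  -- A common interface to commutators and associators; the third argument serves the associator.
  -- Triviality in each of the first two arguments puts the word into the intersection of two
  -- kernels. It is required in every loop `L`, as kernels may have targets other than `A`.
  record Commutator : Set₁ where
    field
      comm       : Term → Term → Term → Term
      x y z      : Carrier
      nontrivial : ∀ {ρ r s t} → Ev r ρ ≈ x → Ev s ρ ≈ y → Ev t ρ ≈ z → ¬ (Ev (comm r s t) ρ ≈ ε)
      trivialˡ   : ∀ (L : Loop 0ℓ 0ℓ) ρ r s t → let open Loop L using () renaming (_≈_ to _≈ᴸ_; ε to εᴸ) in
                   ⟦_⟧ L r ρ ≈ᴸ εᴸ → ⟦_⟧ L (comm r s t) ρ ≈ᴸ εᴸ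
      trivialʳ   : ∀ (L : Loop 0ℓ 0ℓ) ρ r s t → let open Loop L using () renaming (_≈_ to _≈ᴸ_; ε to εᴸ) in
                   ⟦_⟧ L s ρ ≈ᴸ εᴸ → ⟦_⟧ L (comm r s t) ρ ≈ᴸ εᴸ

  -- A loop in which all commutators and associators are trivial is an abelian group, so one of the
  -- two words must serve.
  commutator : Commutator
  commutator with em {P = ∃[ x ] ∃[ y ] ¬ (x ∙ y ≈ y ∙ x)}
  ... | yes (x , y , xy≉yx) = record
    { comm       = λ r s _ → (r · s) ⧸ (s · r)
    ; x          = x
    ; y          = y
    ; z          = ε
    ; nontrivial = λ r≈x s≈y _ eq → xy≉yx
        (trans (sym (∙-cong r≈x s≈y)) (trans (x//y≈ε⇒x≈y eq) (∙-cong s≈y r≈x)))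
    ; trivialˡ   = λ L ρ r s t r≈ε → let module L = Loop L in
        Evaluation.x≈y⇒x//y≈ε L (L.trans (L.trans (L.∙-congʳ r≈ε) (L.identityˡ _))
          (L.sym (L.trans (L.∙-congˡ r≈ε) (L.identityʳ _))))
    ; trivialʳ   = λ L ρ r s t s≈ε → let module L = Loop L in
        Evaluation.x≈y⇒x//y≈ε L (L.trans (L.trans (L.∙-congˡ s≈ε) (L.identityʳ _))
          (L.sym (L.trans (L.∙-congʳ s≈ε) (L.identityˡ _))))
    }
  ... | no commutative with em {P = ∃[ x ] ∃[ y ] ∃[ z ] ¬ ((x ∙ y) ∙ z ≈ x ∙ (y ∙ z))}
  ... | yes (x , y , z , xyz≉) = record
    { comm       = λ r s t → ((r · s) · t) ⧸ (r · (s · t))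
    ; x          = x
    ; y          = y
    ; z          = z
    ; nontrivial = λ r≈x s≈y t≈z eq → xyz≉
        (trans (sym (∙-cong (∙-cong r≈x s≈y) t≈z))
          (trans (x//y≈ε⇒x≈y eq) (∙-cong r≈x (∙-cong s≈y t≈z))))
    ; trivialˡ   = λ L ρ r s t r≈ε → let module L = Loop L in
        Evaluation.x≈y⇒x//y≈ε L
          (L.trans (L.∙-congʳ (L.trans (L.∙-congʳ r≈ε) (L.identityˡ _)))
            (L.sym (L.trans (L.∙-congʳ r≈ε) (L.identityˡ _))))
    ; trivialʳ   = λ L ρ r s t s≈ε → let module L = Loop L in
        Evaluation.x≈y⇒x//y≈ε L
          (L.trans (L.∙-congʳ (L.trans (L.∙-congˡ s≈ε) (L.identityʳ _)))
            (L.sym (L.∙-congˡ (L.trans (L.∙-congʳ s≈ε) (L.identityˡ _)))))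
    }
  ... | no associative = ⊥-elim (nonAbelian ((_\\ ε) , record
    { isGroup = record
      { isMonoid = record
        { isSemigroup = record { isMagma = isMagma ; assoc = λ x y z → dne λ ne → associative (x , y , z , ne) }
        ; identity    = identity
        }
      ; inverse  = (λ x → trans (comm (x \\ ε) x) (leftDividesˡ x ε)) , (λ x → leftDividesˡ x ε)
      ; ⁻¹-cong  = \\-congʳ
      }
    ; comm    = comm
    }))
    where
    comm : ∀ x y → x ∙ y ≈ y ∙ x
    comm x y = dne λ ne → commutative (x , y , ne)

  -- A commutator of terms from two kernels lies in both.
  full-▹ : ∀ K {ρ σ} t → Gen ρ → Full K ρ → Ev t σ ≈ ε → ¬ (Ev t ρ ≈ ε) → Full (K ▹ A , σ) ρ
  full-▹ K {ρ} {σ} t gen full tσ≈ε tρ≉ε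
    with r , r∈K , r≈x ← full (Commutator.x commutator)
       | s , s∈σ , s≈y ← nontrivial⇒full (emptyKernel ▹ A , σ) t gen (λ { nothing → tσ≈ε }) tρ≉ε
                           (Commutator.y commutator)
       | q , q≈z ← gen (Commutator.z commutator) =
    nontrivial⇒full (K ▹ A , σ) (comm r s q) gen
      (λ { nothing  → trivialʳ A σ r s q (s∈σ nothing)
         ; (just i) → trivialˡ (Kernel.target K i) (Kernel.env K i) r s q (r∈K i) })
      (nontrivial r≈x s≈y q≈z)
    where open Commutator commutator

  -- Each `σ` whose kernel is not inside that of `ρ` is imposed as a further condition; by `full-▹`
  -- all values at `ρ` remain attainable. For `σ ⊑ ρ` this is impossible, since terms trivial at `σ`
  -- are trivial at `ρ`.
  separate : ∀ K {ρ} → Gen ρ → Full K ρ → (S : List Env) → ∀ x →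
             ∃[ t ] K ∋ᵏ t × Ev t ρ ≈ x × (∀ {σ} → σ ∈ˡ S → σ ⊑ ρ ⊎ Ev t σ ≈ ε)
  separate K gen full [] x = let t , t∈K , t≈x = full x in t , t∈K , t≈x , λ ()
  separate K {ρ} gen full (σ ∷ S) x with em {P = σ ⊑ ρ}
  ... | yes σ⊑ρ with t , t∈K , t≈x , sep ← separate K gen full S x =
    t , t∈K , t≈x , λ { (here ≡.refl) → inj₁ σ⊑ρ ; (there σ∈S) → sep σ∈S }
  ... | no σ⋢ρ
    with v , vσ≈ε , vρ≉ε ← dne {P = ∃[ v ] Ev v σ ≈ ε × ¬ (Ev v ρ ≈ ε)}
           (λ none → σ⋢ρ λ v vσ≈ε → dne λ vρ≉ε → none (v , vσ≈ε , vρ≉ε))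
    with t , t∈K , t≈x , sep ← separate (K ▹ A , σ) gen (full-▹ K v gen full vσ≈ε vρ≉ε) S x =
    t , (λ i → t∈K (just i)) , t≈x ,
    λ { (here ≡.refl) → inj₂ (t∈K nothing) ; (there σ∈S) → sep σ∈S }

-- Initial segments of tuples

cutoff : {X : Set a} → ℕ → (ℕ → X) → X → ℕ → X
cutoff m ρ e i with i ℕ.<? m
... | yes _ = ρ i
... | no  _ = e

cutoff-< : ∀ {X : Set a} {m i} (ρ : ℕ → X) e → i < m → cutoff m ρ e i ≡ ρ i
cutoff-< {m = m} {i} ρ e i<m with i ℕ.<? m
... | yes _  = ≡.refl
... | no i≮m = contradiction i<m i≮m

cutoff-≥ : ∀ {X : Set a} {m i} (ρ : ℕ → X) e → m ≤ i → cutoff m ρ e i ≡ e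
cutoff-≥ {m = m} {i} ρ e m≤i with i ℕ.<? m
... | yes i<m = contradiction m≤i (ℕ.<⇒≱ i<m)
... | no  _   = ≡.refl

infixl 8 _↾_

-- Truncation of tuples moved into the syntax: what is known of a term at the finitely many
-- `m`-tuples becomes a statement about a term at all tuples.
_↾_ : Term → ℕ → Term
t ↾ m = t [ cutoff m var 𝟏 ]

module Cutoff (L : Loop c ℓ) where
  open Loop L using (Carrier; _≈_; ε; refl; sym; trans; reflexive)
  open Evaluation L

  ⟦⟧-↾ : ∀ t m (ρ : ℕ → Carrier) → ⟦_⟧ L (t ↾ m) ρ ≈ ⟦_⟧ L t (cutoff m ρ ε)
  ⟦⟧-↾ t m ρ = trans (⟦⟧-subst t (cutoff m var 𝟏) ρ) (⟦⟧-cong t pointwise)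
    where
    pointwise : ∀ i → ⟦_⟧ L (cutoff m var 𝟏 i) ρ ≈ cutoff m ρ ε i
    pointwise i with i ℕ.<? m
    ... | yes _ = refl
    ... | no  _ = refl

  ⟦⟧-cutoff : ∀ t {m} (ρ : ℕ → Carrier) → width t ≤ m → ⟦_⟧ L t (cutoff m ρ ε) ≈ ⟦_⟧ L t ρ
  ⟦⟧-cutoff t ρ w≤m = ⟦⟧-local t λ i i<w → reflexive (cutoff-< ρ ε (ℕ.≤-trans i<w w≤m))

funToFin-cong : ∀ {m n} {f g : Fin m → Fin n} → (∀ i → f i ≡ g i) → funToFin f ≡ funToFin g
funToFin-cong {zero}  eq = ≡.refl
funToFin-cong {suc m} eq = ≡.cong₂ Fin.combine (eq Fin.zero) (funToFin-cong (λ i → eq (Fin.suc i)))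

Fin-bounded : ∀ {n} (f : Fin n → ℕ) → ∃[ m ] ∀ i → f i ≤ m
Fin-bounded {zero}  f = 0 , λ ()
Fin-bounded {suc n} f with m , f≤m ← Fin-bounded (λ i → f (Fin.suc i)) =
  f Fin.zero ⊔ m ,
  λ { Fin.zero → ℕ.m≤m⊔n (f Fin.zero) m
    ; (Fin.suc i) → ℕ.≤-trans (f≤m i) (ℕ.m≤n⊔m (f Fin.zero) m) }

Often : (ℕ → Set) → Set
Often P = ∀ i → ∃[ j ] i ≤ j × P j

module Environments
  (em : ∀ {ℓ} → ExcludedMiddle ℓ) (A : Loop 0ℓ 0ℓ) (finite : IsFinite (Loop.setoid A))
  (simple : IsSimple A) (nonAbelian : NonAbelian A) where

  open Loop A
  open Evaluation A
  open Cutoff A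
  open SimpleLoop em A finite simple nonAbelian

  least : ∀ (P : ℕ → Set) {n} → P n → ∃[ k ] P k × (∀ {j} → j < k → ¬ P j)
  least P {zero}  Pn = 0 , Pn , λ ()
  least P {suc n} Pn with em {P = P 0}
  ... | yes P0 = 0 , P0 , λ ()
  ... | no ¬P0 with k , Pk , min ← least (λ i → P (suc i)) Pn =
    suc k , Pk , λ { {zero} _ → ¬P0 ; {suc j} (s≤s j<k) → min j<k }

  -- Infinite pigeonhole: if every value stopped occurring, a bound for the finitely many stopping
  -- times would contradict `Often P`.
  Often-value : ∀ {P n} (f : ℕ → Fin n) → Often P → ∃[ v ] Often (λ j → P j × f j ≡ v)
  Often-value {P} f often = dne λ none →
    let
      eventually-not : ∀ v → ∃[ i ] ∀ j → i ≤ j → ¬ (P j × f j ≡ v)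
      eventually-not v = dne λ never → none (v , λ i → dne λ no-j →
        never (i , λ j i≤j Pj → no-j (j , i≤j , Pj)))
      m , bound = Fin-bounded (λ v → proj₁ (eventually-not v))
      j , m≤j , Pj = often m
    in proj₂ (eventually-not (f j)) j (ℕ.≤-trans (bound (f j)) m≤j) (Pj , ≡.refl)

  infix 4 _≈[_]_

  _≈[_]_ : Env → ℕ → Env → Set
  ρ ≈[ m ] σ = ∀ i → i < m → ρ i ≈ σ i

  ≈[]-sym : ∀ {m ρ σ} → ρ ≈[ m ] σ → σ ≈[ m ] ρ
  ≈[]-sym eq i i<m = sym (eq i i<m)

  ≈[]-trans : ∀ {m ρ σ τ} → ρ ≈[ m ] σ → σ ≈[ m ] τ → ρ ≈[ m ] τ
  ≈[]-trans eq eq′ i i<m = trans (eq i i<m) (eq′ i i<m)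

  ≈[]-≤ : ∀ {m n ρ σ} → m ≤ n → ρ ≈[ n ] σ → ρ ≈[ m ] σ
  ≈[]-≤ m≤n eq i i<m = eq i (ℕ.≤-trans i<m m≤n)

  module _ (y : ℕ → Env) where
    private
      -- Sequential compactness of the space of tuples. Stage `m` is an infinite set of indices on
      -- which the first `m` coordinates of `y` are constant up to `≈`.
      stage : ℕ → Σ[ P ∈ (ℕ → Set) ] Often P
      stage zero    = (λ _ → ⊤) , λ i → i , ℕ.≤-refl , tt
      stage (suc m) =
        _ , proj₂ (Often-value {proj₁ (stage m)} (λ j → index (y j m)) (proj₂ (stage m)))

    abstract
      cluster : Env
      cluster m =
        element (proj₁ (Often-value {proj₁ (stage m)} (λ j → index (y j m)) (proj₂ (stage m))))

      private
        agrees : ∀ m j → proj₁ (stage m) j → y j ≈[ m ] cluster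
        agrees (suc m) j (before , now) i i<1+m with ℕ.m≤n⇒m<n∨m≡n (ℕ.≤-pred i<1+m)
        ... | inj₁ i<m    = agrees m j before i i<m
        ... | inj₂ ≡.refl = trans (sym (element-index (y j m))) (reflexive (≡.cong element now))

      cluster-often : ∀ m → Often (λ j → y j ≈[ m ] cluster)
      cluster-often m i with j , i≤j , Pj ← proj₂ (stage m) i = j , i≤j , agrees m j Pj

  tr : ℕ → Env → Env
  tr m ρ = cutoff m ρ ε

  tr-agrees : ∀ m ρ → tr m ρ ≈[ m ] ρ
  tr-agrees m ρ i i<m = reflexive (cutoff-< ρ ε i<m)

  tr-cong : ∀ {m ρ σ} → ρ ≈[ m ] σ → ∀ i → tr m ρ i ≈ tr m σ i
  tr-cong {m} eq i with i ℕ.<? m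
  ... | yes i<m = eq i i<m
  ... | no  _   = refl

  tr-tr : ∀ {m n} ρ → m ≤ n → ∀ i → tr m (tr n ρ) i ≈ tr m ρ i
  tr-tr {m} {n} ρ m≤n = tr-cong λ i i<m → tr-agrees n ρ i (ℕ.≤-trans i<m m≤n)

  -- Replaces prefixes up to `≈` by elements of a finite type up to `≡`. Thus all `m`-tuples can be
  -- listed, and a choice made from the code alone respects `≈[ m ]`.
  code : ∀ m → Env → Fin (size ℕ.^ m)
  code m ρ = funToFin {m} λ j → index (ρ (toℕ j))

  decode : ∀ m → Fin (size ℕ.^ m) → Env
  decode m k i with i ℕ.<? m
  ... | yes i<m = element (finToFun k (fromℕ< i<m))
  ... | no  _   = ε

  decode-code : ∀ m ρ i → decode m (code m ρ) i ≈ tr m ρ i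
  decode-code m ρ i with i ℕ.<? m
  ... | no  _   = refl
  ... | yes i<m = trans
    (reflexive (≡.cong element (≡.trans (Fin.finToFun-funToFin {m} (λ j → index (ρ (toℕ j))) (fromℕ< i<m))
      (≡.cong (λ k → index (ρ k)) (Fin.toℕ-fromℕ< i<m)))))
    (element-index (ρ i))

  code-cong : ∀ m {ρ σ} → ρ ≈[ m ] σ → code m ρ ≡ code m σ
  code-cong m eq = funToFin-cong {m} λ j → index-cong (eq (toℕ j) (Fin.toℕ<n j))

  decode-agrees : ∀ m ρ → decode m (code m ρ) ≈[ m ] ρ
  decode-agrees m ρ i i<m = trans (decode-code m ρ i) (tr-agrees m ρ i i<m)

  tuples : ℕ → List Env
  tuples m = List.map (decode m) (allFin (size ℕ.^ m))

  ∈-tuples : ∀ m k → decode m k ∈ˡ tuples m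
  ∈-tuples m k = ∈-map⁺ (decode m) (∈-allFin k)

  Ev-↾ : ∀ t m ρ → Ev (t ↾ m) ρ ≈ Ev t (tr m ρ)
  Ev-↾ = ⟦⟧-↾

  Ev-decode : ∀ t m ρ → Ev t (decode m (code m ρ)) ≈ Ev t (tr m ρ)
  Ev-decode t m ρ = ⟦⟧-cong t (decode-code m ρ)

  ⊑-cong : ∀ {ρ ρ′ σ σ′} → (∀ i → ρ i ≈ ρ′ i) → (∀ i → σ i ≈ σ′ i) → ρ ⊑ σ → ρ′ ⊑ σ′
  ⊑-cong ρ≈ σ≈ ρ⊑σ t tρ′≈ε =
    trans (sym (⟦⟧-cong t σ≈)) (ρ⊑σ t (trans (⟦⟧-cong t ρ≈) tρ′≈ε))

  ⊑-tr : ∀ m {ρ σ} → ρ ⊑ σ → tr m ρ ⊑ tr m σ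
  ⊑-tr m {ρ} {σ} ρ⊑σ t eq =
    trans (sym (Ev-↾ t m σ)) (ρ⊑σ (t ↾ m) (trans (Ev-↾ t m ρ) eq))

  Gen-cong : ∀ {ρ σ} → (∀ i → ρ i ≈ σ i) → Gen ρ → Gen σ
  Gen-cong ρ≈σ gen x with t , eq ← gen x = t , trans (sym (⟦⟧-cong t ρ≈σ)) eq

  Gen-tr⇒Gen : ∀ m ρ → Gen (tr m ρ) → Gen ρ
  Gen-tr⇒Gen m ρ gen x with t , eq ← gen x = t ↾ m , trans (Ev-↾ t m ρ) eq

  Gen-tr-≤ : ∀ {m n} ρ → m ≤ n → Gen (tr m ρ) → Gen (tr n ρ)
  Gen-tr-≤ {m} {n} ρ m≤n gen =
    Gen-tr⇒Gen m (tr n ρ) (Gen-cong (λ i → sym (tr-tr ρ m≤n i)) gen)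

  -- Finitely many terms reach all of the finite loop `A`, and together they read boundedly many
  -- variables. So generating is an open condition.
  Gen⇒Gen-tr : ∀ ρ → Gen ρ → ∃[ m ] Gen (tr m ρ)
  Gen⇒Gen-tr ρ gen with m , w≤m ← Fin-bounded (λ i → width (proj₁ (gen (element i)))) =
    m , λ x → proj₁ (gen (element (index x))) ,
      trans (⟦⟧-cutoff (proj₁ (gen (element (index x)))) ρ (w≤m (index x)))
        (trans (proj₂ (gen (element (index x)))) (element-index x))

  -- A non-generating tuple lives in the proper subloop that it generates. With `W-nonGen`, the
  -- identities of W are exactly the equations valid at all non-generating tuples.
  nonGen-W : ∀ s t → ProperSubloops A ⊨ᶠ s ≈ t → ∀ ρ → ¬ Gen ρ → Ev s ρ ≈ Ev t ρ
  nonGen-W s t s≈t ρ ¬gen = begin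
    Ev s ρ                       ≡⟨ subloop-⟦⟧ A S s ρˢ ⟨
    proj₁ (⟦_⟧ (Subloop.loop S) s ρˢ) ≈⟨ s≈t (S , proper) ρˢ ⟩
    proj₁ (⟦_⟧ (Subloop.loop S) t ρˢ) ≡⟨ subloop-⟦⟧ A S t ρˢ ⟩
    Ev t ρ                       ∎
    where
    open import Relation.Binary.Reasoning.Setoid setoid
    S : Subloop A 0ℓ
    S = image emptyKernel A ρ
    proper : IsProper S
    proper = dne λ none → ¬gen λ x → dne λ no-t → none
      (x , λ (t , _ , eq) → no-t (t , eq))
    ρˢ : ℕ → ∃ (Subloop._∈ S)
    ρˢ i = ρ i , var i , (λ ()) , refl

  W-nonGen : ∀ s t → (∀ ρ → ¬ Gen ρ → Ev s ρ ≈ Ev t ρ) → ProperSubloops A ⊨ᶠ s ≈ t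
  W-nonGen s t s≈t (S , z , z∉S) ρ =
    trans (reflexive (subloop-⟦⟧ A S s ρ)) (trans (s≈t (λ i → proj₁ (ρ i)) ¬gen)
      (sym (reflexive (subloop-⟦⟧ A S t ρ))))
    where
    ¬gen : ¬ Gen (λ i → proj₁ (ρ i))
    ¬gen gen with t , eq ← gen z = z∉S (Subloop.resp S
      (trans (reflexive (subloop-⟦⟧ A S t ρ)) eq) (proj₂ (⟦_⟧ (Subloop.loop S) t ρ)))

-- The points of Y

module Points
  (em : ∀ {ℓ} → ExcludedMiddle ℓ) (A : Loop 0ℓ 0ℓ) (finite : IsFinite (Loop.setoid A))
  (simple : IsSimple A) (nonAbelian : NonAbelian A)
  (C : Loop 0ℓ 0ℓ) (gens : ℕ → Loop.Carrier C) (C∈V : InVariety (Singleton A) C) where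

  open Loop A
  open Evaluation A
  open SimpleLoop em A finite simple nonAbelian
  open Environments em A finite simple nonAbelian

  module C = Loop C

  ⟪_⟫ : Term → C.Carrier
  ⟪ t ⟫ = ⟦_⟧ C t gens

  -- The homomorphisms from the subloop generated by gens to A.
  IsHom : Env → Set
  IsHom ρ = ∀ t → ⟪ t ⟫ C.≈ C.ε → Ev t ρ ≈ ε

  Vanishing : Term → Set
  Vanishing t = ∀ ρ → ¬ Gen ρ → Ev t ρ ≈ ε

  infix 4 _~_

  -- For generating tuples: `σ` is the image of `ρ` under an automorphism of `A`.
  _~_ : Env → Env → Set
  ρ ~ σ = ρ ⊑ σ × σ ⊑ ρ

  -- A choice of representatives for `~`. The default `ρ` is not reached when the list meets the
  -- class of `ρ`, and then the result depends on the class alone.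
  pick : List Env → Env → Env
  pick []      ρ = ρ
  pick (σ ∷ S) ρ with em {P = σ ~ ρ}
  ... | yes _ = σ
  ... | no  _ = pick S ρ

  pick-~ : ∀ S ρ → pick S ρ ~ ρ
  pick-~ []      ρ = (λ t eq → eq) , (λ t eq → eq)
  pick-~ (σ ∷ S) ρ with em {P = σ ~ ρ}
  ... | yes σ~ρ = σ~ρ
  ... | no  _   = pick-~ S ρ

  ~-trans : ∀ {ρ σ τ} → ρ ~ σ → σ ~ τ → ρ ~ τ
  ~-trans (p , q) (p′ , q′) = (λ t eq → p′ t (p t eq)) , (λ t eq → q t (q′ t eq))

  ~-sym : ∀ {ρ σ} → ρ ~ σ → σ ~ ρ
  ~-sym (p , q) = q , p

  pick-unique : ∀ S {ρ ρ′ σ} → ρ ~ ρ′ → σ ∈ˡ S → σ ~ ρ → pick S ρ ≡ pick S ρ′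
  pick-unique (τ ∷ S) {ρ} {ρ′} ρ~ρ′ σ∈S σ~ρ with em {P = τ ~ ρ} | em {P = τ ~ ρ′}
  ... | yes _   | yes _    = ≡.refl
  ... | yes τ~ρ | no τ≁ρ′  = contradiction (~-trans τ~ρ ρ~ρ′) τ≁ρ′
  ... | no τ≁ρ  | yes τ~ρ′ = contradiction (~-trans τ~ρ′ (~-sym ρ~ρ′)) τ≁ρ
  pick-unique (τ ∷ S) ρ~ρ′ (here ≡.refl) σ~ρ | no τ≁ρ | no _ = contradiction σ~ρ τ≁ρ
  pick-unique (τ ∷ S) ρ~ρ′ (there σ∈S)   σ~ρ | no _   | no _ = pick-unique S ρ~ρ′ σ∈S σ~ρ

  -- The surjective homomorphisms up to automorphisms of A: as representative
  -- serves the one whose shortest generating initial segment comes first in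
  -- the list of all tuples of that length.
  record Point : Set where
    field
      env       : Env
      isHom     : IsHom env
      level     : ℕ
      generates : Gen (tr level env)
      minimal   : ∀ {j} → j < level → ¬ Gen (tr j env)
      canonical : ∀ i → tr level env i ≈ pick (tuples level) (tr level env) i

  open Point using (env; level)

  level-≤ : ∀ y n → Gen (tr n (env y)) → level y ≤ n
  level-≤ y n gen = ℕ.≮⇒≥ λ n<l → Point.minimal y n<l gen

  decode-~ : ∀ m ρ → decode m (code m ρ) ~ tr m ρ
  decode-~ m ρ =
    ⊑-cong (λ _ → refl) (decode-code m ρ) (λ t eq → eq) ,
    ⊑-cong (decode-code m ρ) (λ _ → refl) (λ t eq → eq)

  -- Every later coordinate of `ρ` is a term in the generating prefix, and `σ` inherits this
  -- equation.
  determined : ∀ {ρ σ} k → Gen (tr k ρ) → (∀ i → tr k ρ i ≈ tr k σ i) → ρ ⊑ σ → ∀ i → ρ i ≈ σ i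
  determined {ρ} {σ} k gen eq ρ⊑σ i with t , t≈ ← gen (ρ i) = begin
    ρ i           ≈⟨ t≈ ⟨
    Ev t (tr k ρ) ≈⟨ ⟦⟧-cong t eq ⟩
    Ev t (tr k σ) ≈⟨ Ev-↾ t k σ ⟨
    Ev (t ↾ k) σ  ≈⟨ ⊑-≈ ρ⊑σ (t ↾ k) (var i) (trans (Ev-↾ t k ρ) t≈) ⟩
    σ i           ∎
    where open import Relation.Binary.Reasoning.Setoid setoid

  -- All shorter prefixes of the two points have the same kernels, so the levels agree. The prefixes
  -- of that length are canonical representatives of one class, hence equal, and `determined`
  -- extends the equality up to `n`.
  point-unique : ∀ y y′ n → Gen (tr n (env y′)) → tr n (env y) ⊑ tr n (env y′) →
                 env y ≈[ n ] env y′
  point-unique y y′ n gen′ n⊑ i i<n = begin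
    env y i         ≈⟨ tr-agrees n (env y) i i<n ⟨
    tr n (env y) i  ≈⟨ determined k
                         (Gen-cong (λ j → sym (tr-tr (env y) (level-≤ y n gen) j)) (Point.generates y))
                         (λ j → trans (tr-tr (env y) (level-≤ y n gen) j)
                           (trans (trk≈ j) (sym (tr-tr (env y′) (level-≤ y n gen) j))))
                         n⊑ i ⟩
    tr n (env y′) i ≈⟨ tr-agrees n (env y′) i i<n ⟩
    env y′ i        ∎
    where
    open import Relation.Binary.Reasoning.Setoid setoid
    k k′ : ℕ
    k  = level y
    k′ = level y′
    gen : Gen (tr n (env y))
    gen = proj₁ (gen-⊑ gen′ n⊑)
    n~ : tr n (env y) ~ tr n (env y′)
    n~ = n⊑ , proj₂ (gen-⊑ gen′ n⊑)
    shorten : ∀ {m} ρ σ → m ≤ n → tr n ρ ⊑ tr n σ → tr m ρ ⊑ tr m σ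
    shorten {m} ρ σ m≤n ⊑n = ⊑-cong (tr-tr ρ m≤n) (tr-tr σ m≤n) (⊑-tr m ⊑n)
    k≤k′ : k ≤ k′
    k≤k′ = level-≤ y k′ (proj₁ (gen-⊑ (Point.generates y′)
      (shorten (env y) (env y′) (level-≤ y′ n gen′) n⊑)))
    k′≤k : k′ ≤ k
    k′≤k = level-≤ y′ k (proj₁ (gen-⊑ (Point.generates y)
      (shorten (env y′) (env y) (level-≤ y n gen) (proj₂ n~))))
    canonical′ : ∀ j → tr k (env y′) j ≈ pick (tuples k) (tr k (env y′)) j
    canonical′ = ≡.subst (λ l → ∀ j → tr l (env y′) j ≈ pick (tuples l) (tr l (env y′)) j)
      (ℕ.≤-antisym k′≤k k≤k′) (Point.canonical y′)
    k~ : tr k (env y) ~ tr k (env y′)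
    k~ = shorten (env y) (env y′) (level-≤ y n gen) n⊑ ,
         shorten (env y′) (env y) (level-≤ y n gen) (proj₂ n~)
    trk≈ : ∀ j → tr k (env y) j ≈ tr k (env y′) j
    trk≈ j = trans (Point.canonical y j) (trans
      (reflexive (≡.cong (λ ρ → ρ j) (pick-unique (tuples k) k~
        (∈-tuples k (code k (env y))) (decode-~ k (env y)))))
      (sym (canonical′ j)))

  abstract
    -- Applies to `ρ` the automorphism of `A` that moves its shortest generating prefix to the
    -- representative: `ρ i` is the value of `term i` at the prefix, so its image is the value of
    -- `term i` at `rep`.
    point-exists : ∀ {ρ} → Gen ρ → IsHom ρ → ∃[ y ] ρ ~ env y
    point-exists {ρ} genρ ρ-hom = record
      { env       = y
      ; isHom     = λ t eq → proj₁ ρ~y t (ρ-hom t eq)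
      ; level     = k
      ; generates = Gen-cong (λ i → sym (trk≈ i)) (proj₁ (gen-⊑ gen (proj₁ rep~)))
      ; minimal   = λ {j} j<k genj → min j<k (proj₁ (gen-⊑ genj (⊑-tr j (proj₁ ρ~y))))
      ; canonical = λ i → trans (trk≈ i) (reflexive (≡.cong (λ σ → σ i)
          (pick-unique (tuples k) (⊑-tr k (proj₁ ρ~y) , ⊑-tr k (proj₂ ρ~y))
            (∈-tuples k (code k ρ)) (decode-~ k ρ))))
      } , ρ~y
      where
      shortest : ∃[ k ] Gen (tr k ρ) × (∀ {j} → j < k → ¬ Gen (tr j ρ))
      shortest = least (λ k → Gen (tr k ρ)) {proj₁ (Gen⇒Gen-tr ρ genρ)} (proj₂ (Gen⇒Gen-tr ρ genρ))
      k : ℕ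
      k = proj₁ shortest
      gen : Gen (tr k ρ)
      gen = proj₁ (proj₂ shortest)
      min : ∀ {j} → j < k → ¬ Gen (tr j ρ)
      min = proj₂ (proj₂ shortest)
      rep : Env
      rep = pick (tuples k) (tr k ρ)
      rep~ : rep ~ tr k ρ
      rep~ = pick-~ (tuples k) (tr k ρ)
      term : ℕ → Term
      term i = proj₁ (gen (ρ i))
      y : Env
      y i = Ev (term i) rep
      Ev-ρ : ∀ t → Ev (t [ term ]) (tr k ρ) ≈ Ev t ρ
      Ev-ρ t = trans (⟦⟧-subst t term (tr k ρ)) (⟦⟧-cong t λ i → proj₂ (gen (ρ i)))
      ρ~y : ρ ~ y
      ρ~y = (λ t eq → trans (sym (⟦⟧-subst t term rep)) (proj₂ rep~ (t [ term ]) (trans (Ev-ρ t) eq))) ,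
            (λ t eq → trans (sym (Ev-ρ t)) (proj₁ rep~ (t [ term ]) (trans (⟦⟧-subst t term rep) eq)))
      trk≈ : ∀ i → tr k y i ≈ rep i
      trk≈ i with i ℕ.<? k
      ... | yes i<k = ⊑-≈ (proj₂ rep~) (term i) (var i)
        (trans (proj₂ (gen (ρ i))) (sym (tr-agrees k ρ i i<k)))
      -- From `k` on the truncated tuple is trivial, hence so is the equivalent tuple `rep`.
      ... | no i≮k = sym (proj₂ rep~ (var i) (reflexive (cutoff-≥ ρ ε (ℕ.≮⇒≥ i≮k))))

  module _ (t : Term) (vanishing : Vanishing t) where
    private
      gens↾ : ℕ → ℕ → C.Carrier
      gens↾ n = cutoff n gens C.ε

      K : ℕ → Kernel
      K n = emptyKernel ▹ C , gens↾ n

      -- Corrects t modulo K n, one n-tuple after the other, until it vanishes at all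
      -- of them.
      kill : ∀ n → (∀ ρ → ¬ (Ev t ρ ≈ ε) → ∃[ u ] K n ∋ᵏ u × ¬ (Ev u ρ ≈ ε)) →
             ∀ L → (∀ {σ} → σ ∈ˡ L → σ ∈ˡ tuples n) →
             ∃[ s ] ⟦_⟧ C s (gens↾ n) C.≈ ⟦_⟧ C t (gens↾ n) ×
                    (∀ {σ} → σ ∈ˡ L → Ev s σ ≈ ε) ×
                    (∀ {σ} → σ ∈ˡ tuples n → Ev t σ ≈ ε → Ev s σ ≈ ε)
      kill n _ [] _ = t , C.refl , (λ ()) , λ _ eq → eq
      kill n hyp (ρ ∷ L) L⊆
        with s , s≈t , s-L , s-t ← kill n hyp L (λ σ∈L → L⊆ (there σ∈L))
        with em {P = Ev s ρ ≈ ε}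
      ... | yes sρ≈ε = s , s≈t , (λ { (here ≡.refl) → sρ≈ε ; (there σ∈L) → s-L σ∈L }) , s-t
      ... | no sρ≉ε
        -- The last invariant of `s` turns its nontriviality at `ρ` into that of `t`, about which
        -- `hyp` and `vanishing` speak.
        with v , v∈K , vρ≉ε ← hyp ρ (λ tρ≈ε → sρ≉ε (s-t (L⊆ (here ≡.refl)) tρ≈ε)) =
        s ⧸ u , C.trans (C.//-congˡ (u∈K nothing)) (C.trans (Evaluation.x//ε≈x C _) s≈t) ,
        (λ { (here ≡.refl) → s⧸u-ρ ; (there σ∈L) → keep (L⊆ (there σ∈L)) (s-L σ∈L) }) ,
        (λ σ∈S tσ≈ε → keep σ∈S (s-t σ∈S tσ≈ε))
        where
        gen : Gen ρ
        gen = dne λ ¬gen → sρ≉ε (s-t (L⊆ (here ≡.refl)) (vanishing ρ ¬gen))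
        separated = separate (K n) gen (nontrivial⇒full (K n) v gen v∈K vρ≉ε) (tuples n) (Ev s ρ)
        u = proj₁ separated
        u∈K = proj₁ (proj₂ separated)
        s⧸u-ρ : Ev (s ⧸ u) ρ ≈ ε
        s⧸u-ρ = x≈y⇒x//y≈ε (sym (proj₁ (proj₂ (proj₂ separated))))
        keep : ∀ {σ} → σ ∈ˡ tuples n → Ev s σ ≈ ε → Ev (s ⧸ u) σ ≈ ε
        keep σ∈S sσ≈ε with proj₂ (proj₂ (proj₂ separated)) σ∈S
        -- Here `σ` and `ρ` have the same kernel, so the corrected term vanishes at both.
        ... | inj₁ σ⊑ρ  = proj₂ (gen-⊑ gen σ⊑ρ) (s ⧸ u) s⧸u-ρ
        ... | inj₂ uσ≈ε = ε//ε≈ε A sσ≈ε uσ≈ε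

      -- Otherwise `kill` yields a term with the value of `t` at `gens↾ n` that is trivial at all
      -- `n`-tuples of `A`. Its truncation is then trivial in `A` identically, hence in `C`, and so
      -- `t` has a trivial value. The tuple found respects all relations of the first `n`
      -- generators.
      witness : ∀ n → width t ≤ n → ¬ (⟪ t ⟫ C.≈ C.ε) →
                ∃[ ρ ] ¬ (Ev t ρ ≈ ε) × (∀ u → K n ∋ᵏ u → Ev u ρ ≈ ε)
      witness n w≤n t≉ε = dne λ none → t≉ε
        (let
          s , s≈t , s-S , _ = kill n
            (λ ρ tρ≉ε → dne λ no-u → none (ρ , tρ≉ε , λ u u∈K → dne λ uρ≉ε → no-u (u , u∈K , uρ≉ε)))
            (tuples n) (λ σ∈S → σ∈S)
          s↾n≈ε : Singleton A ⊨ᶠ s ↾ n ≈ 𝟏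
          s↾n≈ε _ ρ = trans (Ev-↾ s n ρ)
            (trans (sym (Ev-decode s n ρ)) (s-S (∈-tuples n (code n ρ))))
        in C.trans (C.sym (Cutoff.⟦⟧-cutoff C t gens w≤n)) (C.trans (C.sym s≈t)
          (C.trans (C.sym (Cutoff.⟦⟧-↾ C s n gens)) (C∈V (s ↾ n) 𝟏 s↾n≈ε gens))))

    -- A nontrivial value of t is detected at arbitrarily long tuples, and these
    -- cluster at a homomorphism.
    abstract
      separation : (∀ y → Ev t (env y) ≈ ε) → ⟪ t ⟫ C.≈ C.ε
      separation t-points = dne λ t≉ε →
        let
          approx : ∀ n → ∃[ ρ ] ¬ (Ev t ρ ≈ ε) × (∀ u → K (width t ⊔ n) ∋ᵏ u → Ev u ρ ≈ ε)
          approx n = witness (width t ⊔ n) (ℕ.m≤m⊔n (width t) n) t≉ε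
          y : ℕ → Env
          y n = proj₁ (approx n)
          ρ = cluster y
          tρ≉ε : ¬ (Ev t ρ ≈ ε)
          tρ≉ε tρ≈ε = let j , _ , eq = cluster-often y (width t) 0 in
            proj₁ (proj₂ (approx j)) (trans (⟦⟧-local t eq) tρ≈ε)
          ρ-hom : IsHom ρ
          ρ-hom u u≈ε = let j , w≤j , eq = cluster-often y (width u) (width u) in
            trans (sym (⟦⟧-local u eq)) (proj₂ (proj₂ (approx j)) u λ
              { nothing → C.trans (Cutoff.⟦⟧-cutoff C u gens
                  (ℕ.≤-trans w≤j (ℕ.m≤n⊔m (width t) j))) u≈ε })
          p , ρ~p = point-exists (dne λ ¬gen → tρ≉ε (vanishing ρ ¬gen)) ρ-hom
        in tρ≉ε (proj₂ ρ~p t (t-points p))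

  module _ (g : Point → Carrier) (m : ℕ)
    (local : ∀ {y y′} → env y ≈[ m ] env y′ → g y ≈ g y′)
    (supported : ∀ y → ¬ Gen (tr m (env y)) → g y ≈ ε) where
    private
      prefix : Point → Env
      prefix y = decode m (code m (env y))

      prefix-≈ : ∀ {y y′} → prefix y ≡ prefix y′ → env y ≈[ m ] env y′
      prefix-≈ {y} {y′} eq i i<m = trans (sym (decode-agrees m (env y) i i<m))
        (trans (reflexive (≡.cong (λ ρ → ρ i) eq)) (decode-agrees m (env y′) i i<m))

      -- Corrects one prefix at a time. The factor `u` is trivial at every tuple whose kernel is not
      -- inside that of the new prefix; by `point-unique`, a prefix of a point is exceptional only
      -- if it is the new one. So values obtained earlier survive.
      approximate : ∀ L → ∃[ t ] (∀ {σ} → σ ∈ˡ tuples m → ¬ Gen σ → Ev t σ ≈ ε) ×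
                                 (∀ y → prefix y ∈ˡ L → Ev t (prefix y) ≈ g y)
      approximate [] = 𝟏 , (λ _ _ → refl) , λ _ ()
      approximate (ρ ∷ L)
        with t , t-van , t-g ← approximate L
        with em {P = ∃[ y ] ρ ≡ prefix y × Gen ρ}
      ... | no none = t , t-van , λ
        { y (here ≡.refl) →
            let ¬gen : ¬ Gen (prefix y)
                ¬gen gen = none (y , ≡.refl , gen)
            in trans (t-van (∈-tuples m (code m (env y))) ¬gen)
                 (sym (supported y λ gen → ¬gen (Gen-cong (λ i → sym (decode-code m (env y) i)) gen)))
        ; y (there y∈L) → t-g y y∈L
        }
      ... | yes (y₀ , ≡.refl , gen) = t · u ,
        (λ {σ} σ∈S ¬gen → ε∙ε≈ε A (t-van σ∈S ¬gen) (u-van σ∈S ¬gen)) ,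
        λ { y (here eq)   → at-y₀ y eq
          ; y (there y∈L) → at-L y y∈L }
        where
        separated = separate emptyKernel gen (λ x → let s , eq = gen x in s , (λ ()) , eq)
                      (tuples m) (Ev t (prefix y₀) \\ g y₀)
        u = proj₁ separated
        u-van : ∀ {σ} → σ ∈ˡ tuples m → ¬ Gen σ → Ev u σ ≈ ε
        u-van σ∈S ¬gen with proj₂ (proj₂ (proj₂ separated)) σ∈S
        ... | inj₁ σ⊑  = contradiction (proj₁ (gen-⊑ gen σ⊑)) ¬gen
        ... | inj₂ u≈ε = u≈ε
        at-y₀ : ∀ y → prefix y ≡ prefix y₀ → Ev (t · u) (prefix y) ≈ g y
        at-y₀ y eq = begin
          Ev (t · u) (prefix y)                          ≡⟨ ≡.cong (Ev (t · u)) eq ⟩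
          Ev t (prefix y₀) ∙ Ev u (prefix y₀)            ≈⟨ ∙-congˡ (proj₁ (proj₂ (proj₂ separated))) ⟩
          Ev t (prefix y₀) ∙ (Ev t (prefix y₀) \\ g y₀)  ≈⟨ leftDividesˡ _ _ ⟩
          g y₀                                           ≈⟨ local {y₀} {y} (prefix-≈ {y₀} {y} (≡.sym eq)) ⟩
          g y                                            ∎
          where open import Relation.Binary.Reasoning.Setoid setoid
        at-L : ∀ y → prefix y ∈ˡ L → Ev (t · u) (prefix y) ≈ g y
        at-L y y∈L with proj₂ (proj₂ (proj₂ separated)) (∈-tuples m (code m (env y)))
        ... | inj₂ u≈ε = trans (∙-cong (t-g y y∈L) u≈ε) (identityʳ (g y))
        ... | inj₁ y⊑y₀ = at-y₀ y (≡.cong (decode m) (code-cong m (point-unique y y₀ m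
          (Gen-cong (decode-code m (env y₀)) gen)
          (⊑-cong (decode-code m (env y)) (decode-code m (env y₀)) y⊑y₀))))

    abstract
      -- Truncating the interpolating term at `m` carries its properties from the listed tuples to
      -- all tuples.
      realize : ∃[ t ] Vanishing t × (∀ y → Ev t (env y) ≈ g y)
      realize with t , t-van , t-g ← approximate (tuples m) =
        t ↾ m ,
        (λ ρ ¬gen → trans (Ev-↾ t m ρ) (trans (sym (Ev-decode t m ρ))
          (t-van (∈-tuples m (code m ρ)) λ gen →
            ¬gen (Gen-tr⇒Gen m ρ (Gen-cong (decode-code m ρ) gen))))) ,
        (λ y → trans (Ev-↾ t m (env y)) (trans (sym (Ev-decode t m (env y)))
          (t-g y (∈-tuples m (code m (env y))))))

-- The retraction and the complement

module Splitting
  (em : ∀ {ℓ} → ExcludedMiddle ℓ) (A : Loop 0ℓ 0ℓ) (finite : IsFinite (Loop.setoid A))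
  (simple : IsSimple A) (nonAbelian : NonAbelian A)
  (C : Loop 0ℓ 0ℓ) (gens : ℕ → Loop.Carrier C) (C∈V : InVariety (Singleton A) C)
  (generating : Generates C gens) where

  open Loop A
  open Evaluation A
  open SimpleLoop em A finite simple nonAbelian
  open Environments em A finite simple nonAbelian
  open Points em A finite simple nonAbelian C gens C∈V
  open Point using (env; level)

  -- The trivial homomorphism, which guarantees `nearest` a degenerate value to fall back on.
  origin : Env
  origin _ = ε

  Ev-origin : ∀ t → Ev t origin ≈ ε
  Ev-origin (var i) = refl
  Ev-origin (s · t) = ε∙ε≈ε A (Ev-origin s) (Ev-origin t)
  Ev-origin (s ⧵ t) = ε\\ε≈ε A (Ev-origin s) (Ev-origin t)
  Ev-origin (s ⧸ t) = ε//ε≈ε A (Ev-origin s) (Ev-origin t)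
  Ev-origin 𝟏       = refl

  Degenerate : Env → Set
  Degenerate ρ = IsHom ρ × ¬ Gen ρ

  origin-degenerate : Degenerate origin
  origin-degenerate = (λ t _ → Ev-origin t) , λ gen →
    let z , z≉ε = IsSimple.nontrivial simple
        t , t≈z = gen z
    in z≉ε (trans (sym t≈z) (Ev-origin t))

  -- Stated for a code, so that the witness obtained from excluded middle is the same for all tuples
  -- with that prefix. For the same reason `orElse` is a function of the decision: `nearest-cong` is
  -- then mere congruence.
  Near : ∀ m → Fin (size ℕ.^ m) → Set
  Near m k = ∃[ z ] Degenerate z × z ≈[ m ] decode m k

  Near-code : ∀ {m ρ z} → Degenerate z → z ≈[ m ] ρ → Near m (code m ρ)
  Near-code {m} {ρ} {z} deg z≈ρ = z , deg , ≈[]-trans z≈ρ (≈[]-sym (decode-agrees m ρ))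

  Near-≤ : ∀ {j m} ρ → j ≤ m → Near m (code m ρ) → Near j (code j ρ)
  Near-≤ {j} {m} ρ j≤m (z , deg , z≈) =
    Near-code deg (≈[]-≤ j≤m (≈[]-trans z≈ (decode-agrees m ρ)))

  orElse : ∀ {m k} → Dec (Near m k) → Env → Env
  orElse (yes (z , _)) _ = z
  orElse (no _)        ρ = ρ

  -- A degenerate homomorphism sharing with ρ the longest possible initial
  -- segment of length at most m.
  nearest : ℕ → Env → Env
  nearest zero    ρ = origin
  nearest (suc m) ρ = orElse (em {P = Near (suc m) (code (suc m) ρ)}) (nearest m ρ)

  nearest-degenerate : ∀ m ρ → Degenerate (nearest m ρ)
  nearest-degenerate zero    ρ = origin-degenerate
  nearest-degenerate (suc m) ρ with em {P = Near (suc m) (code (suc m) ρ)}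
  ... | yes (_ , deg , _) = deg
  ... | no _              = nearest-degenerate m ρ

  nearest-cong : ∀ m {ρ σ} → ρ ≈[ m ] σ → nearest m ρ ≡ nearest m σ
  nearest-cong zero    eq = ≡.refl
  nearest-cong (suc m) eq = ≡.cong₂ (λ k τ → orElse (em {P = Near (suc m) k}) τ)
    (code-cong (suc m) eq) (nearest-cong m (≈[]-≤ (ℕ.n≤1+n m) eq))

  nearest-agrees : ∀ {j} m ρ → j ≤ m → Near j (code j ρ) → nearest m ρ ≈[ j ] ρ
  nearest-agrees zero    ρ z≤n near i ()
  nearest-agrees (suc m) ρ j≤1+m near with em {P = Near (suc m) (code (suc m) ρ)}
  ... | yes (z , _ , z≈) = ≈[]-≤ j≤1+m (≈[]-trans z≈ (decode-agrees (suc m) ρ))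
  ... | no ¬near with ℕ.m≤n⇒m<n∨m≡n j≤1+m
  ...   | inj₁ j<1+m  = nearest-agrees m ρ (ℕ.≤-pred j<1+m) near
  ...   | inj₂ ≡.refl = contradiction near ¬near

  -- `Near` passes to shorter prefixes, so after one failure no longer prefix succeeds.
  nearest-stable : ∀ {j} m ρ → j ≤ m → ¬ Near j (code j ρ) → nearest m ρ ≡ nearest j ρ
  nearest-stable zero    ρ z≤n   ¬near = ≡.refl
  nearest-stable (suc m) ρ j≤1+m ¬near with ℕ.m≤n⇒m<n∨m≡n j≤1+m
  ... | inj₂ ≡.refl = ≡.refl
  ... | inj₁ j<1+m with em {P = Near (suc m) (code (suc m) ρ)}
  ...   | yes near = contradiction (Near-≤ ρ j≤1+m near) ¬near
  ...   | no _     = nearest-stable m ρ (ℕ.≤-pred j<1+m) ¬near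

  -- The search may stop at `level y`: the prefix of that length generates, so no degenerate tuple
  -- shares it.
  retract : Point → Env
  retract y = nearest (level y) (env y)

  retract-degenerate : ∀ y → Degenerate (retract y)
  retract-degenerate y = nearest-degenerate (level y) (env y)

  level-¬near : ∀ y → ¬ Near (level y) (code (level y) (env y))
  level-¬near y (z , (_ , ¬gen) , z≈) = ¬gen (Gen-tr⇒Gen (level y) z
    (Gen-cong (tr-cong (≈[]-sym (≈[]-trans z≈ (decode-agrees (level y) (env y)))))
      (Point.generates y)))

  retract-nearest : ∀ y m → level y ≤ m → retract y ≡ nearest m (env y)
  retract-nearest y m l≤m = ≡.sym (nearest-stable m (env y) l≤m (level-¬near y))

  -- If the common prefix of length `suc i` is near, both retractions agree with their points there;
  -- if not, the searches end before it and see only this prefix.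
  retract-local : ∀ y y′ i → env y ≈[ suc i ] env y′ → retract y i ≈ retract y′ i
  retract-local y y′ i eq = begin
    retract y i           ≡⟨ ≡.cong (λ ρ → ρ i) (retract-nearest y M l≤M) ⟩
    nearest M (env y) i   ≈⟨ by-cases em ⟩
    nearest M (env y′) i  ≡⟨ ≡.cong (λ ρ → ρ i) (retract-nearest y′ M l′≤M) ⟨
    retract y′ i          ∎
    where
    open import Relation.Binary.Reasoning.Setoid setoid
    M : ℕ
    M = (level y ⊔ level y′) ⊔ suc i
    l≤M : level y ≤ M
    l≤M = ℕ.≤-trans (ℕ.m≤m⊔n (level y) (level y′)) (ℕ.m≤m⊔n (level y ⊔ level y′) (suc i))
    l′≤M : level y′ ≤ M
    l′≤M = ℕ.≤-trans (ℕ.m≤n⊔m (level y) (level y′)) (ℕ.m≤m⊔n (level y ⊔ level y′) (suc i))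
    i≤M : suc i ≤ M
    i≤M = ℕ.m≤n⊔m (level y ⊔ level y′) (suc i)
    by-cases : Dec (Near (suc i) (code (suc i) (env y))) →
               nearest M (env y) i ≈ nearest M (env y′) i
    by-cases (yes near) = trans (nearest-agrees M (env y) i≤M near i ℕ.≤-refl)
      (trans (eq i ℕ.≤-refl) (sym (nearest-agrees M (env y′) i≤M
        (≡.subst (Near (suc i)) (code-cong (suc i) eq) near) i ℕ.≤-refl)))
    by-cases (no ¬near) = reflexive (≡.cong (λ ρ → ρ i)
      (≡.trans (nearest-stable M (env y) i≤M ¬near)
        (≡.trans (nearest-cong (suc i) eq)
          (≡.sym (nearest-stable M (env y′) i≤M
            λ near → ¬near (≡.subst (Near (suc i)) (≡.sym (code-cong (suc i) eq)) near))))))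

  -- Points with long non-generating initial segments cluster at degenerate
  -- homomorphisms only.
  abstract
    eventually-near : ∀ m → ∃[ n ] ∀ y → ¬ Gen (tr n (env y)) → Near m (code m (env y))
    eventually-near m = dne λ none → absurd λ n →
      dne λ no-y → none (n , λ y ¬gen → dne λ ¬near → no-y (y , ¬gen , ¬near))
      where
      absurd : ¬ (∀ n → ∃[ y ] ¬ Gen (tr n (env y)) × ¬ Near m (code m (env y)))
      absurd far with j , _ , eq ← cluster-often (λ n → env (proj₁ (far n))) m 0 =
        proj₂ (proj₂ (far j)) (Near-code (hom , ¬gen) (≈[]-sym eq))
        where
        y : ℕ → Env
        y n = env (proj₁ (far n))
        hom : IsHom (cluster y)
        hom t t≈ε with k , _ , eq′ ← cluster-often y (width t) 0 =
          trans (sym (⟦⟧-local t eq′)) (Point.isHom (proj₁ (far k)) t t≈ε)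
        ¬gen : ¬ Gen (cluster y)
        ¬gen gen with k , genk ← Gen⇒Gen-tr (cluster y) gen
          with l , k≤l , eq′ ← cluster-often y k k =
          proj₁ (proj₂ (far l)) (Gen-tr-≤ (y l) k≤l (Gen-cong (tr-cong (≈[]-sym eq′)) genk))

    -- The retraction tends to the identity at infinity, which gives the quotient realized below its
    -- compact support.
    retract-agrees : ∀ m → ∃[ n ] ∀ y → ¬ Gen (tr n (env y)) → retract y ≈[ m ] env y
    retract-agrees m with n , near ← eventually-near m = n , λ y ¬gen i i<m → trans
      (reflexive (≡.cong (λ ρ → ρ i) (retract-nearest y (level y ⊔ m) (ℕ.m≤m⊔n (level y) m))))
      (nearest-agrees (level y ⊔ m) (env y) (ℕ.m≤n⊔m (level y) m) (near y ¬gen) i i<m)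

  vanishing : Kernel
  vanishing = record { Index = ∃[ ρ ] ¬ Gen ρ ; target = λ _ → A ; env = proj₁ }

  N : Subloop C 0ℓ
  N = image vanishing C gens

  N-normal : IsNormal N
  N-normal = image-normal vanishing C gens generating

  Fixed : Term → Set
  Fixed t = ∀ y → Ev t (env y) ≈ Ev t (retract y)

  H : Subloop C 0ℓ
  H = record
    { _∈        = λ x → ∃[ t ] Fixed t × ⟪ t ⟫ C.≈ x
    ; resp      = λ x≈y (t , fix , eq) → t , fix , C.trans eq x≈y
    ; ∙-closed  = λ (s , fs , s≈) (t , ft , t≈) → s · t , (λ y → ∙-cong (fs y) (ft y)) , C.∙-cong s≈ t≈
    ; \\-closed = λ (s , fs , s≈) (t , ft , t≈) → s ⧵ t , (λ y → \\-cong (fs y) (ft y)) , C.\\-cong s≈ t≈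
    ; //-closed = λ (s , fs , s≈) (t , ft , t≈) → s ⧸ t , (λ y → //-cong (fs y) (ft y)) , C.//-cong s≈ t≈
    ; ε-closed  = 𝟏 , (λ _ → refl) , C.refl
    }

  Ev-hom : ∀ {ρ} s t → IsHom ρ → ⟪ s ⟫ C.≈ ⟪ t ⟫ → Ev s ρ ≈ Ev t ρ
  Ev-hom s t hom eq = x//y≈ε⇒x≈y (hom (s ⧸ t) (Evaluation.x≈y⇒x//y≈ε C eq))

  module _ (t : Term) where
    private
      m : ℕ
      m = proj₁ (retract-agrees (width t))

      abstract
        realized : ∃[ n ] Vanishing n × (∀ y → Ev n (env y) ≈ Ev t (env y) \\ Ev t (retract y))
        -- The bound `width t` makes both values of `t` locally constant. The bound `m` makes
        -- `retract y` agree with `y` on the variables of `t` wherever the prefix fails to generate.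
        realized = realize (λ y → Ev t (env y) \\ Ev t (retract y)) (width t ⊔ m)
          (λ {y} {y′} eq → \\-cong
            (⟦⟧-local t (≈[]-≤ (ℕ.m≤m⊔n (width t) m) eq))
            (⟦⟧-local t λ i i<w → retract-local y y′ i
              (≈[]-≤ (ℕ.≤-trans i<w (ℕ.m≤m⊔n (width t) m)) eq)))
          (λ y ¬gen → trans
            (\\-congˡ (sym (⟦⟧-local t (≈[]-sym (proj₂ (retract-agrees (width t)) y
              λ gen → ¬gen (Gen-tr-≤ (env y) (ℕ.m≤n⊔m (width t) m) gen))))))
            (x\\x≈ε (Ev t (env y))))

      n : Term
      n = proj₁ realized

      n-vanishing : Vanishing n
      n-vanishing = proj₁ (proj₂ realized)

      t·n-fixed : Fixed (t · n)
      t·n-fixed y = trans (∙-congˡ (proj₂ (proj₂ realized) y))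
        (trans (leftDividesˡ (Ev t (env y)) (Ev t (retract y)))
          (sym (trans (∙-congˡ (n-vanishing (retract y) (proj₂ (retract-degenerate y))))
            (identityʳ (Ev t (retract y))))))

    abstract
      -- With the left quotient as the value of `n`, the product takes at a point the value of `t`
      -- at its retraction. At the retraction itself `n` is trivial, and the product has the same
      -- value.
      fix : ∃[ n ] Vanishing n × Fixed (t · n)
      fix = n , n-vanishing , t·n-fixed

  -- Comparing the values at `y` with those at its retraction, where `n` is trivial, shows that `n`
  -- is trivial at `y` too; `separation` concludes. Both the uniqueness in the transversal and the
  -- trivial meet rest on this.
  fixed-unique : ∀ s s′ n → Fixed s → Fixed s′ → Vanishing n →
                 ⟪ s′ ⟫ C.≈ ⟪ s ⟫ C.∙ ⟪ n ⟫ → ⟪ s ⟫ C.≈ ⟪ s′ ⟫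
  fixed-unique s s′ n fs fs′ van eq =
    C.sym (C.trans eq (C.trans (C.∙-congˡ (separation n van n-points)) (C.identityʳ _)))
    where
    open import Relation.Binary.Reasoning.Setoid setoid
    n-points : ∀ y → Ev n (env y) ≈ ε
    n-points y = LoopProperties.identityʳ-unique A (Ev s (env y)) (Ev n (env y)) (begin
      Ev s (env y) ∙ Ev n (env y)          ≈⟨ Ev-hom s′ (s · n) (Point.isHom y) eq ⟨
      Ev s′ (env y)                        ≈⟨ fs′ y ⟩
      Ev s′ (retract y)                    ≈⟨ Ev-hom s′ (s · n) (proj₁ (retract-degenerate y)) eq ⟩
      Ev s (retract y) ∙ Ev n (retract y)  ≈⟨ ∙-congˡ (van (retract y) (proj₂ (retract-degenerate y))) ⟩
      Ev s (retract y) ∙ ε                 ≈⟨ identityʳ _ ⟩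
      Ev s (retract y)                     ≈⟨ fs y ⟨
      Ev s (env y)                         ∎)

  transversal : IsTransversal N H
  transversal x with t , t≈x ← generating x | n , van , fixed ← fix (proj₁ (generating x)) =
    ⟪ t · n ⟫ ,
    ((t · n , fixed , C.refl) ,
      (⟪ n ⟫ , (n , (λ (ρ , ¬gen) → van ρ ¬gen) , C.refl) , C.∙-congʳ t≈x)) ,
    λ {h′} (s , fs , s≈h′) (m , (q , q∈ , q≈m) , h′≈xm) → C.trans
      -- Two elements of the coset of `x` differ by the value of this term, which vanishes because
      -- `n` and `q` do.
      (fixed-unique (t · n) s ((t · n) ⧵ (t · q)) fixed fs
        (λ ρ ¬gen → trans
          (\\-cong (trans (∙-congˡ (van ρ ¬gen)) (identityʳ _))
                   (trans (∙-congˡ (q∈ (ρ , ¬gen))) (identityʳ _)))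
          (x\\x≈ε (Ev t ρ)))
        (C.trans (C.trans s≈h′ (C.trans h′≈xm (C.∙-cong (C.sym t≈x) (C.sym q≈m))))
          (C.sym (C.leftDividesˡ _ _))))
      s≈h′

  trivialMeet : HasTrivialMeet N H
  trivialMeet {z} (n , n∈ , n≈z) (s , fs , s≈z) = C.trans (C.sym s≈z)
    (C.sym (fixed-unique 𝟏 s n (λ _ → refl) fs (λ ρ ¬gen → n∈ (ρ , ¬gen))
      (C.trans s≈z (C.trans (C.sym n≈z) (C.sym (C.identityˡ _))))))

  factorization : IsFactorization N H
  factorization z with t , t≈z ← generating z | n , van , fixed ← fix (proj₁ (generating z)) =
    ⟪ t ⧸ (t · n) ⟫ , ⟪ t · n ⟫ ,
    (t ⧸ (t · n) ,
      (λ (ρ , ¬gen) → x≈y⇒x//y≈ε (sym (trans (∙-congˡ (van ρ ¬gen)) (identityʳ _)))) , C.refl) ,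
    (t · n , fixed , C.refl) ,
    C.trans (C.sym t≈z) (C.sym (C.rightDividesˡ _ _))

  -- A fixed term takes at a point the value it takes at a degenerate homomorphism, and there the
  -- identities of W hold. So the quotient of the two sides is a vanishing term that is trivial at
  -- all points.
  H∈W : InVariety (ProperSubloops A) (Subloop.loop H)
  H∈W s t s≈t ρ = begin
    proj₁ (⟦_⟧ (Subloop.loop H) s ρ)   ≡⟨ subloop-⟦⟧ C H s ρ ⟩
    ⟦_⟧ C s (λ i → proj₁ (ρ i))        ≈⟨ Evaluation.⟦⟧-cong C s (λ i → proj₂ (proj₂ (proj₂ (ρ i)))) ⟨
    ⟦_⟧ C s (λ i → ⟪ τ i ⟫)            ≈⟨ Evaluation.⟦⟧-subst C s τ gens ⟨
    ⟪ s [ τ ] ⟫                        ≈⟨ Evaluation.x//y≈ε⇒x≈y C (separation (u ⧸ v) (λ σ ¬gen → x≈y⇒x//y≈ε (u≈v σ ¬gen)) points) ⟩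
    ⟪ t [ τ ] ⟫                        ≈⟨ Evaluation.⟦⟧-subst C t τ gens ⟩
    ⟦_⟧ C t (λ i → ⟪ τ i ⟫)            ≈⟨ Evaluation.⟦⟧-cong C t (λ i → proj₂ (proj₂ (proj₂ (ρ i)))) ⟩
    ⟦_⟧ C t (λ i → proj₁ (ρ i))        ≡⟨ subloop-⟦⟧ C H t ρ ⟨
    proj₁ (⟦_⟧ (Subloop.loop H) t ρ)   ∎
    where
    open import Relation.Binary.Reasoning.Setoid C.setoid
    τ : ℕ → Term
    τ i = proj₁ (proj₂ (ρ i))
    u v : Term
    u = s [ τ ]
    v = t [ τ ]
    fixed : ∀ q → Fixed (q [ τ ])
    fixed q y = trans (⟦⟧-subst q τ (env y))
      (trans (⟦⟧-cong q λ i → proj₁ (proj₂ (proj₂ (ρ i))) y) (sym (⟦⟧-subst q τ (retract y))))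
    u≈v : ∀ σ → ¬ Gen σ → Ev u σ ≈ Ev v σ
    u≈v σ ¬gen = trans (⟦⟧-subst s τ σ) (trans
      (nonGen-W s t s≈t (λ i → Ev (τ i) σ) λ gen → ¬gen λ x →
        let q , q≈x = gen x in q [ τ ] , trans (⟦⟧-subst q τ σ) q≈x)
      (sym (⟦⟧-subst t τ σ)))
    points : ∀ y → Ev (u ⧸ v) (env y) ≈ ε
    points y = x≈y⇒x//y≈ε (trans (fixed s y)
      (trans (u≈v (retract y) (proj₂ (retract-degenerate y))) (sym (fixed t y))))

-- Ultrafilters of countable Boolean algebras

module BooleanFacts (em : ∀ {ℓ} → ExcludedMiddle ℓ) (B : BooleanAlgebra 0ℓ 0ℓ) where

  open BooleanAlgebra B public using (Carrier; _≈_; ⊥; setoid)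
    renaming (_∧_ to _∩_; _∨_ to _∪_; ⊤ to 𝟙; ¬_ to ∁)
  open BooleanAlgebra B
    using (refl; sym; trans; ∧-cong; ∧-congˡ; ∧-congʳ; ∧-assoc; ∧-comm; ∧-complementʳ; ∧-complementˡ;
           ∨-complementʳ; ∧-distribˡ-∨; ∨-cong; ¬-cong)
  open BooleanAlgebraProperties B using (∧-idem; ∧-identityʳ; ∧-zeroʳ; ∨-identityʳ; ∨-identityˡ)
  open import Relation.Binary.Construct.NaturalOrder.Left _≈_ _∩_ public
    using () renaming (_≤_ to _≼_)
  open import Relation.Binary.Reasoning.Setoid setoid

  ≼-reflexive : ∀ {u v} → u ≈ v → u ≼ v
  ≼-reflexive {u} u≈v = trans (sym (∧-idem u)) (∧-congˡ u≈v)

  ≼-trans : ∀ {u v w} → u ≼ v → v ≼ w → u ≼ w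
  ≼-trans {u} {v} {w} u≼v v≼w = begin
    u              ≈⟨ u≼v ⟩
    u ∩ v          ≈⟨ ∧-congˡ v≼w ⟩
    u ∩ (v ∩ w)    ≈⟨ ∧-assoc u v w ⟨
    (u ∩ v) ∩ w    ≈⟨ ∧-congʳ u≼v ⟨
    u ∩ w          ∎

  ∩-lowerʳ : ∀ u v → u ∩ v ≼ v
  ∩-lowerʳ u v = begin
    u ∩ v          ≈⟨ ∧-congˡ (∧-idem v) ⟨
    u ∩ (v ∩ v)    ≈⟨ ∧-assoc u v v ⟨
    (u ∩ v) ∩ v    ∎

  ∩-lowerˡ : ∀ u v → u ∩ v ≼ u
  ∩-lowerˡ u v = ≼-trans (≼-reflexive (∧-comm u v)) (∩-lowerʳ v u)

  ∩-greatest : ∀ {u v w} → u ≼ v → u ≼ w → u ≼ v ∩ w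
  ∩-greatest {u} {v} {w} u≼v u≼w = begin
    u              ≈⟨ u≼w ⟩
    u ∩ w          ≈⟨ ∧-congʳ u≼v ⟩
    (u ∩ v) ∩ w    ≈⟨ ∧-assoc u v w ⟩
    u ∩ (v ∩ w)    ∎

  ≼-𝟙 : ∀ u → u ≼ 𝟙
  ≼-𝟙 u = sym (∧-identityʳ u)

  ≼⊥⇒≈⊥ : ∀ {u} → u ≼ ⊥ → u ≈ ⊥
  ≼⊥⇒≈⊥ {u} u≼⊥ = trans u≼⊥ (∧-zeroʳ u)

  split-≈ : ∀ u b → u ≈ (u ∩ b) ∪ (u ∩ ∁ b)
  split-≈ u b = begin
    u                          ≈⟨ ∧-identityʳ u ⟨
    u ∩ 𝟙                      ≈⟨ ∧-congˡ (∨-complementʳ b) ⟨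
    u ∩ (b ∪ ∁ b)              ≈⟨ ∧-distribˡ-∨ u b (∁ b) ⟩
    (u ∩ b) ∪ (u ∩ ∁ b)        ∎

  split-⊥ : ∀ {u} b → u ∩ b ≈ ⊥ → u ∩ ∁ b ≈ ⊥ → u ≈ ⊥
  split-⊥ {u} b ub≈⊥ u∁b≈⊥ = trans (split-≈ u b) (trans (∨-cong ub≈⊥ u∁b≈⊥) (∨-identityʳ ⊥))

  ∩∁≈⊥⇒≼ : ∀ {u v} → u ∩ ∁ v ≈ ⊥ → u ≼ v
  ∩∁≈⊥⇒≼ {u} {v} eq = trans (split-≈ u v) (trans (∨-cong refl eq) (∨-identityʳ (u ∩ v)))

  ≼∁⇒∩≈⊥ : ∀ {u v} → u ≼ ∁ v → u ∩ v ≈ ⊥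
  ≼∁⇒∩≈⊥ {u} {v} u≼∁v = begin
    u ∩ v            ≈⟨ ∧-congʳ u≼∁v ⟩
    (u ∩ ∁ v) ∩ v    ≈⟨ ∧-assoc u (∁ v) v ⟩
    u ∩ (∁ v ∩ v)    ≈⟨ ∧-congˡ (∧-complementˡ v) ⟩
    u ∩ ⊥            ≈⟨ ∧-zeroʳ u ⟩
    ⊥                ∎

  ∩≈⊥⇒≼∁ : ∀ {u v} → u ∩ v ≈ ⊥ → u ≼ ∁ v
  ∩≈⊥⇒≼∁ {u} {v} eq = trans (split-≈ u v) (trans (∨-cong eq refl) (∨-identityˡ (u ∩ ∁ v)))

  ≼-antisym : ∀ {u v} → u ≼ v → v ≼ u → u ≈ v
  ≼-antisym {u} {v} u≼v v≼u = trans u≼v (trans (∧-comm u v) (sym v≼u))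

  -- if b then p else q
  cond : Carrier → Carrier → Carrier → Carrier
  cond b p q = ∁ (b ∩ ∁ p) ∩ ∁ (∁ b ∩ ∁ q)

  module _ (U : Ultrafilter B) where
    open Ultrafilter U using (upward; ∩-mem; ⊥-mem; ultra) renaming (_∈ to U∋_)

    ∋-resp : ∀ {u v} → u ≈ v → U∋ u → U∋ v
    ∋-resp u≈v = upward (≼-reflexive u≈v)

    ∋-∩ˡ : ∀ {u v} → U∋ (u ∩ v) → U∋ u
    ∋-∩ˡ {u} {v} = upward (∩-lowerˡ u v)

    ∋-∩ʳ : ∀ {u v} → U∋ (u ∩ v) → U∋ v
    ∋-∩ʳ {u} {v} = upward (∩-lowerʳ u v)

    ∋-∁⇒∌ : ∀ {u} → U∋ ∁ u → ¬ (U∋ u)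
    ∋-∁⇒∌ {u} ∁u∈ u∈ = ⊥-mem (∋-resp (∧-complementʳ u) (∩-mem u∈ ∁u∈))

    ∌⇒∋-∁ : ∀ {u} → ¬ (U∋ u) → U∋ ∁ u
    ∌⇒∋-∁ {u} u∉ with ultra u
    ... | inj₁ u∈  = contradiction u∈ u∉
    ... | inj₂ ∁u∈ = ∁u∈

    ∋-modus-ponens : ∀ {u v} → U∋ ∁ (u ∩ ∁ v) → U∋ u → U∋ v
    ∋-modus-ponens {u} {v} imp u∈ with ultra v
    ... | inj₁ v∈  = v∈
    ... | inj₂ ∁v∈ = contradiction (∩-mem u∈ ∁v∈) (∋-∁⇒∌ imp)

    ∋-implication : ∀ {u v} → (U∋ u → U∋ v) → U∋ ∁ (u ∩ ∁ v)
    ∋-implication u⇒v = ∌⇒∋-∁ λ u∁v∈ → ∋-∁⇒∌ (∋-∩ʳ u∁v∈) (u⇒v (∋-∩ˡ u∁v∈))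

    ∋-cond⁺ : ∀ {b p q} → U∋ b → (U∋ cond b p q → U∋ p) × (U∋ p → U∋ cond b p q)
    ∋-cond⁺ b∈ =
      (λ r∈ → ∋-modus-ponens (∋-∩ˡ r∈) b∈) ,
      (λ p∈ → ∩-mem (∋-implication λ _ → p∈) (∋-implication λ ∁b∈ → contradiction b∈ (∋-∁⇒∌ ∁b∈)))

    ∋-cond⁻ : ∀ {b p q} → U∋ ∁ b → (U∋ cond b p q → U∋ q) × (U∋ q → U∋ cond b p q)
    ∋-cond⁻ ∁b∈ =
      (λ r∈ → ∋-modus-ponens (∋-∩ʳ r∈) ∁b∈) ,
      (λ q∈ → ∩-mem (∋-implication λ b∈ → contradiction b∈ (∋-∁⇒∌ ∁b∈)) (∋-implication λ _ → q∈))

    ∋-≈⊥ : ∀ {u} → U∋ u → ¬ (u ≈ ⊥)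
    ∋-≈⊥ u∈ u≈⊥ = ⊥-mem (∋-resp u≈⊥ u∈)

    ∋-split : ∀ {u} b → U∋ u → U∋ (u ∩ b) ⊎ U∋ (u ∩ ∁ b)
    ∋-split b u∈ with ultra b
    ... | inj₁ b∈  = inj₁ (∩-mem u∈ b∈)
    ... | inj₂ ∁b∈ = inj₂ (∩-mem u∈ ∁b∈)

    ∋-⋀ : ∀ {n} (g : Fin n → Carrier) → (∀ i → U∋ g i) → ∃[ u ] U∋ u × (∀ i → u ≼ g i)
    ∋-⋀ {zero}  g g∈ = 𝟙 , Ultrafilter.𝟙-mem U , λ ()
    ∋-⋀ {suc n} g g∈ with u , u∈ , u≼ ← ∋-⋀ (λ i → g (Fin.suc i)) (λ i → g∈ (Fin.suc i)) =
      g Fin.zero ∩ u , ∩-mem (g∈ Fin.zero) u∈ ,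
      λ { Fin.zero → ∩-lowerˡ (g Fin.zero) u ; (Fin.suc i) → ≼-trans (∩-lowerʳ (g Fin.zero) u) (u≼ i) }

    ∋-cover : ∀ {n} (g : Fin n → Carrier) → (∀ u → (∀ i → u ∩ g i ≈ ⊥) → u ≈ ⊥) → ∃[ i ] U∋ g i
    ∋-cover g cover = decidable-stable em λ none →
      let u , u∈ , u≼ = ∋-⋀ (λ i → ∁ (g i)) (λ i → ∌⇒∋-∁ λ gi∈ → none (i , gi∈))
      in ∋-≈⊥ u∈ (cover u λ i → ≼∁⇒∩≈⊥ (u≼ i))

  module Countable (countable : IsCountable setoid) where

    -- `Q` is a notion of largeness for which one half of a large element is large. It is
    -- instantiated with being nonzero and, for compactness, with being a counterexample.
    module _ {ℓ} (Q : Carrier → Set ℓ) (Q-resp : ∀ {u v} → u ≈ v → Q u → Q v) (¬Q⊥ : ¬ Q ⊥)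
      (Q-split : ∀ {u} b → Q u → Q (u ∩ b) ⊎ Q (u ∩ ∁ b)) where
      private
        enum : ℕ → Carrier
        enum = Surjection.to countable

        step : ∃ Q → Carrier → ∃ Q
        step (u , q) b with Q-split b q
        ... | inj₁ q′ = u ∩ b , q′
        ... | inj₂ q′ = u ∩ ∁ b , q′

        step-≼ : ∀ uq b → proj₁ (step uq b) ≼ proj₁ uq
        step-≼ (u , q) b with Q-split b q
        ... | inj₁ _ = ∩-lowerˡ u b
        ... | inj₂ _ = ∩-lowerˡ u (∁ b)

        step-decides : ∀ uq b → proj₁ (step uq b) ≼ b ⊎ proj₁ (step uq b) ≼ ∁ b
        step-decides (u , q) b with Q-split b q
        ... | inj₁ _ = inj₁ (∩-lowerʳ u b)
        ... | inj₂ _ = inj₂ (∩-lowerʳ u (∁ b))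

        chain : ∃ Q → ℕ → ∃ Q
        chain uq zero    = uq
        chain uq (suc n) = step (chain uq n) (enum n)

        chain-≼ : ∀ uq {m n} → m ≤ n → proj₁ (chain uq n) ≼ proj₁ (chain uq m)
        chain-≼ uq {m} {zero}  z≤n = ≼-reflexive refl
        chain-≼ uq {m} {suc n} m≤1+n with ℕ.m≤n⇒m<n∨m≡n m≤1+n
        ... | inj₁ m<1+n  = ≼-trans (step-≼ (chain uq n) (enum n)) (chain-≼ uq (ℕ.≤-pred m<1+n))
        ... | inj₂ ≡.refl = ≼-reflexive refl

      -- The n-th element of B is decided at the n-th step of a descending chain in Q.
      ultrafilter : ∀ u → Q u → Σ[ U ∈ Ultrafilter B ] (_∋_ B U u × (∀ v → _∋_ B U v → ∃[ w ] w ≼ v × Q w))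
      ultrafilter u q = record
        { _∈     = λ v → ∃[ n ] proj₁ (s n) ≼ v
        ; 𝟙-mem  = 0 , ≼-𝟙 u
        ; ⊥-mem  = λ (n , sn≼⊥) → ¬Q⊥ (Q-resp (≼⊥⇒≈⊥ sn≼⊥) (proj₂ (s n)))
        ; upward = λ v≼w (n , sn≼v) → n , ≼-trans sn≼v v≼w
        ; ∩-mem  = λ (m , sm≼v) (n , sn≼w) → m ⊔ n , ∩-greatest
            (≼-trans (chain-≼ (u , q) (ℕ.m≤m⊔n m n)) sm≼v)
            (≼-trans (chain-≼ (u , q) (ℕ.m≤n⊔m m n)) sn≼w)
        ; ultra  = decide
        } , (0 , ≼-reflexive refl) , λ v (n , sn≼v) → proj₁ (s n) , sn≼v , proj₂ (s n)
        where
        s : ℕ → ∃ Q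
        s = chain (u , q)
        decide : ∀ v → (∃[ n ] proj₁ (s n) ≼ v) ⊎ (∃[ n ] proj₁ (s n) ≼ ∁ v)
        decide v with step-decides (s (Surjection.to⁻ countable v)) (enum (Surjection.to⁻ countable v))
        ... | inj₁ ≼b  = inj₁ (suc (Surjection.to⁻ countable v) ,
          ≼-trans ≼b (≼-reflexive (Surjection.to∘to⁻ countable v)))
        ... | inj₂ ≼∁b = inj₂ (suc (Surjection.to⁻ countable v) ,
          ≼-trans ≼∁b (≼-reflexive (¬-cong (Surjection.to∘to⁻ countable v))))

    ≈⊥-by-points : ∀ {u} → (∀ U → ¬ (_∋_ B U u)) → u ≈ ⊥
    ≈⊥-by-points {u} none = decidable-stable em λ u≉⊥ →
      let U , u∈ , _ = ultrafilter (λ v → ¬ (v ≈ ⊥)) (λ u≈v u≉⊥ v≈⊥ → u≉⊥ (trans u≈v v≈⊥))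
            (λ ⊥≉⊥ → ⊥≉⊥ refl) split u u≉⊥
      in none U u∈
      where
      split : ∀ {u} b → ¬ (u ≈ ⊥) → ¬ (u ∩ b ≈ ⊥) ⊎ ¬ (u ∩ ∁ b ≈ ⊥)
      split {u} b u≉⊥ with em {P = u ∩ b ≈ ⊥}
      ... | yes ub≈⊥ = inj₂ λ u∁b≈⊥ → u≉⊥ (split-⊥ b ub≈⊥ u∁b≈⊥)
      ... | no ub≉⊥  = inj₁ ub≉⊥

    ≼-by-points : ∀ {u v} → (∀ U → _∋_ B U u → _∋_ B U v) → u ≼ v
    ≼-by-points incl = ∩∁≈⊥⇒≼ (≈⊥-by-points λ U uv∈ →
      ∋-∁⇒∌ U (∋-∩ʳ U uv∈) (incl U (∋-∩ˡ U uv∈)))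

    ≈-by-points : ∀ {u v} → (∀ U → _∋_ B U u → _∋_ B U v) → (∀ U → _∋_ B U v → _∋_ B U u) → u ≈ v
    ≈-by-points incl incl′ = ≼-antisym (≼-by-points incl) (≼-by-points incl′)

    -- Compactness of the Stone space: a clopen set of ultrafilters is given by
    -- an element of B.
    clopen : (P : Ultrafilter B → Set) → IsOpen B P → IsOpen B (λ U → ¬ P U) →
             ∃[ p ] ∀ U → (_∋_ B U p → P U) × (P U → _∋_ B U p)
    clopen P open-P open-¬P = decidable-stable em λ none →
      let U , _ , bad = ultrafilter (λ u → ¬ Good u)
            (λ u≈v ¬good (p , good) → ¬good (p , λ U u∈ → good U (∋-resp U u≈v u∈)))
            (λ ¬good → ¬good (⊥ , λ U ⊥∈ → contradiction ⊥∈ (Ultrafilter.⊥-mem U)))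
            Good-split 𝟙 (λ (p , good) → none (p , λ U → good U (Ultrafilter.𝟙-mem U)))
      in not-bad U bad
      where
      Good : Carrier → Set₁
      Good u = ∃[ p ] ∀ U → _∋_ B U u → (_∋_ B U p → P U) × (P U → _∋_ B U p)

      Good-join : ∀ {u} b → Good (u ∩ b) → Good (u ∩ ∁ b) → Good u
      Good-join b (p , p-good) (q , q-good) = cond b p q , λ U u∈ →
        [ (λ ub∈ → let to , from = ∋-cond⁺ U (∋-∩ʳ U ub∈) ; to′ , from′ = p-good U ub∈
                   in (λ r∈ → to′ (to r∈)) , (λ PU → from (from′ PU)))
        , (λ u∁b∈ → let to , from = ∋-cond⁻ U (∋-∩ʳ U u∁b∈) ; to′ , from′ = q-good U u∁b∈
                    in (λ r∈ → to′ (to r∈)) , (λ PU → from (from′ PU)))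
        ] (∋-split U b u∈)

      Good-split : ∀ {u} b → ¬ Good u → ¬ Good (u ∩ b) ⊎ ¬ Good (u ∩ ∁ b)
      Good-split {u} b ¬good with em {P = Good (u ∩ b)}
      ... | yes good = inj₂ λ good′ → ¬good (Good-join b good good′)
      ... | no ¬good′ = inj₁ ¬good′

      -- By openness `P` is constant on a neighbourhood of `U`, and below it every element is good,
      -- by means of `𝟙` or `⊥`.
      not-bad : ∀ U → ¬ (∀ v → _∋_ B U v → ∃[ w ] w ≼ v × ¬ Good w)
      not-bad U bad with em {P = P U}
      ... | yes PU with v , v∈ , v⊆P ← open-P PU | w , w≼v , ¬good ← bad (proj₁ (open-P PU)) (proj₁ (proj₂ (open-P PU))) =
        ¬good (𝟙 , λ W w∈ → (λ _ → v⊆P (Ultrafilter.upward W w≼v w∈)) , λ _ → Ultrafilter.𝟙-mem W)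
      ... | no ¬PU with v , v∈ , v⊆¬P ← open-¬P ¬PU | w , w≼v , ¬good ← bad (proj₁ (open-¬P ¬PU)) (proj₁ (proj₂ (open-¬P ¬PU))) =
        ¬good (⊥ , λ W w∈ → (λ ⊥∈ → contradiction ⊥∈ (Ultrafilter.⊥-mem W)) ,
          λ PW → contradiction PW (v⊆¬P (Ultrafilter.upward W w≼v w∈)))

-- Recognizing filtered Boolean powers

-- [n = a] for an element n of a loop of functions with values in A.
record Valuation (N A : Loop 0ℓ 0ℓ) (B : BooleanAlgebra 0ℓ 0ℓ) (x : Ultrafilter B) : Set₁ where
  private
    module N = Loop N
    module A = Loop A
  open BooleanAlgebra B using (Carrier; _≈_; ⊥) renaming (_∧_ to _∩_; ¬_ to ∁)
  field
    [_≔_]     : N.Carrier → A.Carrier → Carrier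
    ≔-cong    : ∀ {m n a b} → m N.≈ n → a A.≈ b → [ m ≔ a ] ≈ [ n ≔ b ]
    disjoint  : ∀ n {a b} → ¬ (a A.≈ b) → [ n ≔ a ] ∩ [ n ≔ b ] ≈ ⊥
    cover     : ∀ n u → (∀ a → u ∩ [ n ≔ a ] ≈ ⊥) → u ≈ ⊥
    ≔-∙       : ∀ m n a b → ([ m ≔ a ] ∩ [ n ≔ b ]) ∩ ∁ [ m N.∙ n ≔ a A.∙ b ] ≈ ⊥
    basepoint : ∀ n → _∋_ B x [ n ≔ A.ε ]
    faithful  : ∀ {n} → ∁ [ n ≔ A.ε ] ≈ ⊥ → n N.≈ N.ε
    complete  : (p : A.Carrier → Carrier) → (∀ {a b} → a A.≈ b → p a ≈ p b) →
                (∀ {a b} → ¬ (a A.≈ b) → p a ∩ p b ≈ ⊥) →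
                (∀ u → (∀ a → u ∩ p a ≈ ⊥) → u ≈ ⊥) → _∋_ B x (p A.ε) →
                ∃[ n ] ∀ a → [ n ≔ a ] ≈ p a

module Recognition (em : ∀ {ℓ} → ExcludedMiddle ℓ)
  (N A : Loop 0ℓ 0ℓ) (finite : IsFinite (Loop.setoid A))
  (B : BooleanAlgebra 0ℓ 0ℓ) (countable : IsCountable (BooleanAlgebra.setoid B))
  (x : Ultrafilter B) (valuation : Valuation N A B x) where

  open Valuation valuation
  open BooleanFacts em B
  open Countable countable
  private
    module N = Loop N
    module A = Loop A
    module B = BooleanAlgebra B

    element : Fin (proj₁ finite) → A.Carrier
    element = Inverse.from (proj₂ finite)

    covered : (p : A.Carrier → Carrier) → (∀ {a b} → a A.≈ b → p a ≈ p b) →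
              ∀ u → (∀ i → u ∩ p (element i) ≈ ⊥) → ∀ a → u ∩ p a ≈ ⊥
    covered p p-cong u eq a = B.trans
      (B.∧-congˡ (p-cong (A.sym (Inverse.strictlyInverseʳ (proj₂ finite) a)))) (eq _)

    takes-value : ∀ n U → ∃[ a ] _∋_ B U [ n ≔ a ]
    takes-value n U with i , i∈ ← ∋-cover U (λ i → [ n ≔ element i ])
      (λ u eq → cover n u (covered [ n ≔_] (≔-cong N.refl) u eq)) = element i , i∈

  value : N.Carrier → Ultrafilter B → A.Carrier
  value n U = proj₁ (takes-value n U)

  value-unique : ∀ {n U a b} → _∋_ B U [ n ≔ a ] → _∋_ B U [ n ≔ b ] → a A.≈ b
  value-unique {n} {U} a∈ b∈ = decidable-stable em λ a≉b →
    ∋-≈⊥ U (Ultrafilter.∩-mem U a∈ b∈) (disjoint n a≉b)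

  value-∋ : ∀ n U → _∋_ B U [ n ≔ value n U ]
  value-∋ n U = proj₂ (takes-value n U)

  ∋⇒value : ∀ n U {a} → _∋_ B U [ n ≔ a ] → value n U A.≈ a
  ∋⇒value n U a∈ = value-unique {n} {U} (value-∋ n U) a∈

  value⇒∋ : ∀ n U {a} → value n U A.≈ a → _∋_ B U [ n ≔ a ]
  value⇒∋ n U eq = ∋-resp U (≔-cong N.refl eq) (value-∋ n U)

  value-cong : ∀ {m n} → m N.≈ n → ∀ U → value m U A.≈ value n U
  value-cong {m} {n} m≈n U = ∋⇒value m U (∋-resp U (≔-cong (N.sym m≈n) A.refl) (value-∋ n U))

  value-∙ : ∀ m n U → value (m N.∙ n) U A.≈ value m U A.∙ value n U
  value-∙ m n U = ∋⇒value (m N.∙ n) U (Ultrafilter.upward U (∩∁≈⊥⇒≼ (≔-∙ m n _ _))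
    (Ultrafilter.∩-mem U (value-∋ m U) (value-∋ n U)))

  -- The identity and the divisions of a loop are determined by its multiplication; hence
  -- `Valuation` has a law for products alone.
  value-ε : ∀ U → value N.ε U A.≈ A.ε
  value-ε U = LoopProperties.identityʳ-unique A (value N.ε U) (value N.ε U)
    (A.trans (A.sym (value-∙ N.ε N.ε U)) (value-cong (N.identityˡ N.ε) U))

  value-\\ : ∀ m n U → value (m N.\\ n) U A.≈ value m U A.\\ value n U
  value-\\ m n U = QuasigroupProperties.y≈x\\z A.quasigroup _ _ _
    (A.trans (A.sym (value-∙ m (m N.\\ n) U)) (value-cong (N.leftDividesˡ m n) U))

  value-// : ∀ m n U → value (m N.// n) U A.≈ value m U A.// value n U
  value-// m n U = QuasigroupProperties.x≈z//y A.quasigroup _ _ _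
    (A.trans (A.sym (value-∙ (m N.// n) n U)) (value-cong (N.rightDividesˡ n m) U))

  value-injective : ∀ {m n} → (∀ U → value m U A.≈ value n U) → m N.≈ n
  value-injective {m} {n} eq = Evaluation.x//y≈ε⇒x≈y N (faithful (≈⊥-by-points λ U ∁∈ →
    ∋-∁⇒∌ U ∁∈ (value⇒∋ (m N.// n) U
      (A.trans (value-// m n U) (Evaluation.x≈y⇒x//y≈ε A (eq U))))))

  value-continuous : ∀ n → IsContinuous A B (value n)
  value-continuous n a {U} eq = [ n ≔ a ] , value⇒∋ n U eq , λ {V} a∈ → ∋⇒value n V a∈

  -- By compactness the clopen fibres of `f` are elements of the Boolean algebra. They form a
  -- partition, which `complete` realizes.
  value-surjective : ∀ f → IsContinuous A B f → f x A.≈ A.ε → ∃[ n ] ∀ U → value n U A.≈ f U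
  value-surjective f f-cts fx≈ε = proj₁ completed , λ U →
    ∋⇒value (proj₁ completed) U (∋-resp U (B.sym (proj₂ completed (f U))) (proj₂ (fibre-spec (f U) U) A.refl))
    where
    fibre-clopen : ∀ a → ∃[ p ] ∀ U → (_∋_ B U p → f U A.≈ a) × (f U A.≈ a → _∋_ B U p)
    fibre-clopen a = clopen (λ U → f U A.≈ a) (f-cts a) λ {U} fU≉a →
      let v , v∈ , v⊆ = f-cts (f U) {U} A.refl
      in v , v∈ , λ {W} v∈W fW≈a → fU≉a (A.trans (A.sym (v⊆ v∈W)) fW≈a)
    fibre : A.Carrier → Carrier
    fibre a = proj₁ (fibre-clopen a)
    fibre-spec : ∀ a U → (_∋_ B U (fibre a) → f U A.≈ a) × (f U A.≈ a → _∋_ B U (fibre a))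
    fibre-spec a = proj₂ (fibre-clopen a)
    fibre-cong : ∀ {a b} → a A.≈ b → fibre a ≈ fibre b
    fibre-cong {a} {b} a≈b = ≈-by-points
      (λ U a∈ → proj₂ (fibre-spec b U) (A.trans (proj₁ (fibre-spec a U) a∈) a≈b))
      (λ U b∈ → proj₂ (fibre-spec a U) (A.trans (proj₁ (fibre-spec b U) b∈) (A.sym a≈b)))
    fibre-disjoint : ∀ {a b} → ¬ (a A.≈ b) → fibre a ∩ fibre b ≈ ⊥
    fibre-disjoint {a} {b} a≉b = ≈⊥-by-points λ U ab∈ → a≉b
      (A.trans (A.sym (proj₁ (fibre-spec a U) (∋-∩ˡ U ab∈))) (proj₁ (fibre-spec b U) (∋-∩ʳ U ab∈)))
    fibre-cover : ∀ u → (∀ a → u ∩ fibre a ≈ ⊥) → u ≈ ⊥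
    fibre-cover u eq = ≈⊥-by-points λ U u∈ →
      ∋-≈⊥ U (Ultrafilter.∩-mem U u∈ (proj₂ (fibre-spec (f U) U) A.refl)) (eq (f U))
    completed : ∃[ n ] ∀ a → [ n ≔ a ] ≈ fibre a
    completed = complete fibre fibre-cong fibre-disjoint fibre-cover (proj₂ (fibre-spec A.ε x) fx≈ε)

  recognize : N ≅ Subloop.loop (FilteredBooleanPower A B x)
  recognize = (λ n → (value n , value-continuous n) , ∋⇒value n x (basepoint n)) , record
    { isLoopMonomorphism = record
      { isLoopHomomorphism = record
        { isQuasigroupHomomorphism = record
          { isRelHomomorphism = record { cong = value-cong }
          ; ∙-homo  = value-∙
          ; \\-homo = value-\\
          ; //-homo = value-//
          }
        ; ε-homo = value-ε
        }
      ; injective = value-injective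
      }
    ; surjective = λ ((f , f-cts) , fx≈ε) →
        let n , n≈ = value-surjective f f-cts fx≈ε
        in n , λ m≈n U → A.trans (value-cong m≈n U) (n≈ U)
    }

-- The Boolean algebra of the one-point compactification of Y

Bool-extensional : ∀ {x y : Bool} → (x ≡ true → y ≡ true) → (y ≡ true → x ≡ true) → x ≡ y
Bool-extensional {true}  {true}  _ _ = ≡.refl
Bool-extensional {true}  {false} f _ = ≡.sym (f ≡.refl)
Bool-extensional {false} {true}  _ g = g ≡.refl
Bool-extensional {false} {false} _ _ = ≡.refl

∧-true : ∀ {x y} → x Bool.∧ y ≡ true → x ≡ true × y ≡ true
∧-true {x} {y} eq = Bool.∧-conicalˡ x y eq , Bool.∧-conicalʳ x y eq

module PointAlgebra
  (em : ∀ {ℓ} → ExcludedMiddle ℓ) (A : Loop 0ℓ 0ℓ) (finite : IsFinite (Loop.setoid A))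
  (simple : IsSimple A) (nonAbelian : NonAbelian A)
  (C : Loop 0ℓ 0ℓ) (gens : ℕ → Loop.Carrier C) (C∈V : InVariety (Singleton A) C)
  (generating : Generates C gens) where

  open Loop A
  open Evaluation A
  open Cutoff A
  open SimpleLoop em A finite simple nonAbelian
  open Environments em A finite simple nonAbelian
  open Points em A finite simple nonAbelian C gens C∈V
  open Splitting em A finite simple nonAbelian C gens C∈V generating
  open Point using (env; level)

  truth : Set → Bool
  truth P = Relation.Nullary.does (em {P = P})

  truth⁺ : ∀ {P} → P → truth P ≡ true
  truth⁺ {P} p with em {P = P}
  ... | yes _ = ≡.refl
  ... | no ¬p = contradiction p ¬p

  truth⁻ : ∀ {P} → truth P ≡ true → P
  truth⁻ {P} eq with em {P = P}
  ... | yes p = p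

  truth-cong : ∀ {P Q} → (P → Q) → (Q → P) → truth P ≡ truth Q
  truth-cong f g = Bool-extensional (λ p → truth⁺ (f (truth⁻ p))) (λ q → truth⁺ (g (truth⁻ q)))

  -- The value at nothing is the value at infinity: it is shared by all points
  -- without a generating initial segment of length n.
  Local : ℕ → (Maybe Point → Bool) → Set
  Local n f = (∀ y → ¬ Gen (tr n (env y)) → f (just y) ≡ f nothing) ×
              (∀ y y′ → env y ≈[ n ] env y′ → f (just y) ≡ f (just y′))

  Local-≤ : ∀ {m n f} → m ≤ n → Local m f → Local n f
  Local-≤ m≤n (far , near) =
    (λ y ¬gen → far y λ gen → ¬gen (Gen-tr-≤ (env y) m≤n gen)) ,
    (λ y y′ eq → near y y′ (≈[]-≤ m≤n eq))

  Clopen : Set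
  Clopen = Σ[ f ∈ (Maybe Point → Bool) ] ∃[ n ] Local n f

  pointwise₁ : (Bool → Bool) → Clopen → Clopen
  pointwise₁ h (f , n , far , near) =
    (λ p → h (f p)) , n , (λ y ¬gen → ≡.cong h (far y ¬gen)) , (λ y y′ eq → ≡.cong h (near y y′ eq))

  pointwise₂ : (Bool → Bool → Bool) → Clopen → Clopen → Clopen
  pointwise₂ h (f , m , f-local) (g , n , g-local) =
    (λ p → h (f p) (g p)) , m ⊔ n ,
    (λ y ¬gen → ≡.cong₂ h (proj₁ (Local-≤ {f = f} (ℕ.m≤m⊔n m n) f-local) y ¬gen)
                          (proj₁ (Local-≤ {f = g} (ℕ.m≤n⊔m m n) g-local) y ¬gen)) ,
    (λ y y′ eq → ≡.cong₂ h (proj₂ (Local-≤ {f = f} (ℕ.m≤m⊔n m n) f-local) y y′ eq)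
                           (proj₂ (Local-≤ {f = g} (ℕ.m≤n⊔m m n) g-local) y y′ eq))

  constant : Bool → Clopen
  constant v = (λ _ → v) , 0 , (λ _ _ → ≡.refl) , (λ _ _ _ → ≡.refl)

  clopens : BooleanAlgebra 0ℓ 0ℓ
  clopens = record
    { Carrier = Clopen
    ; _≈_     = λ f g → ∀ p → proj₁ f p ≡ proj₁ g p
    ; _∨_     = pointwise₂ Bool._∨_
    ; _∧_     = pointwise₂ Bool._∧_
    ; ¬_      = pointwise₁ Bool.not
    ; ⊤       = constant true
    ; ⊥       = constant false
    ; isBooleanAlgebra = record
      { isDistributiveLattice = record
        { isLattice = record
          { isEquivalence = record
            { refl  = λ p → ≡.refl
            ; sym   = λ eq p → ≡.sym (eq p)
            ; trans = λ eq eq′ p → ≡.trans (eq p) (eq′ p)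
            }
          ; ∨-comm     = λ f g p → Bool.∨-comm (proj₁ f p) (proj₁ g p)
          ; ∨-assoc    = λ f g h p → Bool.∨-assoc (proj₁ f p) (proj₁ g p) (proj₁ h p)
          ; ∨-cong     = λ eq eq′ p → ≡.cong₂ Bool._∨_ (eq p) (eq′ p)
          ; ∧-comm     = λ f g p → Bool.∧-comm (proj₁ f p) (proj₁ g p)
          ; ∧-assoc    = λ f g h p → Bool.∧-assoc (proj₁ f p) (proj₁ g p) (proj₁ h p)
          ; ∧-cong     = λ eq eq′ p → ≡.cong₂ Bool._∧_ (eq p) (eq′ p)
          ; absorptive = (λ f g p → Bool.∨-abs-∧ (proj₁ f p) (proj₁ g p)) ,
                         (λ f g p → Bool.∧-abs-∨ (proj₁ f p) (proj₁ g p))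
          }
        ; ∨-distrib-∧ = (λ f g h p → Bool.∨-distribˡ-∧ (proj₁ f p) (proj₁ g p) (proj₁ h p)) ,
                        (λ f g h p → Bool.∨-distribʳ-∧ (proj₁ f p) (proj₁ g p) (proj₁ h p))
        ; ∧-distrib-∨ = (λ f g h p → Bool.∧-distribˡ-∨ (proj₁ f p) (proj₁ g p) (proj₁ h p)) ,
                        (λ f g h p → Bool.∧-distribʳ-∨ (proj₁ f p) (proj₁ g p) (proj₁ h p))
        }
      ; ∨-complement = (λ f p → Bool.∨-inverseˡ (proj₁ f p)) , (λ f p → Bool.∨-inverseʳ (proj₁ f p))
      ; ∧-complement = (λ f p → Bool.∧-inverseˡ (proj₁ f p)) , (λ f p → Bool.∧-inverseʳ (proj₁ f p))
      ; ¬-cong = λ eq p → ≡.cong Bool.not (eq p)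
      }
    }

  private
    module B = BooleanAlgebra clopens
    module BF = BooleanFacts em clopens

  ≈⊥-pointwise : ∀ f → (∀ p → ¬ (proj₁ f p ≡ true)) → f B.≈ B.⊥
  ≈⊥-pointwise f never p = Bool.¬-not (never p)

  at : Maybe Point → Ultrafilter clopens
  at p = record
    { _∈     = λ f → proj₁ f p ≡ true
    ; 𝟙-mem  = ≡.refl
    ; ⊥-mem  = λ ()
    ; upward = λ u≼v u∈ → proj₂ (∧-true (≡.trans (≡.sym (u≼v p)) u∈))
    ; ∩-mem  = λ u∈ v∈ → ≡.cong₂ Bool._∧_ u∈ v∈
    ; ultra  = λ (f , _) → decide (f p)
    }
    where
    decide : ∀ v → v ≡ true ⊎ Bool.not v ≡ true
    decide true  = inj₁ ≡.refl
    decide false = inj₂ ≡.refl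

  valueAt : Term → Maybe Point → Carrier
  valueAt t nothing  = ε
  valueAt t (just y) = Ev t (env y)

  level-set : ∀ t → Vanishing t → Carrier → Clopen
  level-set t van a = (λ p → truth (valueAt t p ≈ a)) , width t ,
    (λ y ¬gen →
      let t≈ε = trans (sym (⟦⟧-cutoff t (env y) ℕ.≤-refl)) (van (tr (width t) (env y)) ¬gen)
      in truth-cong (λ eq → trans (sym t≈ε) eq) (λ eq → trans t≈ε eq)) ,
    (λ y y′ eq → truth-cong (λ t≈a → trans (sym (⟦⟧-local t eq)) t≈a)
                            (λ t≈a → trans (⟦⟧-local t eq) t≈a))

  realize-clopens : (p : Carrier → Clopen) → (∀ {a b} → a ≈ b → p a B.≈ p b) →
    (∀ {a b} → ¬ (a ≈ b) → p a B.∧ p b B.≈ B.⊥) →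
    (∀ u → (∀ a → u B.∧ p a B.≈ B.⊥) → u B.≈ B.⊥) → proj₁ (p ε) nothing ≡ true →
    ∃[ t ] Σ[ van ∈ Vanishing t ] ∀ a → level-set t van a B.≈ p a
  realize-clopens p p-cong disjoint cover base =
    proj₁ realized , proj₁ (proj₂ realized) , λ a q → Bool-extensional
      (λ eq → ≡.trans (≡.sym (p-cong (truth⁻ eq) q)) (value-∋ q))
      (λ p∈ → truth⁺ (value-unique q (value-∋ q) p∈))
    where
    covering : ∀ q → ∃[ i ] proj₁ (p (element i)) q ≡ true
    -- The ultrafilter `at q` turns the covering law, which speaks of elements of the algebra, into
    -- a statement about the single point `q`.
    covering q = BF.∋-cover (at q) (λ i → p (element i)) λ u eq → cover u λ a r →
      ≡.trans (≡.cong (proj₁ u r Bool.∧_) (p-cong (sym (element-index a)) r)) (eq (index a) r)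
    value-unique : ∀ q {a b} → proj₁ (p a) q ≡ true → proj₁ (p b) q ≡ true → a ≈ b
    value-unique q {a} {b} a∈ b∈ = dne λ a≉b →
      contradiction (≡.trans (≡.sym (≡.cong₂ Bool._∧_ a∈ b∈)) (disjoint a≉b q)) λ ()
    g : Point → Carrier
    g y = element (proj₁ (covering (just y)))
    g-∋ : ∀ y → proj₁ (p (g y)) (just y) ≡ true
    g-∋ y = proj₂ (covering (just y))
    bound : ∃[ m ] ∀ i → proj₁ (proj₂ (p (element i))) ≤ m
    bound = Fin-bounded λ i → proj₁ (proj₂ (p (element i)))
    local : ∀ i → Local (proj₁ bound) (proj₁ (p (element i)))
    local i = Local-≤ {f = proj₁ (p (element i))} (proj₂ bound i) (proj₂ (proj₂ (p (element i))))
    realized : ∃[ t ] Vanishing t × (∀ y → Ev t (env y) ≈ g y)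
    realized = realize g (proj₁ bound)
      (λ {y} {y′} eq → value-unique (just y′)
        (≡.trans (≡.sym (proj₂ (local (proj₁ (covering (just y)))) y y′ eq)) (g-∋ y)) (g-∋ y′))
      (λ y ¬gen → value-unique nothing
        (≡.trans (≡.sym (proj₁ (local (proj₁ (covering (just y)))) y ¬gen)) (g-∋ y)) base)
    value-∋ : ∀ q → proj₁ (p (valueAt (proj₁ realized) q)) q ≡ true
    value-∋ nothing  = base
    value-∋ (just y) = ≡.trans (p-cong (proj₂ (proj₂ realized) y) (just y)) (g-∋ y)

  -- The sets are read off a term representing the element; `Ev-hom` makes its choice immaterial.
  -- Faithfulness is `separation`, and completeness comes from `realize`.
  valuation : Valuation (Subloop.loop N) A clopens (at nothing)
  valuation = record
    { [_≔_]     = λ (_ , t , t∈ , _) a → level-set t (λ ρ ¬gen → t∈ (ρ , ¬gen)) a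
    ; ≔-cong    = λ { {_ , s , _ , s≈} {_ , t , _ , t≈} m≈n a≈b p →
        let eq = valueAt-cong s t (C.trans s≈ (C.trans m≈n (C.sym t≈))) p
        in truth-cong (λ s≈a → trans (sym eq) (trans s≈a a≈b))
                      (λ t≈b → trans eq (trans t≈b (sym a≈b))) }
    ; disjoint  = λ (_ , t , t∈ , _) {a} {b} a≉b →
        ≈⊥-pointwise (level-set t (λ ρ ¬gen → t∈ (ρ , ¬gen)) a B.∧ level-set t (λ ρ ¬gen → t∈ (ρ , ¬gen)) b) λ p both →
          let t≈a , t≈b = ∧-true both in a≉b (trans (sym (truth⁻ t≈a)) (truth⁻ t≈b))
    ; cover     = λ (_ , t , _) u eq → ≈⊥-pointwise u λ p u∈ →
        contradiction (≡.trans (≡.sym (≡.cong₂ Bool._∧_ u∈ (truth⁺ refl))) (eq (valueAt t p) p)) λ ()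
    ; ≔-∙       = λ (_ , s , _) (_ , t , _) a b p → Bool.¬-not λ both →
        let st , ¬st = ∧-true both
            s≈a , t≈b = ∧-true st
        in contradiction (≡.trans (≡.sym ¬st) (≡.cong Bool.not
             (truth⁺ (valueAt-∙ s t p (truth⁻ s≈a) (truth⁻ t≈b))))) λ ()
    ; basepoint = λ _ → truth⁺ refl
    ; faithful  = λ { {_ , t , t∈ , t≈} eq → C.trans (C.sym t≈)
        (separation t (λ ρ ¬gen → t∈ (ρ , ¬gen)) λ y →
          truth⁻ (Bool.not-injective (eq (just y)))) }
    ; complete  = λ p p-cong disjoint cover base →
        let t , van , t≈ = realize-clopens p p-cong disjoint cover base
        in (⟪ t ⟫ , t , (λ (ρ , ¬gen) → van ρ ¬gen) , C.refl) , t≈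
    }
    where
    valueAt-cong : ∀ s t → ⟪ s ⟫ C.≈ ⟪ t ⟫ → ∀ p → valueAt s p ≈ valueAt t p
    valueAt-cong s t eq nothing  = refl
    valueAt-cong s t eq (just y) = Ev-hom s t (Point.isHom y) eq
    valueAt-∙ : ∀ s t p {a b} → valueAt s p ≈ a → valueAt t p ≈ b → valueAt (s · t) p ≈ a ∙ b
    valueAt-∙ s t nothing  s≈ t≈ = trans (sym (identityˡ ε)) (∙-cong s≈ t≈)
    valueAt-∙ s t (just y) s≈ t≈ = ∙-cong s≈ t≈

-- Countability: enumerations of pairs, terms and clopen sets

diagonalStep : ℕ × ℕ → ℕ × ℕ
diagonalStep (zero  , y) = suc y , zero
diagonalStep (suc x , y) = x , suc y

unpair : ℕ → ℕ × ℕ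
unpair zero    = 0 , 0
unpair (suc n) = diagonalStep (unpair n)

unpair-surjective : ∀ x y → ∃[ n ] unpair n ≡ (x , y)
unpair-surjective x y = walk (x ℕ.+ y) x y ≡.refl
  where
  -- Follows the antidiagonals backwards: `s` is the sum, which drops when the walk passes from
  -- `(suc x , 0)` to `(0 , x)`.
  walk : ∀ s x y → x ℕ.+ y ≡ s → ∃[ n ] unpair n ≡ (x , y)
  walk s       x       (suc y) eq with n , n≡ ← walk s (suc x) y (≡.trans (≡.sym (ℕ.+-suc x y)) eq) =
    suc n , ≡.cong diagonalStep n≡
  walk (suc s) (suc x) zero    eq with n , n≡ ← walk s zero x (≡.trans (≡.sym (ℕ.+-identityʳ x)) (ℕ.suc-injective eq)) =
    suc n , ≡.cong diagonalStep n≡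
  walk zero    (suc x) zero    ()
  walk s       zero    zero    eq = 0 , ≡.refl

-- The first component of the code is a tag for the constructor. The fuel bounds the depth of the
-- term and makes the recursion structural.
enumerate↓ : ℕ → ℕ → Term
enumerate↓ zero       n = 𝟏
enumerate↓ (suc fuel) n with unpair n
... | 0 , k = var k
... | 1 , k = enumerate↓ fuel (proj₁ (unpair k)) · enumerate↓ fuel (proj₂ (unpair k))
... | 2 , k = enumerate↓ fuel (proj₁ (unpair k)) ⧵ enumerate↓ fuel (proj₂ (unpair k))
... | 3 , k = enumerate↓ fuel (proj₁ (unpair k)) ⧸ enumerate↓ fuel (proj₂ (unpair k))
... | _ , k = 𝟏

depth : Term → ℕ
depth (var i) = 1
depth (s · t) = suc (depth s ⊔ depth t)
depth (s ⧵ t) = suc (depth s ⊔ depth t)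
depth (s ⧸ t) = suc (depth s ⊔ depth t)
depth 𝟏       = 0

enumerate↓-surjective : ∀ t fuel → depth t ≤ fuel → ∃[ n ] enumerate↓ fuel n ≡ t
enumerate↓-surjective 𝟏 zero       _ = 0 , ≡.refl
enumerate↓-surjective 𝟏 (suc fuel) _ with n , n≡ ← unpair-surjective 4 0 = n , lemma
  where
  lemma : enumerate↓ (suc fuel) n ≡ 𝟏
  lemma rewrite n≡ = ≡.refl
enumerate↓-surjective (var i) (suc fuel) _ with n , n≡ ← unpair-surjective 0 i = n , lemma
  where
  lemma : enumerate↓ (suc fuel) n ≡ var i
  lemma rewrite n≡ = ≡.refl
enumerate↓-surjective (s · t) (suc fuel) (s≤s d≤)
  with i , i≡ ← enumerate↓-surjective s fuel (ℕ.≤-trans (ℕ.m≤m⊔n (depth s) (depth t)) d≤)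
     | j , j≡ ← enumerate↓-surjective t fuel (ℕ.≤-trans (ℕ.m≤n⊔m (depth s) (depth t)) d≤)
  with k , k≡ ← unpair-surjective i j
  with n , n≡ ← unpair-surjective 1 k = n , lemma
  where
  lemma : enumerate↓ (suc fuel) n ≡ s · t
  lemma rewrite n≡ | k≡ | i≡ | j≡ = ≡.refl
enumerate↓-surjective (s ⧵ t) (suc fuel) (s≤s d≤)
  with i , i≡ ← enumerate↓-surjective s fuel (ℕ.≤-trans (ℕ.m≤m⊔n (depth s) (depth t)) d≤)
     | j , j≡ ← enumerate↓-surjective t fuel (ℕ.≤-trans (ℕ.m≤n⊔m (depth s) (depth t)) d≤)
  with k , k≡ ← unpair-surjective i j
  with n , n≡ ← unpair-surjective 2 k = n , lemma
  where
  lemma : enumerate↓ (suc fuel) n ≡ s ⧵ t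
  lemma rewrite n≡ | k≡ | i≡ | j≡ = ≡.refl
enumerate↓-surjective (s ⧸ t) (suc fuel) (s≤s d≤)
  with i , i≡ ← enumerate↓-surjective s fuel (ℕ.≤-trans (ℕ.m≤m⊔n (depth s) (depth t)) d≤)
     | j , j≡ ← enumerate↓-surjective t fuel (ℕ.≤-trans (ℕ.m≤n⊔m (depth s) (depth t)) d≤)
  with k , k≡ ← unpair-surjective i j
  with n , n≡ ← unpair-surjective 3 k = n , lemma
  where
  lemma : enumerate↓ (suc fuel) n ≡ s ⧸ t
  lemma rewrite n≡ | k≡ | i≡ | j≡ = ≡.refl

enumerate : ℕ → Term
enumerate n = enumerate↓ (proj₁ (unpair n)) (proj₂ (unpair n))

enumerate-surjective : ∀ t → ∃[ n ] enumerate n ≡ t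
enumerate-surjective t with k , k≡ ← enumerate↓-surjective t (depth t) ℕ.≤-refl
  with n , n≡ ← unpair-surjective (depth t) k =
  n , ≡.trans (≡.cong₂ enumerate↓ (≡.cong proj₁ n≡) (≡.cong proj₂ n≡)) k≡

module CountablePoints
  (em : ∀ {ℓ} → ExcludedMiddle ℓ) (A : Loop 0ℓ 0ℓ) (finite : IsFinite (Loop.setoid A))
  (simple : IsSimple A) (nonAbelian : NonAbelian A)
  (C : Loop 0ℓ 0ℓ) (gens : ℕ → Loop.Carrier C) (C∈V : InVariety (Singleton A) C)
  (generating : Generates C gens) where

  open Loop A
  open SimpleLoop em A finite simple nonAbelian
  open Points em A finite simple nonAbelian C gens C∈V
  open PointAlgebra em A finite simple nonAbelian C gens C∈V generating
  open Point using (env)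
  private
    module B = BooleanAlgebra clopens

  abstract
    -- The function with value `ε` on `f` and a fixed other value off `f` has compact support
    -- because `f` contains infinity, so a term realizes it. Clopen sets that miss infinity are
    -- reached through complements. The quantifier over `van` accommodates the proof that `describe`
    -- obtains from excluded middle.
    zero-set : ∀ f → proj₁ f nothing ≡ true →
               ∃[ t ] Vanishing t × (∀ van → level-set t van ε B.≈ f)
    zero-set (f , n , far , near) f∞ = t , proj₁ (proj₂ realized) , λ van → λ
      { nothing  → ≡.trans (truth⁺ refl) (≡.sym f∞)
      ; (just y) → Bool-extensional
          (λ t≈ε → indicator≈ε (f (just y)) (trans (sym (proj₂ (proj₂ realized) y)) (truth⁻ t≈ε)))
          (λ fy → truth⁺ (trans (proj₂ (proj₂ realized) y) (reflexive (≡.cong indicator fy))))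
      }
      where
      z : Carrier
      z = proj₁ (IsSimple.nontrivial simple)
      indicator : Bool → Carrier
      indicator v = if v then ε else z
      indicator≈ε : ∀ v → indicator v ≈ ε → v ≡ true
      indicator≈ε true  _   = ≡.refl
      indicator≈ε false z≈ε = contradiction z≈ε (proj₂ (IsSimple.nontrivial simple))
      realized : ∃[ t ] Vanishing t × (∀ y → Ev t (env y) ≈ indicator (f (just y)))
      realized = realize (λ y → indicator (f (just y))) n
        (λ {y} {y′} eq → reflexive (≡.cong indicator (near y y′ eq)))
        (λ y ¬gen → reflexive (≡.cong indicator (≡.trans (far y ¬gen) f∞)))
      t : Term
      t = proj₁ realized

  private
    describe : Bool → (t : Term) → Dec (Vanishing t) → Clopen
    describe true  t (yes van) = level-set t van ε
    describe false t (yes van) = B.¬ (level-set t van ε)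
    describe _     t (no _)    = B.⊤

    sign : ℕ → Bool
    sign zero    = true
    sign (suc _) = false

    clopen# : ℕ → Clopen
    clopen# n = describe (sign (proj₁ (unpair n))) (enumerate (proj₂ (unpair n))) em

    describe-zero : ∀ {f} t (van? : Dec (Vanishing t)) → Vanishing t →
                    (∀ van → level-set t van ε B.≈ f) → describe true t van? B.≈ f
    describe-zero t (yes van) _   eq = eq van
    describe-zero t (no ¬van) van eq = contradiction van ¬van

    describe-nonzero : ∀ {f} t (van? : Dec (Vanishing t)) → Vanishing t →
                       (∀ van → level-set t van ε B.≈ B.¬ f) → describe false t van? B.≈ f
    describe-nonzero {f} t (yes van) _ eq p =
      ≡.trans (≡.cong Bool.not (eq van p)) (Bool.not-involutive (proj₁ f p))
    describe-nonzero t (no ¬van) van eq = contradiction van ¬van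

    find : ∀ v t → ∃[ n ] unpair n ≡ (v , proj₁ (enumerate-surjective t))
    find v t = unpair-surjective v (proj₁ (enumerate-surjective t))

    clopen#-find : ∀ v t → clopen# (proj₁ (find v t)) ≡ describe (sign v) t em
    clopen#-find v t = ≡.cong₂ (λ w s → describe (sign w) s em)
      (≡.cong proj₁ (proj₂ (find v t)))
      (≡.trans (≡.cong (λ p → enumerate (proj₂ p)) (proj₂ (find v t))) (proj₂ (enumerate-surjective t)))

    clopen#-surjective : ∀ f → ∃[ n ] clopen# n B.≈ f
    clopen#-surjective f with proj₁ f nothing in f∞
    ... | true  with t , van , eq ← zero-set f f∞ =
      proj₁ (find 0 t) , λ p → ≡.trans (≡.cong (λ g → proj₁ g p) (clopen#-find 0 t))
        (describe-zero {f} t em van eq p)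
    ... | false with t , van , eq ← zero-set (B.¬ f) (≡.cong Bool.not f∞) =
      proj₁ (find 1 t) , λ p → ≡.trans (≡.cong (λ g → proj₁ g p) (clopen#-find 1 t))
        (describe-nonzero {f} t em van eq p)

  clopens-countable : IsCountable B.setoid
  clopens-countable = record
    { to         = clopen#
    ; cong       = λ { ≡.refl p → ≡.refl }
    ; surjective = λ f → proj₁ (clopen#-surjective f) ,
        λ { ≡.refl → proj₂ (clopen#-surjective f) }
    }

-- Back and forth between countable atomless Boolean algebras

module Matching (em : ∀ {ℓ} → ExcludedMiddle ℓ)
  (B₁ B₂ : BooleanAlgebra 0ℓ 0ℓ) (x₁ : Ultrafilter B₁) (x₂ : Ultrafilter B₂) where

  module L = BooleanFacts em B₁
  module R = BooleanFacts em B₂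
  private
    module LB = BooleanAlgebra B₁
    module RB = BooleanAlgebra B₂
    module LP = BooleanAlgebraProperties B₁
    module RP = BooleanAlgebraProperties B₂

  Pairs : Set
  Pairs = List (L.Carrier × R.Carrier)

  -- Corresponding cells of the partitions of u and v generated by the two
  -- components of the pairs are both zero or both nonzero, and both or neither
  -- contain the base point.
  Matched : L.Carrier → R.Carrier → Pairs → Set
  Matched u v []            = ((u L.≈ L.⊥ → v R.≈ R.⊥) × (v R.≈ R.⊥ → u L.≈ L.⊥)) ×
                              ((_∋_ B₁ x₁ u → _∋_ B₂ x₂ v) × (_∋_ B₂ x₂ v → _∋_ B₁ x₁ u))
  Matched u v ((b , β) ∷ P) = Matched (u L.∩ b) (v R.∩ β) P × Matched (u L.∩ L.∁ b) (v R.∩ R.∁ β) P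

  Matched-cong : ∀ P {u u′ v v′} → u L.≈ u′ → v R.≈ v′ → Matched u v P → Matched u′ v′ P
  Matched-cong [] u≈ v≈ ((to , from) , (x-to , x-from)) =
    ((λ u≈⊥ → RB.trans (RB.sym v≈) (to (LB.trans u≈ u≈⊥))) ,
     (λ v≈⊥ → LB.trans (LB.sym u≈) (from (RB.trans v≈ v≈⊥)))) ,
    ((λ u∈ → R.∋-resp x₂ v≈ (x-to (L.∋-resp x₁ (LB.sym u≈) u∈))) ,
     (λ v∈ → L.∋-resp x₁ u≈ (x-from (R.∋-resp x₂ (RB.sym v≈) v∈))))
  Matched-cong (_ ∷ P) u≈ v≈ (m⁺ , m⁻) =
    Matched-cong P (LB.∧-congʳ u≈) (RB.∧-congʳ v≈) m⁺ ,
    Matched-cong P (LB.∧-congʳ u≈) (RB.∧-congʳ v≈) m⁻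

  Matched-⊥ : ∀ P {u v} → u L.≈ L.⊥ → v R.≈ R.⊥ → Matched u v P
  Matched-⊥ [] u≈⊥ v≈⊥ = ((λ _ → v≈⊥) , (λ _ → u≈⊥)) ,
    ((λ u∈ → contradiction u≈⊥ (L.∋-≈⊥ x₁ u∈)) , (λ v∈ → contradiction v≈⊥ (R.∋-≈⊥ x₂ v∈)))
  Matched-⊥ ((b , β) ∷ P) u≈⊥ v≈⊥ =
    Matched-⊥ P (LB.trans (LB.∧-congʳ u≈⊥) (LP.∧-zeroˡ b)) (RB.trans (RB.∧-congʳ v≈⊥) (RP.∧-zeroˡ β)) ,
    Matched-⊥ P (LB.trans (LB.∧-congʳ u≈⊥) (LP.∧-zeroˡ (L.∁ b))) (RB.trans (RB.∧-congʳ v≈⊥) (RP.∧-zeroˡ (R.∁ β)))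

  Matched-forget : ∀ P {u v} → Matched u v P → Matched u v []
  Matched-forget [] m = m
  Matched-forget ((b , β) ∷ P) (m⁺ , m⁻)
    with (to⁺ , from⁺) , (x-to⁺ , x-from⁺) ← Matched-forget P m⁺
       | (to⁻ , from⁻) , (x-to⁻ , x-from⁻) ← Matched-forget P m⁻ =
    ((λ u≈⊥ → R.split-⊥ β
        (to⁺ (LB.trans (LB.∧-congʳ u≈⊥) (LP.∧-zeroˡ b)))
        (to⁻ (LB.trans (LB.∧-congʳ u≈⊥) (LP.∧-zeroˡ (L.∁ b))))) ,
     (λ v≈⊥ → L.split-⊥ b
        (from⁺ (RB.trans (RB.∧-congʳ v≈⊥) (RP.∧-zeroˡ β)))
        (from⁻ (RB.trans (RB.∧-congʳ v≈⊥) (RP.∧-zeroˡ (R.∁ β)))))) ,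
    ((λ u∈ → [ (λ ub∈ → R.∋-∩ˡ x₂ (x-to⁺ ub∈)) , (λ u∁b∈ → R.∋-∩ˡ x₂ (x-to⁻ u∁b∈)) ] (L.∋-split x₁ b u∈)) ,
     (λ v∈ → [ (λ vβ∈ → L.∋-∩ˡ x₁ (x-from⁺ vβ∈)) , (λ v∁β∈ → L.∋-∩ˡ x₁ (x-from⁻ v∁β∈)) ] (R.∋-split x₂ β v∈)))

  -- The partition generated by `P` already refines the splitting by a listed pair: each cell is
  -- kept on both sides or becomes zero on both.
  Matched-restrict : ∀ P {u v b β} → (b , β) ∈ˡ P → Matched u v P →
                     Matched (u L.∩ b) (v R.∩ β) P × Matched (u L.∩ L.∁ b) (v R.∩ R.∁ β) P
  Matched-restrict ((b , β) ∷ P) {u} {v} (here ≡.refl) (m⁺ , m⁻) =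
    (Matched-cong P (L.∩-lowerʳ u b) (R.∩-lowerʳ v β) m⁺ ,
     Matched-⊥ P (L.≼∁⇒∩≈⊥ (≼∁∁ᴸ u b)) (R.≼∁⇒∩≈⊥ (≼∁∁ᴿ v β))) ,
    (Matched-⊥ P (L.≼∁⇒∩≈⊥ (L.∩-lowerʳ u (L.∁ b))) (R.≼∁⇒∩≈⊥ (R.∩-lowerʳ v (R.∁ β))) ,
     Matched-cong P (L.∩-lowerʳ u (L.∁ b)) (R.∩-lowerʳ v (R.∁ β)) m⁻)
    where
    ≼∁∁ᴸ : ∀ u b → u L.∩ b L.≼ L.∁ (L.∁ b)
    ≼∁∁ᴸ u b = L.≼-trans (L.∩-lowerʳ u b) (L.≼-reflexive (LB.sym (LP.¬-involutive b)))
    ≼∁∁ᴿ : ∀ v β → v R.∩ β R.≼ R.∁ (R.∁ β)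
    ≼∁∁ᴿ v β = R.≼-trans (R.∩-lowerʳ v β) (R.≼-reflexive (RB.sym (RP.¬-involutive β)))
  Matched-restrict ((c , γ) ∷ P) {u} {v} {b} {β} (there b∈P) (m⁺ , m⁻)
    with m⁺⁺ , m⁺⁻ ← Matched-restrict P b∈P m⁺
       | m⁻⁺ , m⁻⁻ ← Matched-restrict P b∈P m⁻ =
    (Matched-cong P (swapᴸ u c b) (swapᴿ v γ β) m⁺⁺ ,
     Matched-cong P (swapᴸ u (L.∁ c) b) (swapᴿ v (R.∁ γ) β) m⁻⁺) ,
    (Matched-cong P (swapᴸ u c (L.∁ b)) (swapᴿ v γ (R.∁ β)) m⁺⁻ ,
     Matched-cong P (swapᴸ u (L.∁ c) (L.∁ b)) (swapᴿ v (R.∁ γ) (R.∁ β)) m⁻⁻)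
    where
    swapᴸ : ∀ u b c → (u L.∩ b) L.∩ c L.≈ (u L.∩ c) L.∩ b
    swapᴸ u b c = LB.trans (LB.∧-assoc u b c) (LB.trans (LB.∧-congˡ (LB.∧-comm b c)) (LB.sym (LB.∧-assoc u c b)))
    swapᴿ : ∀ u b c → (u R.∩ b) R.∩ c R.≈ (u R.∩ c) R.∩ b
    swapᴿ u b c = RB.trans (RB.∧-assoc u b c) (RB.trans (RB.∧-congˡ (RB.∧-comm b c)) (RB.sym (RB.∧-assoc u c b)))

  -- Only the traces of the last component and its complement on `v` enter, so a choice made in one
  -- cell may be replaced by an element that agrees with it there.
  Matched-tail : ∀ P {u v b β γ} → v R.∩ β R.≈ v R.∩ γ → v R.∩ R.∁ β R.≈ v R.∩ R.∁ γ →
                 Matched u v (P ++ (b , β) ∷ []) → Matched u v (P ++ (b , γ) ∷ [])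
  Matched-tail [] eq eq′ (m⁺ , m⁻) = Matched-cong [] LB.refl eq m⁺ , Matched-cong [] LB.refl eq′ m⁻
  Matched-tail ((c , δ) ∷ P) {v = v} eq eq′ (m⁺ , m⁻) =
    Matched-tail P (within δ eq) (within δ eq′) m⁺ ,
    Matched-tail P (within (R.∁ δ) eq) (within (R.∁ δ) eq′) m⁻
    where
    within : ∀ δ {β γ} → v R.∩ β R.≈ v R.∩ γ → (v R.∩ δ) R.∩ β R.≈ (v R.∩ δ) R.∩ γ
    within δ {β} {γ} eq = begin
      (v R.∩ δ) R.∩ β    ≈⟨ RB.∧-congʳ (RB.∧-comm v δ) ⟩
      (δ R.∩ v) R.∩ β    ≈⟨ RB.∧-assoc δ v β ⟩
      δ R.∩ (v R.∩ β)    ≈⟨ RB.∧-congˡ eq ⟩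
      δ R.∩ (v R.∩ γ)    ≈⟨ RB.∧-assoc δ v γ ⟨
      (δ R.∩ v) R.∩ γ    ≈⟨ RB.∧-congʳ (RB.∧-comm v δ) ⟨
      (v R.∩ δ) R.∩ γ    ∎
      where open import Relation.Binary.Reasoning.Setoid RB.setoid

  module Extension (countable₂ : IsCountable RB.setoid) (atomless₂ : IsAtomless B₂) where
    private
      module RC = R.Countable countable₂

    -- Atomlessness provides `w` splitting `v`. Its complement splits `v` as well, and exactly one
    -- of the two stands in the prescribed relation to the base point.
    halve : ∀ v → ¬ (v R.≈ R.⊥) → ∀ (Q : Set) →
            ∃[ β ] ¬ (v R.∩ β R.≈ R.⊥) × ¬ (v R.∩ R.∁ β R.≈ R.⊥) × (Q → _∋_ B₂ x₂ β) × (_∋_ B₂ x₂ β → Q)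
    halve v v≉⊥ Q with w , w≼v , w≉⊥ , w≉v ← proj₂ atomless₂ v v≉⊥ = choose em em
      where
      vw≉⊥ : ¬ (v R.∩ w R.≈ R.⊥)
      vw≉⊥ eq = w≉⊥ (RB.trans w≼v (RB.trans (RB.∧-comm w v) eq))
      v∁w≉⊥ : ¬ (v R.∩ R.∁ w R.≈ R.⊥)
      v∁w≉⊥ eq = w≉v (R.≼-antisym w≼v (R.∩∁≈⊥⇒≼ eq))
      v∁∁w≉⊥ : ¬ (v R.∩ R.∁ (R.∁ w) R.≈ R.⊥)
      v∁∁w≉⊥ eq = vw≉⊥ (RB.trans (RB.∧-congˡ (RB.sym (RP.¬-involutive w))) eq)
      choose : Dec Q → Dec (_∋_ B₂ x₂ w) →
        ∃[ β ] ¬ (v R.∩ β R.≈ R.⊥) × ¬ (v R.∩ R.∁ β R.≈ R.⊥) × (Q → _∋_ B₂ x₂ β) × (_∋_ B₂ x₂ β → Q)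
      choose (yes q) (yes w∈) = w , vw≉⊥ , v∁w≉⊥ , (λ _ → w∈) , (λ _ → q)
      choose (yes q) (no w∉)  = R.∁ w , v∁w≉⊥ , v∁∁w≉⊥ , (λ _ → R.∌⇒∋-∁ x₂ w∉) , (λ _ → q)
      choose (no ¬q) (yes w∈) = R.∁ w , v∁w≉⊥ , v∁∁w≉⊥ , (λ q → contradiction q ¬q) ,
        (λ ∁w∈ → contradiction w∈ (R.∋-∁⇒∌ x₂ ∁w∈))
      choose (no ¬q) (no w∉)  = w , vw≉⊥ , v∁w≉⊥ , (λ q → contradiction q ¬q) , (λ w∈ → contradiction w∈ w∉)

    extend-cell : ∀ {u v} → Matched u v [] → ∀ b → ∃[ β ] Matched u v ((b , β) ∷ [])
    extend-cell {u} {v} m@((to , from) , (x-to , x-from)) b with em {P = u L.∩ b L.≈ L.⊥}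
    ... | yes ub≈⊥ = R.⊥ ,
      Matched-⊥ [] ub≈⊥ (RP.∧-zeroʳ v) ,
      Matched-cong [] (L.∩≈⊥⇒≼∁ ub≈⊥) (RB.sym (RB.trans (RB.∧-congˡ RP.¬⊥≈⊤) (RP.∧-identityʳ v))) m
    ... | no ub≉⊥ with em {P = u L.∩ L.∁ b L.≈ L.⊥}
    ... | yes u∁b≈⊥ = R.𝟙 ,
      Matched-cong [] (L.∩∁≈⊥⇒≼ u∁b≈⊥) (R.≼-𝟙 v) m ,
      Matched-⊥ [] u∁b≈⊥ (RB.trans (RB.∧-congˡ RP.¬⊤≈⊥) (RP.∧-zeroʳ v))
    ... | no u∁b≉⊥
      with β , vβ≉⊥ , v∁β≉⊥ , b⇒β , β⇒b ← halve v
             (λ v≈⊥ → ub≉⊥ (LB.trans (LB.∧-congʳ (from v≈⊥)) (LP.∧-zeroˡ b))) (_∋_ B₁ x₁ b) =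
      β ,
      (((λ eq → contradiction eq ub≉⊥) , (λ eq → contradiction eq vβ≉⊥)) ,
       ((λ ub∈ → Ultrafilter.∩-mem x₂ (x-to (L.∋-∩ˡ x₁ ub∈)) (b⇒β (L.∋-∩ʳ x₁ ub∈))) ,
        (λ vβ∈ → Ultrafilter.∩-mem x₁ (x-from (R.∋-∩ˡ x₂ vβ∈)) (β⇒b (R.∋-∩ʳ x₂ vβ∈))))) ,
      (((λ eq → contradiction eq u∁b≉⊥) , (λ eq → contradiction eq v∁β≉⊥)) ,
       ((λ u∁b∈ → Ultrafilter.∩-mem x₂ (x-to (L.∋-∩ˡ x₁ u∁b∈))
          (R.∌⇒∋-∁ x₂ λ β∈ → L.∋-∁⇒∌ x₁ (L.∋-∩ʳ x₁ u∁b∈) (β⇒b β∈))) ,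
        (λ v∁β∈ → Ultrafilter.∩-mem x₁ (x-from (R.∋-∩ˡ x₂ v∁β∈))
          (L.∌⇒∋-∁ x₁ λ b∈ → R.∋-∁⇒∌ x₂ (R.∋-∩ʳ x₂ v∁β∈) (b⇒β b∈)))))

    private
      within : ∀ {w γ δ} → (∀ U → _∋_ B₂ U w → (_∋_ B₂ U γ → _∋_ B₂ U δ) × (_∋_ B₂ U δ → _∋_ B₂ U γ)) →
               w R.∩ δ R.≈ w R.∩ γ × w R.∩ R.∁ δ R.≈ w R.∩ R.∁ γ
      within {w} {γ} {δ} agree =
        RC.≈-by-points
          (λ U m → Ultrafilter.∩-mem U (R.∋-∩ˡ U m) (proj₂ (agree U (R.∋-∩ˡ U m)) (R.∋-∩ʳ U m)))
          (λ U m → Ultrafilter.∩-mem U (R.∋-∩ˡ U m) (proj₁ (agree U (R.∋-∩ˡ U m)) (R.∋-∩ʳ U m))) ,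
        RC.≈-by-points
          (λ U m → Ultrafilter.∩-mem U (R.∋-∩ˡ U m) (R.∌⇒∋-∁ U λ γ∈ →
            R.∋-∁⇒∌ U (R.∋-∩ʳ U m) (proj₁ (agree U (R.∋-∩ˡ U m)) γ∈)))
          (λ U m → Ultrafilter.∩-mem U (R.∋-∩ˡ U m) (R.∌⇒∋-∁ U λ δ∈ →
            R.∋-∁⇒∌ U (R.∋-∩ʳ U m) (proj₂ (agree U (R.∋-∩ˡ U m)) δ∈)))

    -- Partners are found separately in the two cells cut out by the first pair and glued together
    -- by `cond`.
    extend : ∀ P {u v} → Matched u v P → ∀ b → ∃[ β ] Matched u v (P ++ (b , β) ∷ [])
    extend [] m b = extend-cell m b
    extend ((c , γ) ∷ P) {u} {v} (m⁺ , m⁻) b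
      with β⁺ , n⁺ ← extend P m⁺ b | β⁻ , n⁻ ← extend P m⁻ b =
      R.cond γ β⁺ β⁻ ,
      (let eq , eq′ = within {v R.∩ γ} (λ U w∈ → R.∋-cond⁺ U (R.∋-∩ʳ U w∈))
       in Matched-tail P eq eq′ n⁺) ,
      (let eq , eq′ = within {v R.∩ R.∁ γ} (λ U w∈ → R.∋-cond⁻ U (R.∋-∩ʳ U w∈))
       in Matched-tail P eq eq′ n⁻)

module BackAndForth (em : ∀ {ℓ} → ExcludedMiddle ℓ)
  (B₁ B₂ : BooleanAlgebra 0ℓ 0ℓ) (x₁ : Ultrafilter B₁) (x₂ : Ultrafilter B₂)
  (countable₁ : IsCountable (BooleanAlgebra.setoid B₁)) (countable₂ : IsCountable (BooleanAlgebra.setoid B₂))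
  (atomless₁ : IsAtomless B₁) (atomless₂ : IsAtomless B₂) where

  open Matching em B₁ B₂ x₁ x₂
  private
    module Flip = Matching em B₂ B₁ x₂ x₁
    module LB = BooleanAlgebra B₁
    module RB = BooleanAlgebra B₂
    module LC = L.Countable countable₁
    module RC = R.Countable countable₂

  flip-pairs : Pairs → Flip.Pairs
  flip-pairs = List.map swap

  flip : ∀ P {u v} → Matched u v P → Flip.Matched v u (flip-pairs P)
  flip [] ((to , from) , (x-to , x-from)) = (from , to) , (x-from , x-to)
  flip (_ ∷ P) (m⁺ , m⁻) = flip P m⁺ , flip P m⁻

  unflip : ∀ P {u v} → Flip.Matched v u (flip-pairs P) → Matched u v P
  unflip [] ((to , from) , (x-to , x-from)) = (from , to) , (x-from , x-to)
  unflip (_ ∷ P) (m⁺ , m⁻) = unflip P m⁺ , unflip P m⁻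

  extend₁ : ∀ P → Matched L.𝟙 R.𝟙 P → ∀ b → ∃[ β ] Matched L.𝟙 R.𝟙 (P ++ (b , β) ∷ [])
  extend₁ P = Extension.extend countable₂ atomless₂ P

  extend₂ : ∀ P → Matched L.𝟙 R.𝟙 P → ∀ β → ∃[ b ] Matched L.𝟙 R.𝟙 (P ++ (b , β) ∷ [])
  extend₂ P m β with b , m′ ← Flip.Extension.extend countable₁ atomless₁ (flip-pairs P) (flip P m) β =
    b , unflip (P ++ (b , β) ∷ [])
          (≡.subst (Flip.Matched R.𝟙 L.𝟙) (≡.sym (List.map-++ swap P ((b , β) ∷ []))) m′)

  Stage : Set
  Stage = ∃[ P ] Matched L.𝟙 R.𝟙 P

  forth : Stage → L.Carrier → Stage
  forth (P , m) b = _ , proj₂ (extend₁ P m b)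

  back : Stage → R.Carrier → Stage
  back (P , m) β = _ , proj₂ (extend₂ P m β)

  stage : ℕ → Stage
  stage zero    = [] ,
    (((λ 𝟙≈⊥ → contradiction 𝟙≈⊥ (proj₁ atomless₁)) , (λ 𝟙≈⊥ → contradiction 𝟙≈⊥ (proj₁ atomless₂))) ,
     ((λ _ → Ultrafilter.𝟙-mem x₂) , (λ _ → Ultrafilter.𝟙-mem x₁)))
  stage (suc n) = back (forth (stage n) (Surjection.to countable₁ n)) (Surjection.to countable₂ n)

  pairs : ℕ → Pairs
  pairs n = proj₁ (stage n)

  pairs-⊆ : ∀ {m n} → m ≤ n → ∀ {q} → q ∈ˡ pairs m → q ∈ˡ pairs n
  pairs-⊆ {m} {zero}  z≤n q∈ = q∈
  pairs-⊆ {m} {suc n} m≤1+n q∈ with ℕ.m≤n⇒m<n∨m≡n m≤1+n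
  ... | inj₁ m<1+n  = ∈-++⁺ˡ (∈-++⁺ˡ (pairs-⊆ (ℕ.≤-pred m<1+n) q∈))
  ... | inj₂ ≡.refl = q∈

  -- The graph of an isomorphism, closed under `≈` because the enumerations reach elements only up
  -- to `≈`. It is total on both sides by `total₁` and `total₂`.
  Related : L.Carrier → R.Carrier → Set
  Related b β = ∃[ n ] ∃[ b′ ] ∃[ β′ ] b′ L.≈ b × β′ R.≈ β × (b′ , β′) ∈ˡ pairs n

  abstract
    total₁ : ∀ b → ∃[ β ] Related b β
    total₁ b = β , suc n , Surjection.to countable₁ n , β , Surjection.to∘to⁻ countable₁ b , RB.refl ,
      ∈-++⁺ˡ (∈-++⁺ʳ (pairs n) (here ≡.refl))
      where
      n : ℕ
      n = Surjection.to⁻ countable₁ b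
      β : R.Carrier
      β = proj₁ (extend₁ (pairs n) (proj₂ (stage n)) (Surjection.to countable₁ n))

    total₂ : ∀ β → ∃[ b ] Related b β
    total₂ β = partner , suc n , partner , Surjection.to countable₂ n , LB.refl , Surjection.to∘to⁻ countable₂ β ,
      ∈-++⁺ʳ (proj₁ half) (here ≡.refl)
      where
      n : ℕ
      n = Surjection.to⁻ countable₂ β
      half : Stage
      half = forth (stage n) (Surjection.to countable₁ n)
      partner : L.Carrier
      partner = proj₁ (extend₂ (proj₁ half) (proj₂ half) (Surjection.to countable₂ n))

  Literal₁ : Ultrafilter B₁ → Bool → L.Carrier → Set
  Literal₁ U s b = if s then _∋_ B₁ U b else ¬ (_∋_ B₁ U b)

  Literal₂ : Ultrafilter B₂ → Bool → R.Carrier → Set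
  Literal₂ V s β = if s then _∋_ B₂ V β else ¬ (_∋_ B₂ V β)

  private
    literal₁ : Bool → L.Carrier → L.Carrier
    literal₁ s b = if s then b else L.∁ b

    literal₂ : Bool → R.Carrier → R.Carrier
    literal₂ s β = if s then β else R.∁ β

    literal₁-∋ : ∀ {U b b′} s → b′ L.≈ b → _∋_ B₁ U (literal₁ s b′) → Literal₁ U s b
    literal₁-∋ {U} true  eq b∈ = L.∋-resp U eq b∈
    literal₁-∋ {U} false eq ∁b∈ b∈ = L.∋-∁⇒∌ U ∁b∈ (L.∋-resp U (LB.sym eq) b∈)

    literal₂-∋ : ∀ {V β β′} s → β′ R.≈ β → _∋_ B₂ V (literal₂ s β′) → Literal₂ V s β
    literal₂-∋ {V} true  eq β∈ = R.∋-resp V eq β∈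
    literal₂-∋ {V} false eq ∁β∈ β∈ = R.∋-∁⇒∌ V ∁β∈ (R.∋-resp V (RB.sym eq) β∈)

    ∋-literal₁ : ∀ {U b b′} s → b′ L.≈ b → Literal₁ U s b → _∋_ B₁ U (literal₁ s b′)
    ∋-literal₁ {U} true  eq b∈ = L.∋-resp U (LB.sym eq) b∈
    ∋-literal₁ {U} false eq b∉ = L.∌⇒∋-∁ U λ b′∈ → b∉ (L.∋-resp U eq b′∈)

    ∋-literal₂ : ∀ {V β β′} s → β′ R.≈ β → Literal₂ V s β → _∋_ B₂ V (literal₂ s β′)
    ∋-literal₂ {V} true  eq β∈ = R.∋-resp V (RB.sym eq) β∈
    ∋-literal₂ {V} false eq β∉ = R.∌⇒∋-∁ V λ β′∈ → β∉ (R.∋-resp V eq β′∈)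

    restrict : ∀ s {P u v b β} → (b , β) ∈ˡ P → Matched u v P →
               Matched (u L.∩ literal₁ s b) (v R.∩ literal₂ s β) P
    restrict true  {P} q∈ m = proj₁ (Matched-restrict P q∈ m)
    restrict false {P} q∈ m = proj₂ (Matched-restrict P q∈ m)

    module Cell {b₁ b₂ b₃ β₁ β₂ β₃} (r₁ : Related b₁ β₁) (r₂ : Related b₂ β₂) (r₃ : Related b₃ β₃)
      (s₁ s₂ s₃ : Bool) where
      n : ℕ
      n = proj₁ r₁ ⊔ (proj₁ r₂ ⊔ proj₁ r₃)

      c₁ : L.Carrier
      c₁ = ((L.𝟙 L.∩ literal₁ s₁ (proj₁ (proj₂ r₁))) L.∩ literal₁ s₂ (proj₁ (proj₂ r₂)))
           L.∩ literal₁ s₃ (proj₁ (proj₂ r₃))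

      c₂ : R.Carrier
      c₂ = ((R.𝟙 R.∩ literal₂ s₁ (proj₁ (proj₂ (proj₂ r₁)))) R.∩ literal₂ s₂ (proj₁ (proj₂ (proj₂ r₂))))
           R.∩ literal₂ s₃ (proj₁ (proj₂ (proj₂ r₃)))

      cell : Matched c₁ c₂ []
      cell = Matched-forget (pairs n)
        (restrict s₃ (pairs-⊆ (ℕ.≤-trans (ℕ.m≤n⊔m (proj₁ r₂) (proj₁ r₃)) (ℕ.m≤n⊔m (proj₁ r₁) _))
            (proj₂ (proj₂ (proj₂ (proj₂ (proj₂ r₃))))))
          (restrict s₂ (pairs-⊆ (ℕ.≤-trans (ℕ.m≤m⊔n (proj₁ r₂) (proj₁ r₃)) (ℕ.m≤n⊔m (proj₁ r₁) _))
              (proj₂ (proj₂ (proj₂ (proj₂ (proj₂ r₂))))))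
            (restrict s₁ (pairs-⊆ (ℕ.m≤m⊔n (proj₁ r₁) _) (proj₂ (proj₂ (proj₂ (proj₂ (proj₂ r₁))))))
              (proj₂ (stage n)))))

  Absent₁ : (s₁ s₂ s₃ : Bool) → L.Carrier → L.Carrier → L.Carrier → Set₁
  Absent₁ s₁ s₂ s₃ b₁ b₂ b₃ = ∀ U → Literal₁ U s₁ b₁ → Literal₁ U s₂ b₂ → ¬ Literal₁ U s₃ b₃

  Absent₂ : (s₁ s₂ s₃ : Bool) → R.Carrier → R.Carrier → R.Carrier → Set₁
  Absent₂ s₁ s₂ s₃ β₁ β₂ β₃ = ∀ V → Literal₂ V s₁ β₁ → Literal₂ V s₂ β₂ → ¬ Literal₂ V s₃ β₃

  module _ {b₁ b₂ b₃ β₁ β₂ β₃} (r₁ : Related b₁ β₁) (r₂ : Related b₂ β₂) (r₃ : Related b₃ β₃)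
    (s₁ s₂ s₃ : Bool) where
    open Cell r₁ r₂ r₃ s₁ s₂ s₃

    -- A combination of literals realized by no ultrafilter is a zero cell, and matched cells vanish
    -- together. Three literals are what the product law of a valuation takes; statements about
    -- fewer elements repeat one of them.
    transfer : Absent₁ s₁ s₂ s₃ b₁ b₂ b₃ → Absent₂ s₁ s₂ s₃ β₁ β₂ β₃
    transfer absent V l₁ l₂ l₃ = R.∋-≈⊥ V
      (Ultrafilter.∩-mem V (Ultrafilter.∩-mem V (Ultrafilter.∩-mem V (Ultrafilter.𝟙-mem V)
        (∋-literal₂ {V} s₁ (proj₁ (proj₂ (proj₂ (proj₂ (proj₂ r₁))))) l₁))
        (∋-literal₂ {V} s₂ (proj₁ (proj₂ (proj₂ (proj₂ (proj₂ r₂))))) l₂))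
        (∋-literal₂ {V} s₃ (proj₁ (proj₂ (proj₂ (proj₂ (proj₂ r₃))))) l₃))
      (proj₁ (proj₁ cell) (LC.≈⊥-by-points λ U c∈ → absent U
        (literal₁-∋ {U} s₁ (proj₁ (proj₂ (proj₂ (proj₂ r₁)))) (L.∋-∩ʳ U (L.∋-∩ˡ U (L.∋-∩ˡ U c∈))))
        (literal₁-∋ {U} s₂ (proj₁ (proj₂ (proj₂ (proj₂ r₂)))) (L.∋-∩ʳ U (L.∋-∩ˡ U c∈)))
        (literal₁-∋ {U} s₃ (proj₁ (proj₂ (proj₂ (proj₂ r₃)))) (L.∋-∩ʳ U c∈))))

    transfer⁻¹ : Absent₂ s₁ s₂ s₃ β₁ β₂ β₃ → Absent₁ s₁ s₂ s₃ b₁ b₂ b₃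
    transfer⁻¹ absent U l₁ l₂ l₃ = L.∋-≈⊥ U
      (Ultrafilter.∩-mem U (Ultrafilter.∩-mem U (Ultrafilter.∩-mem U (Ultrafilter.𝟙-mem U)
        (∋-literal₁ {U} s₁ (proj₁ (proj₂ (proj₂ (proj₂ r₁)))) l₁))
        (∋-literal₁ {U} s₂ (proj₁ (proj₂ (proj₂ (proj₂ r₂)))) l₂))
        (∋-literal₁ {U} s₃ (proj₁ (proj₂ (proj₂ (proj₂ r₃)))) l₃))
      (proj₂ (proj₁ cell) (RC.≈⊥-by-points λ V c∈ → absent V
        (literal₂-∋ {V} s₁ (proj₁ (proj₂ (proj₂ (proj₂ (proj₂ r₁))))) (R.∋-∩ʳ V (R.∋-∩ˡ V (R.∋-∩ˡ V c∈))))
        (literal₂-∋ {V} s₂ (proj₁ (proj₂ (proj₂ (proj₂ (proj₂ r₂))))) (R.∋-∩ʳ V (R.∋-∩ˡ V c∈)))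
        (literal₂-∋ {V} s₃ (proj₁ (proj₂ (proj₂ (proj₂ (proj₂ r₃))))) (R.∋-∩ʳ V c∈))))

  related-basepoint : ∀ {b β} → Related b β → (_∋_ B₁ x₁ b → _∋_ B₂ x₂ β) × (_∋_ B₂ x₂ β → _∋_ B₁ x₁ b)
  related-basepoint (n , b′ , β′ , b≈ , β≈ , q∈)
    with _ , (to , from) ← Matched-forget (pairs n) (restrict true q∈ (proj₂ (stage n))) =
    (λ b∈ → R.∋-resp x₂ β≈ (R.∋-∩ʳ x₂ (to (Ultrafilter.∩-mem x₁ (Ultrafilter.𝟙-mem x₁) (L.∋-resp x₁ (LB.sym b≈) b∈))))) ,
    (λ β∈ → L.∋-resp x₁ b≈ (L.∋-∩ʳ x₁ (from (Ultrafilter.∩-mem x₂ (Ultrafilter.𝟙-mem x₂) (R.∋-resp x₂ (RB.sym β≈) β∈)))))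

  related-cong : ∀ {b b′ β β′} → Related b β → Related b′ β′ → b L.≈ b′ → β R.≈ β′
  related-cong r r′ b≈b′ = RC.≈-by-points
    (λ V β∈ → decidable-stable em (transfer r r r′ true true false
      (λ U b∈ _ b′∉ → b′∉ (L.∋-resp U b≈b′ b∈)) V β∈ β∈))
    (λ V β′∈ → decidable-stable em (transfer r′ r′ r true true false
      (λ U b′∈ _ b∉ → b∉ (L.∋-resp U (LB.sym b≈b′) b′∈)) V β′∈ β′∈))

  related-cong⁻¹ : ∀ {b b′ β β′} → Related b β → Related b′ β′ → β R.≈ β′ → b L.≈ b′
  related-cong⁻¹ r r′ β≈β′ = LC.≈-by-points
    (λ U b∈ → decidable-stable em (transfer⁻¹ r r r′ true true false
      (λ V β∈ _ β′∉ → β′∉ (R.∋-resp V β≈β′ β∈)) U b∈ b∈))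
    (λ U b′∈ → decidable-stable em (transfer⁻¹ r′ r′ r true true false
      (λ V β′∈ _ β∉ → β∉ (R.∋-resp V (RB.sym β≈β′) β′∈)) U b′∈ b′∈))

  related-disjoint : ∀ {b b′ β β′} → Related b β → Related b′ β′ →
                     b L.∩ b′ L.≈ L.⊥ → β R.∩ β′ R.≈ R.⊥
  related-disjoint r r′ eq = RC.≈⊥-by-points λ V m → transfer r r r′ true true true
    (λ U b∈ _ b′∈ → L.∋-≈⊥ U (Ultrafilter.∩-mem U b∈ b′∈) eq) V (R.∋-∩ˡ V m) (R.∋-∩ˡ V m) (R.∋-∩ʳ V m)

  related-disjoint⁻¹ : ∀ {b b′ β β′} → Related b β → Related b′ β′ →
                       β R.∩ β′ R.≈ R.⊥ → b L.∩ b′ L.≈ L.⊥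
  related-disjoint⁻¹ r r′ eq = LC.≈⊥-by-points λ U m → transfer⁻¹ r r r′ true true true
    (λ V β∈ _ β′∈ → R.∋-≈⊥ V (Ultrafilter.∩-mem V β∈ β′∈) eq) U (L.∋-∩ˡ U m) (L.∋-∩ˡ U m) (L.∋-∩ʳ U m)

  related-⊥ : ∀ {b β} → Related b β → b L.≈ L.⊥ → β R.≈ R.⊥
  related-⊥ r b≈⊥ = RC.≈⊥-by-points λ V β∈ → transfer r r r true true true
    (λ U b∈ _ _ → L.∋-≈⊥ U b∈ b≈⊥) V β∈ β∈ β∈

  related-⊥⁻¹ : ∀ {b β} → Related b β → β R.≈ R.⊥ → b L.≈ L.⊥
  related-⊥⁻¹ r β≈⊥ = LC.≈⊥-by-points λ U b∈ → transfer⁻¹ r r r true true true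
    (λ V β∈ _ _ → R.∋-≈⊥ V β∈ β≈⊥) U b∈ b∈ b∈

  -- The laws of a valuation are built from vanishing conditions on at most three elements and from
  -- membership in the base point, quantified over elements. `Related` preserves these in both
  -- directions and is total on both sides.
  transport : ∀ {N A : Loop 0ℓ 0ℓ} → Valuation N A B₁ x₁ → Valuation N A B₂ x₂
  transport {N} {A} valuation = record
    { [_≔_]     = λ n a → image₂ [ n ≔ a ]
    ; ≔-cong    = λ m≈n a≈b → related-cong (image-related _) (image-related _) (≔-cong m≈n a≈b)
    ; disjoint  = λ n a≉b → related-disjoint (image-related _) (image-related _) (disjoint n a≉b)
    ; cover     = λ n v eq → let u , r = total₂ v in related-⊥ r (cover n u λ a →
        related-disjoint⁻¹ r (image-related _) (eq a))
    ; ≔-∙       = λ m n a b → RC.≈⊥-by-points λ V c∈ →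
        transfer (image-related _) (image-related _) (image-related _) true true false
          (λ U m∈ n∈ mn∉ → L.∋-≈⊥ U
            (Ultrafilter.∩-mem U (Ultrafilter.∩-mem U m∈ n∈) (L.∌⇒∋-∁ U mn∉)) (≔-∙ m n a b))
          V (R.∋-∩ˡ V (R.∋-∩ˡ V c∈)) (R.∋-∩ʳ V (R.∋-∩ˡ V c∈)) (R.∋-∁⇒∌ V (R.∋-∩ʳ V c∈))
    ; basepoint = λ n → proj₁ (related-basepoint (image-related _)) (basepoint n)
    ; faithful  = λ {n} eq → faithful (LC.≈⊥-by-points λ U ∁∈ →
        transfer⁻¹ (image-related [ n ≔ A.ε ]) (image-related _) (image-related _) false false false
          (λ V ∌ _ _ → R.∋-≈⊥ V (R.∌⇒∋-∁ V ∌) eq)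
          U (L.∋-∁⇒∌ U ∁∈) (L.∋-∁⇒∌ U ∁∈) (L.∋-∁⇒∌ U ∁∈))
    ; complete  = λ p p-cong p-disjoint p-cover base →
        let
          preimage : ∀ a → ∃[ b ] Related b (p a)
          preimage a = total₂ (p a)
          n , n≈ = complete (λ a → proj₁ (preimage a))
            (λ {a} {b} a≈b → related-cong⁻¹ (proj₂ (preimage a)) (proj₂ (preimage b)) (p-cong a≈b))
            (λ {a} {b} a≉b → related-disjoint⁻¹ (proj₂ (preimage a)) (proj₂ (preimage b)) (p-disjoint a≉b))
            (λ u eq → let v , r = total₁ u in related-⊥⁻¹ r (p-cover v λ a →
              related-disjoint r (proj₂ (preimage a)) (eq a)))
            (proj₂ (related-basepoint (proj₂ (preimage A.ε))) base)
        in n , λ a → related-cong (image-related _) (proj₂ (preimage a)) (n≈ a)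
    }
    where
    open Valuation valuation
    module A = Loop A
    image₂ : L.Carrier → R.Carrier
    image₂ b = proj₁ (total₁ b)
    image-related : ∀ b → Related b (image₂ b)
    image-related b = proj₂ (total₁ b)

-- The free loop

⟦⟧-var : ∀ {I : Set a} (K : I → Loop c ℓ) t → ⟦_⟧ (FreeLoop K) t var ≡ t
⟦⟧-var K (var i) = ≡.refl
⟦⟧-var K (s · t) = ≡.cong₂ _·_ (⟦⟧-var K s) (⟦⟧-var K t)
⟦⟧-var K (s ⧵ t) = ≡.cong₂ _⧵_ (⟦⟧-var K s) (⟦⟧-var K t)
⟦⟧-var K (s ⧸ t) = ≡.cong₂ _⧸_ (⟦⟧-var K s) (⟦⟧-var K t)
⟦⟧-var K 𝟏       = ≡.refl

FreeLoop-generated : ∀ {I : Set a} (K : I → Loop c ℓ) → Generates (FreeLoop K) var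
FreeLoop-generated K t = t , Loop.reflexive (FreeLoop K) (⟦⟧-var K t)

module FreePoints
  (em : ∀ {ℓ} → ExcludedMiddle ℓ) (A : Loop 0ℓ 0ℓ) (finite : IsFinite (Loop.setoid A))
  (simple : IsSimple A) (nonAbelian : NonAbelian A) where

  open Loop A
  open Evaluation A
  open SimpleLoop em A finite simple nonAbelian
  open Environments em A finite simple nonAbelian

  F : Loop 0ℓ 0ℓ
  F = FreeLoop (Singleton A)

  F∈V : InVariety (Singleton A) F
  F∈V = FreeLoop-inVariety (Singleton A)

  F-generated : Generates F var
  F-generated = FreeLoop-generated (Singleton A)

  open Points em A finite simple nonAbelian F var F∈V
  open Splitting em A finite simple nonAbelian F var F∈V F-generated
  open PointAlgebra em A finite simple nonAbelian F var F∈V F-generated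
  open Point using (env; level)
  private
    module B = BooleanAlgebra clopens

  Ev-⟪⟫ : ∀ t ρ → Ev ⟪ t ⟫ ρ ≈ Ev t ρ
  Ev-⟪⟫ t ρ = reflexive (≡.cong (λ s → Ev s ρ) (⟦⟧-var (Singleton A) t))

  isHom : ∀ ρ → IsHom ρ
  isHom ρ t t≈ε = trans (sym (Ev-⟪⟫ t ρ)) (t≈ε tt ρ)

  -- Lists all elements of `A`, but only after `n` trivial entries: a generating tuple whose prefix
  -- of length `n` generates just the trivial subloop.
  delayed : ℕ → Env
  delayed n i with i ℕ.<? n | (i ℕ.∸ n) ℕ.<? size
  ... | yes _ | _      = ε
  ... | no _  | yes i< = element (fromℕ< i<)
  ... | no _  | no _   = ε

  delayed-origin : ∀ n i → tr n (delayed n) i ≈ origin i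
  delayed-origin n i with i ℕ.<? n
  ... | no _    = refl
  ... | yes i<n with i ℕ.<? n | (i ℕ.∸ n) ℕ.<? size
  ...   | yes _  | _ = refl
  ...   | no i≮n | _ = contradiction i<n i≮n

  delayed-element : ∀ n j → delayed n (n ℕ.+ toℕ j) ≈ element j
  delayed-element n j with (n ℕ.+ toℕ j) ℕ.<? n | (n ℕ.+ toℕ j ℕ.∸ n) ℕ.<? size
  ... | yes n+j<n | _      = contradiction n+j<n (ℕ.m+n≮m n (toℕ j))
  ... | no _      | no j≮  = contradiction
    (≡.subst (_< size) (≡.sym (ℕ.m+n∸m≡n n (toℕ j))) (Fin.toℕ<n j)) j≮
  ... | no _      | yes j< = reflexive (≡.cong element (Fin.toℕ-injective
    (≡.trans (Fin.toℕ-fromℕ< j<) (ℕ.m+n∸m≡n n (toℕ j)))))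

  abstract
    -- Shows that the point at infinity is not isolated.
    late-point : ∀ n → ∃[ y ] ¬ Gen (tr n (env y))
    late-point n with y , y~ ← point-exists {delayed n}
      (λ x → var (n ℕ.+ toℕ (index x)) , trans (delayed-element n (index x)) (element-index x))
      (isHom (delayed n)) = y , λ gen → proj₂ origin-degenerate
        (Gen-cong (delayed-origin n) (proj₁ (gen-⊑ gen (⊑-tr n (proj₁ y~)))))

  module _ (y : Point) (k : ℕ) (level≤k : level y ≤ k) where
    private
      other : ∃[ a ] ¬ (a ≈ env y k)
      other with em {P = env y k ≈ ε} | IsSimple.nontrivial simple
      ... | yes y≈ε | z , z≉ε = z , λ z≈y → z≉ε (trans z≈y y≈ε)
      ... | no y≉ε  | _       = ε , λ ε≈y → y≉ε (sym ε≈y)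

      varied-env : Env
      varied-env i with i ℕ.≟ k
      ... | yes _ = proj₁ other
      ... | no  _ = env y i

      varied-env-agrees : env y ≈[ k ] varied-env
      varied-env-agrees i i<k with i ℕ.≟ k
      ... | yes ≡.refl = contradiction i<k (ℕ.<-irrefl ≡.refl)
      ... | no  _      = refl

      varied-env-differs : ¬ (varied-env k ≈ env y k)
      varied-env-differs eq with k ℕ.≟ k
      ... | yes _  = proj₂ other eq
      ... | no k≢k = k≢k ≡.refl

      tr≈ : ∀ {j} → j ≤ level y → ∀ i → tr j (env y) i ≈ tr j varied-env i
      tr≈ j≤l = tr-cong (≈[]-≤ (ℕ.≤-trans j≤l level≤k) varied-env-agrees)

    abstract
      -- No point is isolated: level, minimality and canonicity depend on the entries below
      -- `level y` alone, and every tuple is a homomorphism on the free loop, so entry `k` may be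
      -- changed at will.
      vary : ∃[ y′ ] env y ≈[ k ] env y′ × ¬ (env y′ k ≈ env y k)
      vary = record
        { env       = varied-env
        ; isHom     = isHom varied-env
        ; level     = level y
        ; generates = Gen-cong (tr≈ ℕ.≤-refl) (Point.generates y)
        ; minimal   = λ j<l gen → Point.minimal y j<l
            (Gen-cong (λ i → sym (tr≈ (ℕ.<⇒≤ j<l) i)) gen)
        ; canonical = λ i → trans (sym (tr≈ ℕ.≤-refl i)) (trans (Point.canonical y i)
            (reflexive (≡.cong (λ σ → σ i) (pick-unique (tuples (level y))
              (⊑-cong (λ _ → refl) (tr≈ ℕ.≤-refl) (λ t eq → eq) ,
               ⊑-cong (tr≈ ℕ.≤-refl) (λ _ → refl) (λ t eq → eq))
              (∈-tuples (level y) (code (level y) (env y))) (decode-~ (level y) (env y))))))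
        } , varied-env-agrees , varied-env-differs

  inhabited : ∀ u → ¬ (u B.≈ B.⊥) → ∃[ y ] proj₁ u (just y) ≡ true
  inhabited u@(f , n , far , _) u≉⊥
    with dne {P = ∃[ p ] f p ≡ true} (λ none → u≉⊥ (≈⊥-pointwise u λ p fp → none (p , fp)))
  ... | just y , fy = y , fy
  ... | nothing , f∞ with y , ¬gen ← late-point n = y , ≡.trans (far y ¬gen) f∞

  clopens-atomless : IsAtomless clopens
  clopens-atomless = (λ eq → contradiction (eq nothing) λ ()) , λ u u≉⊥ →
    let y , uy = inhabited u u≉⊥ in shrink u y uy
    where
    shrink : ∀ u y → proj₁ u (just y) ≡ true →
             ∃[ v ] v B.≈ v B.∧ u × ¬ (v B.≈ B.⊥) × ¬ (v B.≈ u)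
    shrink u@(f , n , far , near) y fy = v ,
      (λ { nothing  → ≡.refl
         ; (just z) → Bool-extensional
             (λ m → ≡.cong₂ Bool._∧_ m (proj₁ (∧-true m))) (λ m → proj₁ (∧-true m)) }) ,
      (λ v≈⊥ → contradiction (≡.trans (≡.sym (≡.cong₂ Bool._∧_ fy (truth⁺ λ _ _ → refl))) (v≈⊥ (just y))) λ ()) ,
      λ v≈u → proj₂ (proj₂ varied) (truth⁻ (proj₂ (∧-true {f (just (proj₁ varied))}
        (≡.trans (v≈u (just (proj₁ varied)))
          (≡.trans (≡.sym (near y (proj₁ varied) (≈[]-≤ (ℕ.m≤m⊔n n (level y)) (proj₁ (proj₂ varied))))) fy))))
        k ℕ.≤-refl)
      where
      k : ℕ
      -- Agreement up to `n` keeps the varied point inside `f`, and `level y` lets coordinate `k`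
      -- vary. The neighbourhood below has length `suc k` and so excludes that point.
      k = n ⊔ level y
      varied : ∃[ y′ ] env y ≈[ k ] env y′ × ¬ (env y′ k ≈ env y k)
      varied = vary y k (ℕ.m≤n⊔m n (level y))
      genk : Gen (tr (suc k) (env y))
      genk = Gen-tr-≤ (env y) (ℕ.≤-trans (ℕ.m≤n⊔m n (level y)) (ℕ.n≤1+n k)) (Point.generates y)
      g : Maybe Point → Bool
      -- Points near `y` share its generating prefix of length `suc k`, so the neighbourhood stays
      -- away from infinity.
      g nothing  = false
      g (just z) = f (just z) Bool.∧ truth (env z ≈[ suc k ] env y)
      v : Clopen
      v = g , suc k ,
        (λ z ¬gen → Bool.¬-not λ m →
          ¬gen (Gen-cong (tr-cong (≈[]-sym (truth⁻ (proj₂ (∧-true {f (just z)} m))))) genk)) ,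
        (λ z z′ eq → ≡.cong₂ Bool._∧_
          (near z z′ (≈[]-≤ (ℕ.≤-trans (ℕ.m≤m⊔n n (level y)) (ℕ.n≤1+n k)) eq))
          (truth-cong (≈[]-trans (≈[]-sym eq)) (≈[]-trans eq)))

  FW : Loop 0ℓ _
  FW = FreeLoop (ProperSubloops A)

  -- Both loops consist of terms, and the map leaves the term unchanged. Terms equal in W agree at
  -- non-generating tuples, so their quotient is vanishing and `fixed-unique` gives injectivity. Any
  -- term becomes a member of `H` through the factor from `fix`, which is trivial in W.
  H≅FW : Subloop.loop H ≅ FW
  H≅FW = proj₁ , record
    { isLoopMonomorphism = record
      { isLoopHomomorphism = record
        { isQuasigroupHomomorphism = record
          { isRelHomomorphism = record
            { cong = λ {(s , _)} {(t , _)} s≈t → W-nonGen s t λ ρ _ → s≈t tt ρ }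
          ; ∙-homo  = λ _ _ _ _ → refl
          ; \\-homo = λ _ _ _ _ → refl
          ; //-homo = λ _ _ _ _ → refl
          }
        ; ε-homo = λ _ _ → refl
        }
      ; injective = λ {(d , s , fs , s≈d)} {(d′ , s′ , fs′ , s′≈d′)} d≈d′ j σ →
          trans (sym (s≈d j σ)) (trans
            (fixed-unique s s′ (s ⧵ s′) fs fs′
              (λ ρ ¬gen → trans (\\-congʳ (begin
                Ev s ρ      ≈⟨ Ev-⟪⟫ s ρ ⟨
                Ev ⟪ s ⟫ ρ  ≈⟨ s≈d tt ρ ⟩
                Ev d ρ      ≈⟨ nonGen-W d d′ d≈d′ ρ ¬gen ⟩
                Ev d′ ρ     ≈⟨ s′≈d′ tt ρ ⟨
                Ev ⟪ s′ ⟫ ρ ≈⟨ Ev-⟪⟫ s′ ρ ⟩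
                Ev s′ ρ     ∎)) (x\\x≈ε (Ev s′ ρ)))
              (λ _ ρ → sym (leftDividesˡ (Ev ⟪ s ⟫ ρ) (Ev ⟪ s′ ⟫ ρ))) j σ)
            (s′≈d′ j σ))
      }
    ; surjective = λ t → let n , van , fixed = fix t in
        (⟪ t · n ⟫ , t · n , fixed , λ _ _ → refl) ,
        λ {(z , _)} z≈ → W-nonGen z t λ ρ ¬gen → trans (z≈ tt ρ) (trans (Ev-⟪⟫ (t · n) ρ)
          (trans (∙-congˡ (van ρ ¬gen)) (identityʳ _)))
    }
    where open import Relation.Binary.Reasoning.Setoid setoid

corollary5p1 : (∀ {ℓ} → ExcludedMiddle ℓ) →
    (A : Loop 0ℓ 0ℓ) → IsFinite (Loop.setoid A) → IsSimple A → NonAbelian A →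
    (Σ[ N ∈ Subloop (FreeLoop (Singleton A)) 0ℓ ]
    Σ[ H ∈ Subloop (FreeLoop (Singleton A)) 0ℓ ]
    (IsNormal N
    × ((B : BooleanAlgebra 0ℓ 0ℓ) →
    IsCountable (BooleanAlgebra.setoid B) → IsAtomless B →
    (x : Ultrafilter B) →
    Subloop.loop N ≅ Subloop.loop (FilteredBooleanPower A B x))
    × (Subloop.loop H ≅ FreeLoop (ProperSubloops A))
    × HasTrivialMeet N H
    × IsFactorization N H))
    ×
    ((C : Loop 0ℓ 0ℓ) → IsCountable (Loop.setoid C) → InVariety (Singleton A) C →
    Σ[ N ∈ Subloop C 0ℓ ] Σ[ H ∈ Subloop C 0ℓ ]
    (IsSplitExtension N H
    × (Σ[ B ∈ BooleanAlgebra 0ℓ 0ℓ ] Σ[ x ∈ Ultrafilter B ]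
    (Subloop.loop N ≅ Subloop.loop (FilteredBooleanPower A B x)))
    × InVariety (ProperSubloops A) (Subloop.loop H)))
corollary5p1 em A finite simple nonAbelian =
  (N , H , N-normal ,
    (λ B countable atomless x →
      Recognition.recognize em (Subloop.loop N) A finite B countable x
        (BackAndForth.transport em clopens B (at nothing) x
          clopens-countable countable clopens-atomless atomless valuation)) ,
    H≅FW , (λ {z} → trivialMeet {z}) , factorization) ,
  λ C countable C∈V →
    let
      gens = Surjection.to countable
      generating : Generates C gens
      generating d = var (Surjection.to⁻ countable d) , Surjection.to∘to⁻ countable d
      module S = Splitting em A finite simple nonAbelian C gens C∈V generating
      module P = PointAlgebra em A finite simple nonAbelian C gens C∈V generating
      module Q = CountablePoints em A finite simple nonAbelian C gens C∈V generating
    in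
    S.N , S.H , (S.N-normal , S.transversal) ,
    (P.clopens , P.at nothing ,
      Recognition.recognize em (Subloop.loop S.N) A finite P.clopens Q.clopens-countable
        (P.at nothing) P.valuation) ,
    S.H∈W
  where
  open FreePoints em A finite simple nonAbelian
  open Splitting em A finite simple nonAbelian F var F∈V F-generated
  open PointAlgebra em A finite simple nonAbelian F var F∈V F-generated
  open CountablePoints em A finite simple nonAbelian F var F∈V F-generated
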